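{- For every integer $\alpha\ge 1$, with $\psi:=\left\lfloor \frac{3^{\alpha+1}}{8}\right\rfloor$ and $\beta:=2\lfloor\alpha/2\rfloor+1$, we have $$\frac{(1+9x)^{\psi}}{3^{\beta}}\cdot L_{\alpha}\in\mathbb{Z}[x],$$ i.e. the $q$-series $3^{ -\beta}(1+9x)^{\psi}L_\alpha$ equals a polynomial in the $q$-series $x$ with integer coefficients.
   Context: Notation: $(a;q)_\infty=\prod_{j\ge 0}(1-aq^j)$, $q=e^{2\pi i\tau}$ with $\tau$ in the upper half plane (or $q$ a formal variable). The function $d_2(n)$ is defined by $\sum_{n\ge 0} d_2(n)q^n=\dfrac{(q^2;q^2)_\infty^{2}}{(q;q)_\infty^{7}}$. Set $$x=q\frac{(q^2;q^2)_\infty(q^6;q^6)_\infty^5}{(q;q)_\infty^5(q^3;q^3)_\infty}.$$ For $\alpha\ge1$ let $\lambda_{2\alpha-1}=\frac{1+5\cdot 3^{2\alpha-1}}{8}$ and $\lambda_{2\alpha}=\frac{1+7\cdot 3^{2\alpha}}{8}$, and define $$L_{2\alpha-1}=\frac{(q^3;q^3)_\infty^7}{(q^6;q^6)_\infty^2}\sum_{n\ge 0} d_2(3^{2\alpha-1}n+\lambda_{2\alpha-1})q^{n+1},\qquad L_{2\alpha}=\frac{(q;q)_\infty^7}{(q^2;q^2)_\infty^2}\sum_{n\ge 0} d_2(3^{2\alpha}n+\lambda_{2\alpha})q^{n+1}.$$ -}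

module Defs where

import Algebra.Properties.CommutativeMonoid.Sum as Sum
open import Data.Fin.Base using (toℕ)
open import Data.Integer.Base as ℤ using (ℤ; 0ℤ; 1ℤ)
open import Data.Integer.Properties using (+-0-commutativeMonoid)
open import Data.List.Base using (List; []; _∷_)
open import Data.Nat.Base as ℕ using (ℕ; zero; suc; _∸_; _/_; parity)
open import Data.Nat.Properties using (m^n≢0)
open import Data.Parity.Base using (0ℙ; 1ℙ)
open import Data.Product.Base using (∃)
open import Data.Rational.Base as ℚ using (ℚ)
open import Relation.Binary.PropositionalEquality.Core using (_≡_)

open Sum +-0-commutativeMonoid using (sum⁺-syntax)

-- Formal power series in q over ℤ, given by their coefficients.

Series : Set
Series = ℕ → ℤ

infixl 6 _+_ _-_
infixl 7 _*_ _÷_ _÷3^_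
infixr 8 _^_
infix  9 q^_
infix  4 _∈ℤ[_]

const : ℤ → Series
const c zero    = c
const c (suc _) = 0ℤ

1# : Series
1# = const 1ℤ

q^_ : ℕ → Series
(q^ zero)  n       = 1# n
(q^ suc k) zero    = 0ℤ
(q^ suc k) (suc n) = (q^ k) n

q : Series
q = q^ 1

_+_ : Series → Series → Series
(f + g) n = f n ℤ.+ g n

_-_ : Series → Series → Series
(f - g) n = f n ℤ.- g n

_*_ : Series → Series → Series
(f * g) n = ∑[ i ≤ n ] (f (toℕ i) ℤ.* g (n ∸ toℕ i))

_^_ : Series → ℕ → Series
f ^ zero  = 1#
f ^ suc k = f * f ^ k

-- The geometric series Σₖ (1 - f)ᵏ. It is the inverse of f when f has constant
-- term 1, the only case used: then (1 - f)ᵏ has order at least k, so the terms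
-- with k > n do not affect the coefficient of qⁿ.

inverse : Series → Series
inverse f n = ∑[ k ≤ n ] (((1# - f) ^ toℕ k) n)

_÷_ : Series → Series → Series
f ÷ g = f * inverse g

partialPochhammer : Series → Series → ℕ → Series
partialPochhammer a b zero    = 1#
partialPochhammer a b (suc N) = partialPochhammer a b N * (1# - a * b ^ N)

-- (a ; b)∞ = ∏_{j ≥ 0} (1 - a bʲ) for b with zero constant term: then a bʲ has
-- order at least j, so the factors with j > n do not affect the coefficient
-- of qⁿ.

⟨_⨾_⟩∞ : Series → Series → Series
⟨ a ⨾ b ⟩∞ n = partialPochhammer a b (suc n) n

E : ℕ → Series
E k = ⟨ q^ k ⨾ q^ k ⟩∞

d₂ : ℕ → ℤ
d₂ = E 2 ^ 2 ÷ E 1 ^ 7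

x : Series
x = q * ((E 2 * E 6 ^ 5) ÷ (E 1 ^ 5 * E 3))

-- The divisions by 8 are exact for α ≥ 1.

λ[_] : ℕ → ℕ
λ[ α ] with parity α
... | 1ℙ = (1 ℕ.+ 5 ℕ.* 3 ℕ.^ α) / 8
... | 0ℙ = (1 ℕ.+ 7 ℕ.* 3 ℕ.^ α) / 8

prefactor : ℕ → Series
prefactor α with parity α
... | 1ℙ = E 3 ^ 7 ÷ E 6 ^ 2
... | 0ℙ = E 1 ^ 7 ÷ E 2 ^ 2

L : ℕ → Series
L α = prefactor α * (q * λ n → d₂ (3 ℕ.^ α ℕ.* n ℕ.+ λ[ α ]))

_÷3^_ : Series → ℕ → (ℕ → ℚ)
(f ÷3^ β) n = (f n ℚ./ (3 ℕ.^ β)) {{m^n≢0 3 β}}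

-- Polynomials over ℤ are lists of coefficients, constant term first.

evaluate : List ℤ → Series → Series
evaluate []       y = const 0ℤ
evaluate (c ∷ cs) y = const c + y * evaluate cs y

-- A power series over ℚ lies in ℤ[y].

_∈ℤ[_] : (ℕ → ℚ) → Series → Set
g ∈ℤ[ y ] = ∃ λ (P : List ℤ) → ∀ n → g n ≡ evaluate P y n ℚ./ 1

{-# OPTIONS --safe #-}
module Submission where

-- L (α + 1) is U₃ (L α) for odd α and U₃ (A · L α) for even α, and L 1 = U₃ A, where U₃ extracts every
-- third coefficient and A = q (q²)²(q⁹)⁷ / ((q)⁷(q¹⁸)²), with (qᵏ) for (qᵏ; qᵏ)∞. By the Jacobi triple
-- product the theta functions φ(-q) and ψ(q) are eta quotients, and their 3-dissections and norms from
-- ℤ[[q]] to ℤ[[q³]] yield a series w with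
--
--   x = w + 3w² + 3w³,  1 + 9x = (1 + 3w)³,  w³ = y(1 + 6w + 12w²) for y = x(q³),
--   A = w(1 + 2w)⁴ / (1 + 3w),  U₃ 1 = 1,  U₃ w = 4x,  U₃ w² = 4x + 48x².
--
-- So U₃ acts on ℤ[w], which is free over ℤ[y] on 1, w, w², by y ↦ x; and since 1 + 3w has norm 1 + 9y,
-- the power of 1 + 9x in the denominator of L α is multiplied by 3 at each step, plus 1 when A is used.
-- For the power of 3, two lattices of polynomials in x, whose coefficients have 3-adic valuation growing
-- with the degree, are exchanged by the two operators, and U₃ gains a factor 9 on one of them. As ℤ[3x]
-- is finite over ℤ[3y], this is a finite computation.

-- The overview leaves open why `w` is the right variable. With `C = q (B/φ₃)³` and `v` the cube
-- root of C(q³), the functions 1 - 2v and 1 + v are, up to series in q³, φ(-q) and ψ(q); so 1 - 8C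
-- and 1 + C, their norms, are known both as sums of cubes and as products. In `v` itself x is only
-- the rational function v(1 - v + v²)/(1 - 2v)³. But `u = 1 - 2v` satisfies u + 2v = 1, so every
-- relation can be made homogeneous in u and v; divided by a power of u it becomes polynomial in
-- `w = v/u`.
--
-- The denominators constrain the lattices. Three k-th powers of 1 + 9y equal (1 + 9x)ᵏ X′ᵏ, where
-- X′ is the product of the other two conjugates of 1 + 9x. The first factor clears the denominator
-- of L α, but X′ᵏ stays inside U₃ and must be absorbed. X′ is a polynomial in x over ℤ[9y], so it
-- suffices that the lattices are modules over ℤ[9x]. The lattice for odd α is not stable under 3x.

open import Defs using
  ( Series; const; 1#; q^_; q; inverse; _÷_; _^_; partialPochhammer; E; d₂; x; λ[_]; prefactor; L
  ; _÷3^_; evaluate; _∈ℤ[_] )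
import Defs
open import Algebra.Bundles using (CommutativeRing)
import Algebra.Properties.CommutativeMonoid.Sum as Sum
import Algebra.Solver.Ring as RingSolver
open import Algebra.Solver.Ring.AlmostCommutativeRing using (fromCommutativeRing; _-Raw-AlmostCommutative⟶_)
open import Algebra.Structures using (IsCommutativeRing)
open import Data.Fin.Base using (Fin; toℕ; zero; suc)
open import Data.Integer.Base as ℤ using (ℤ; +_; -[1+_]; 0ℤ; 1ℤ)
import Data.Integer.DivMod as ℤ
import Data.Integer.Properties as ℤ
import Data.Integer.Tactic.RingSolver as ℤ-Solver
open import Data.List.Base using (List; []; _∷_; drop; length; map)
open import Data.List.Properties using (≡-dec)
open import Data.Maybe.Base using (just; nothing)
open import Data.Nat.Base as ℕ using (ℕ; zero; suc; _≤_; _<_; _∸_; _/_; z≤n; s≤s; parity)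
open import Data.Nat.Divisibility using (n∣m*n)
open import Data.Nat.DivMod using (+-distrib-/-∣ʳ; m*n/n≡m)
import Data.Nat.Properties as ℕ
open import Data.Nat.Tactic.RingSolver using (solve-∀)
open import Data.Parity.Base using (Parity; 0ℙ; 1ℙ)
open import Data.Product.Base using (∃; ∃₂; _×_; _,_; proj₁; proj₂)
open import Data.Rational.Base as ℚ using ()
import Data.Rational.Properties as ℚ
open import Data.Rational.Unnormalised.Base using (mkℚᵘ; *≡*)
open import Data.Sum.Base using (inj₁; inj₂)
open import Data.Unit.Base using (tt)
open import Function.Base using (_∘_)
open import Level using (0ℓ)
open import Relation.Binary.Definitions using (WeaklyDecidable)
open import Relation.Binary.PropositionalEquality.Core using (_≡_; refl; sym; trans; cong; cong₂; subst)
open import Relation.Binary.PropositionalEquality.Properties using (module ≡-Reasoning)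
import Relation.Binary.Reasoning.Setoid as SetoidReasoning
open import Relation.Nullary.Decidable.Core using (True; yes; no; toWitness)

open Sum ℤ.+-0-commutativeMonoid using (sum; sum-cong-≗)

-- Algebras over ℤ

record ℤ-Algebra : Set₁ where
  field
    commutativeRing : CommutativeRing 0ℓ 0ℓ
  open CommutativeRing commutativeRing public
    using
    ( Carrier; setoid; +-cong; +-congˡ; +-congʳ; *-cong; *-congˡ; *-congʳ; -‿cong; *-assoc; *-comm
    ; +-identityˡ; +-identityʳ; *-identityˡ; *-identityʳ; distribˡ; distribʳ; zeroˡ; zeroʳ; -‿inverseʳ
    )
    renaming
    ( _≈_ to _≋_; _+_ to _⊕_; _*_ to _⊛_; -_ to ⊝_; _-_ to _⊖_; 1# to one; 0# to nil
    ; refl to ≋-refl; sym to ≋-sym; trans to ≋-trans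
    )
  field
    ι     : ℤ → Carrier
    ι-+   : ∀ a b → ι (a ℤ.+ b) ≋ ι a ⊕ ι b
    ι-*   : ∀ a b → ι (a ℤ.* b) ≋ ι a ⊛ ι b
    ι-neg : ∀ a → ι (ℤ.- a) ≋ ⊝ ι a
    ι-0   : ι 0ℤ ≋ nil
    ι-1   : ι 1ℤ ≋ one

  private
    morphism : ℤ.+-*-rawRing -Raw-AlmostCommutative⟶ fromCommutativeRing commutativeRing
    morphism = record
      { ⟦_⟧ = ι ; +-homo = ι-+ ; *-homo = ι-* ; -‿homo = ι-neg ; 0-homo = ι-0 ; 1-homo = ι-1 }

    -- Equality in the carrier may be undecidable, so numerals are compared as integers; a failed
    -- comparison asserts nothing.
    coefficient≟ : WeaklyDecidable (λ a b → ι a ≋ ι b)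
    coefficient≟ a b with a ℤ.≟ b
    ... | yes refl = just ≋-refl
    ... | no _     = nothing

  open RingSolver ℤ.+-*-rawRing (fromCommutativeRing commutativeRing) morphism coefficient≟ public
    using (solve; Polynomial; _:+_; _:*_; _:-_; :-_; con; _:=_)

  module ≋-Reasoning = SetoidReasoning setoid

  infixr 8 _↑_

  _↑_ : Carrier → ℕ → Carrier
  f ↑ zero  = one
  f ↑ suc n = f ⊛ f ↑ n

  ↑-cong : ∀ {f g} n → f ≋ g → f ↑ n ≋ g ↑ n
  ↑-cong zero    p = ≋-refl
  ↑-cong (suc n) p = *-cong p (↑-cong n p)

  ↑-+ : ∀ f m n → f ↑ (m ℕ.+ n) ≋ f ↑ m ⊛ f ↑ n
  ↑-+ f zero    n = ≋-sym (*-identityˡ _)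
  ↑-+ f (suc m) n = ≋-trans (*-congˡ (↑-+ f m n)) (≋-sym (*-assoc f (f ↑ m) (f ↑ n)))

  ↑-* : ∀ f m n → f ↑ (m ℕ.* n) ≋ (f ↑ n) ↑ m
  ↑-* f zero    n = ≋-refl
  ↑-* f (suc m) n = ≋-trans (↑-+ f n (m ℕ.* n)) (*-congˡ (↑-* f m n))

  *-↑ : ∀ f g n → (f ⊛ g) ↑ n ≋ f ↑ n ⊛ g ↑ n
  *-↑ f g zero    = ≋-sym (*-identityˡ one)
  *-↑ f g (suc n) = ≋-trans (*-congˡ (*-↑ f g n))
    (solve 4 (λ f g a b → f :* g :* (a :* b) := f :* a :* (g :* b)) ≋-refl f g (f ↑ n) (g ↑ n))

-- Finite sums and products in a ℤ-algebra

module Finite (R : ℤ-Algebra) where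
  open ℤ-Algebra R

  ≡⇒≋ : ∀ {f g} → f ≡ g → f ≋ g
  ≡⇒≋ refl = ≋-refl

  ∑ : ℕ → (ℕ → Carrier) → Carrier
  ∑ zero    t = nil
  ∑ (suc n) t = ∑ n t ⊕ t n

  ∏ : ℕ → (ℕ → Carrier) → Carrier
  ∏ zero    t = one
  ∏ (suc n) t = ∏ n t ⊛ t n

  ∑-cong : ∀ n {s t} → (∀ {k} → k < n → s k ≋ t k) → ∑ n s ≋ ∑ n t
  ∑-cong zero    p = ≋-refl
  ∑-cong (suc n) p = +-cong (∑-cong n (λ k<n → p (ℕ.m<n⇒m<1+n k<n))) (p ℕ.≤-refl)

  ∏-cong : ∀ n {s t} → (∀ k → s k ≋ t k) → ∏ n s ≋ ∏ n t
  ∏-cong zero    p = ≋-refl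
  ∏-cong (suc n) p = *-cong (∏-cong n p) (p n)

  ∑-⊕ : ∀ n s t → ∑ n (λ k → s k ⊕ t k) ≋ ∑ n s ⊕ ∑ n t
  ∑-⊕ zero    s t = ≋-sym (+-identityʳ nil)
  ∑-⊕ (suc n) s t = ≋-trans (+-congʳ (∑-⊕ n s t))
    (solve 4 (λ a b c d → a :+ b :+ (c :+ d) := a :+ c :+ (b :+ d)) ≋-refl (∑ n s) (∑ n t) (s n) (t n))

  ∏-⊛ : ∀ n s t → ∏ n (λ k → s k ⊛ t k) ≋ ∏ n s ⊛ ∏ n t
  ∏-⊛ zero    s t = ≋-sym (*-identityʳ one)
  ∏-⊛ (suc n) s t = ≋-trans (*-congʳ (∏-⊛ n s t))
    (solve 4 (λ a b c d → a :* b :* (c :* d) := a :* c :* (b :* d)) ≋-refl (∏ n s) (∏ n t) (s n) (t n))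

  ⊛-∑ : ∀ c n t → c ⊛ ∑ n t ≋ ∑ n (λ k → c ⊛ t k)
  ⊛-∑ c zero    t = zeroʳ c
  ⊛-∑ c (suc n) t = ≋-trans (distribˡ c (∑ n t) (t n)) (+-congʳ (⊛-∑ c n t))

  ∑-head : ∀ n t → ∑ (suc n) t ≋ t 0 ⊕ ∑ n (t ∘ suc)
  ∑-head zero    t = ≋-trans (+-identityˡ (t 0)) (≋-sym (+-identityʳ (t 0)))
  ∑-head (suc n) t = ≋-trans (+-congʳ (∑-head n t))
    (solve 3 (λ a b c → a :+ b :+ c := a :+ (b :+ c)) ≋-refl (t 0) (∑ n (t ∘ suc)) (t (suc n)))

  ∏-head : ∀ n t → ∏ (suc n) t ≋ t 0 ⊛ ∏ n (t ∘ suc)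
  ∏-head zero    t = ≋-trans (*-identityˡ (t 0)) (≋-sym (*-identityʳ (t 0)))
  ∏-head (suc n) t = ≋-trans (*-congʳ (∏-head n t))
    (solve 3 (λ a b c → a :* b :* c := a :* (b :* c)) ≋-refl (t 0) (∏ n (t ∘ suc)) (t (suc n)))

  ∑-triple : ∀ n t → ∑ (n ℕ.* 3) t ≋
    ∑ n (λ k → t (k ℕ.* 3)) ⊕ ∑ n (λ k → t (1 ℕ.+ k ℕ.* 3)) ⊕ ∑ n (λ k → t (2 ℕ.+ k ℕ.* 3))
  ∑-triple zero    t = ≋-sym (≋-trans (+-identityʳ _) (+-identityʳ nil))
  ∑-triple (suc n) t = ≋-trans (+-congʳ (+-congʳ (+-congʳ (∑-triple n t))))
    (solve 6 (λ a b c x y z → a :+ b :+ c :+ x :+ y :+ z := a :+ x :+ (b :+ y) :+ (c :+ z)) ≋-refl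
      (∑ n (λ k → t (k ℕ.* 3))) (∑ n (λ k → t (1 ℕ.+ k ℕ.* 3))) (∑ n (λ k → t (2 ℕ.+ k ℕ.* 3)))
      (t (n ℕ.* 3)) (t (1 ℕ.+ n ℕ.* 3)) (t (2 ℕ.+ n ℕ.* 3)))

  ∏-double : ∀ n t → ∏ (n ℕ.* 2) t ≋ ∏ n (λ k → t (k ℕ.* 2) ⊛ t (1 ℕ.+ k ℕ.* 2))
  ∏-double zero    t = ≋-refl
  ∏-double (suc n) t = ≋-trans (*-congʳ (*-congʳ (∏-double n t))) (*-assoc _ _ _)

  ∏-triple : ∀ n t → ∏ (n ℕ.* 3) t ≋ ∏ n (λ k → t (k ℕ.* 3) ⊛ t (1 ℕ.+ k ℕ.* 3) ⊛ t (2 ℕ.+ k ℕ.* 3))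
  ∏-triple zero    t = ≋-refl
  ∏-triple (suc n) t = ≋-trans (*-congʳ (*-congʳ (*-congʳ (∏-triple n t))))
    (solve 4 (λ p x y z → p :* x :* y :* z := p :* (x :* y :* z)) ≋-refl
      (∏ n (λ k → t (k ℕ.* 3) ⊛ t (1 ℕ.+ k ℕ.* 3) ⊛ t (2 ℕ.+ k ℕ.* 3))) (t (n ℕ.* 3)) (t (1 ℕ.+ n ℕ.* 3)) (t (2 ℕ.+ n ℕ.* 3)))

  -- triangular c Q n = cⁿ Q^(n(n-1)/2)

  triangular : Carrier → Carrier → ℕ → Carrier
  triangular c Q zero    = one
  triangular c Q (suc n) = triangular c Q n ⊛ (c ⊛ Q ↑ n)

  triangular-cong : ∀ {c c′ Q Q′} n → c ≋ c′ → Q ≋ Q′ → triangular c Q n ≋ triangular c′ Q′ n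
  triangular-cong zero    p r = ≋-refl
  triangular-cong (suc n) p r = *-cong (triangular-cong n p r) (*-cong p (↑-cong n r))

  -- Gaussian binomial coefficients

  module Gaussian (Q : Carrier) where

    -- Defined by a Pascal rule, hence without division. For `k > L` the truncated exponent `L ∸ k`
    -- is wrong but harmless: it multiplies a term that vanishes by `binomial-zero`.
    binomial : ℕ → ℕ → Carrier
    binomial L       zero    = one
    binomial zero    (suc k) = nil
    binomial (suc L) (suc k) = binomial L (suc k) ⊕ Q ↑ (L ∸ k) ⊛ binomial L k

    binomial-zero : ∀ {L k} → L < k → binomial L k ≋ nil
    binomial-zero {zero}  {suc k} _         = ≋-refl
    binomial-zero {suc L} {suc k} (s≤s L<k) = ≋-trans
      (+-cong (binomial-zero (ℕ.m<n⇒m<1+n L<k)) (≋-trans (*-congˡ (binomial-zero L<k)) (zeroʳ _))) (+-identityˡ nil)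

    -- For `k < L` the exponents on both sides add up to L + 1. Beyond that truncated subtraction
    -- spoils the count, but `binomial L (suc k)` is zero.
    binomial-absorb : ∀ L k →
      Q ↑ (L ∸ k) ⊛ (Q ↑ suc k ⊛ binomial L (suc k)) ≋ Q ↑ suc (suc k) ⊛ (Q ↑ (L ∸ suc k) ⊛ binomial L (suc k))
    binomial-absorb L k with ℕ.<-≤-connex k L
    ... | inj₁ k<L = ≋-trans (*-congʳ (≡⇒≋ (cong (Q ↑_) (sym (ℕ.suc-pred (L ∸ k) {{ℕ.>-nonZero (ℕ.m<n⇒0<n∸m k<L)}})))))
      (≋-trans (solve 4 (λ Q x y z → Q :* x :* (y :* z) := Q :* y :* (x :* z)) ≋-refl Q (Q ↑ ℕ.pred (L ∸ k)) (Q ↑ suc k) (binomial L (suc k)))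
        (*-congˡ (*-congʳ (≡⇒≋ (cong (Q ↑_) (ℕ.pred[m∸n]≡m∸[1+n] L k))))))
    ... | inj₂ L≤k = ≋-trans (vanish _ _) (≋-sym (vanish _ _))
      where
      vanish : ∀ x y → x ⊛ (y ⊛ binomial L (suc k)) ≋ nil
      vanish x y = ≋-trans (*-congˡ (≋-trans (*-congˡ (binomial-zero (s≤s L≤k))) (zeroʳ y))) (zeroʳ x)

    -- The second q-Pascal rule, with the power of `Q` on the other summand. In the triple product
    -- the defining rule adds a factor in `a`, this one a factor in `b`.
    binomial-pascal : ∀ L k → binomial (suc L) (suc k) ≋ binomial L k ⊕ Q ↑ suc k ⊛ binomial L (suc k)
    binomial-pascal zero zero = ≋-trans (+-congˡ (*-identityˡ one))
      (≋-trans (+-identityˡ one) (≋-sym (≋-trans (+-congˡ (zeroʳ _)) (+-identityʳ one))))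
    binomial-pascal zero (suc k) = +-congˡ (≋-trans (zeroʳ _) (≋-sym (zeroʳ _)))
    binomial-pascal (suc L) zero = ≋-trans (+-congʳ (binomial-pascal L zero))
      (≋-trans (+-congʳ (+-congˡ (*-congʳ (*-identityʳ Q))))
       (≋-trans (solve 4 (λ e Q b z → e :+ Q :* b :+ Q :* z :* e := e :+ Q :* (b :+ z :* e)) ≋-refl one Q (binomial L 1) (Q ↑ L))
        (+-congˡ (*-congʳ (≋-sym (*-identityʳ Q))))))
    binomial-pascal (suc L) (suc k) = ≋-trans (+-cong (binomial-pascal L (suc k)) (*-congˡ (binomial-pascal L k)))
      (≋-trans (solve 6 (λ a b w c x y → a :+ w :* b :+ x :* (c :+ y :* a) := a :+ x :* (y :* a) :+ (x :* c :+ w :* b)) ≋-refl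
          (binomial L (suc k)) (binomial L (suc (suc k))) (Q ↑ suc (suc k)) (binomial L k) (Q ↑ (L ∸ k)) (Q ↑ suc k))
        (≋-trans (+-congʳ (+-congˡ (binomial-absorb L k)))
          (solve 6 (λ a b w c x z → a :+ w :* (z :* a) :+ (x :* c :+ w :* b) := a :+ x :* c :+ w :* (b :+ z :* a)) ≋-refl
            (binomial L (suc k)) (binomial L (suc (suc k))) (Q ↑ suc (suc k)) (binomial L k) (Q ↑ (L ∸ k)) (Q ↑ (L ∸ suc k)))))

    factorial : ℕ → Carrier
    factorial n = ∏ n (λ j → one ⊖ Q ↑ suc j)

    -- The quotient formula with denominators cleared. The induction step rests on (1 - Q^(j+1)) +
    -- Q^(j+1) (1 - Q^(i+1)) = 1 - Q^(i+j+2).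
    binomial-factorial : ∀ i j → binomial (i ℕ.+ j) i ⊛ (factorial i ⊛ factorial j) ≋ factorial (i ℕ.+ j)
    binomial-factorial zero    j    = ≋-trans (*-identityˡ _) (*-identityˡ _)
    binomial-factorial (suc i) zero = ≋-trans
      (*-congʳ (≋-trans (+-cong (binomial-zero {i ℕ.+ 0} {suc i} (s≤s (ℕ.≤-reflexive (ℕ.+-identityʳ i))))
        (*-congʳ (≡⇒≋ (cong (Q ↑_) (ℕ.m+n∸m≡n i 0))))) (≋-trans (+-identityˡ _) (*-identityˡ _))))
      (≋-trans (solve 4 (λ b f z e → b :* (f :* z :* e) := b :* (f :* e) :* z) ≋-refl
        (binomial (i ℕ.+ 0) i) (factorial i) (one ⊖ Q ↑ suc i) one)
        (*-cong (binomial-factorial i zero) (≡⇒≋ (cong (λ k → one ⊖ Q ↑ suc k) (sym (ℕ.+-identityʳ i))))))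
    binomial-factorial (suc i) (suc j) = begin
      (binomial (i ℕ.+ suc j) (suc i) ⊕ Q ↑ (i ℕ.+ suc j ∸ i) ⊛ binomial (i ℕ.+ suc j) i) ⊛ (factorial (suc i) ⊛ factorial (suc j))
        ≈⟨ *-congʳ (+-congˡ (*-congʳ (≡⇒≋ (cong (Q ↑_) (ℕ.m+n∸m≡n i (suc j)))))) ⟩
      (binomial (i ℕ.+ suc j) (suc i) ⊕ Q ↑ suc j ⊛ binomial (i ℕ.+ suc j) i) ⊛ (factorial (suc i) ⊛ factorial (suc j))
        ≈⟨ solve 7 (λ b b′ w e f g z → (b :+ w :* b′) :* (f :* z :* (g :* (e :- w))) :=
              b :* (f :* z :* g) :* (e :- w) :+ w :* (b′ :* (f :* (g :* (e :- w))) :* z)) ≋-refl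
            (binomial (i ℕ.+ suc j) (suc i)) (binomial (i ℕ.+ suc j) i) (Q ↑ suc j) one (factorial i) (factorial j) (one ⊖ Q ↑ suc i) ⟩
      binomial (i ℕ.+ suc j) (suc i) ⊛ (factorial (suc i) ⊛ factorial j) ⊛ (one ⊖ Q ↑ suc j)
        ⊕ Q ↑ suc j ⊛ (binomial (i ℕ.+ suc j) i ⊛ (factorial i ⊛ factorial (suc j)) ⊛ (one ⊖ Q ↑ suc i))
        ≈⟨ +-cong (*-congʳ (≋-trans (≡⇒≋ (cong (λ l → binomial l (suc i) ⊛ (factorial (suc i) ⊛ factorial j)) (ℕ.+-suc i j)))
              (≋-trans (binomial-factorial (suc i) j) (≡⇒≋ (cong factorial (sym (ℕ.+-suc i j)))))))
            (*-congˡ (*-congʳ (binomial-factorial i (suc j)))) ⟩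
      factorial (i ℕ.+ suc j) ⊛ (one ⊖ Q ↑ suc j) ⊕ Q ↑ suc j ⊛ (factorial (i ℕ.+ suc j) ⊛ (one ⊖ Q ↑ suc i))
        ≈⟨ solve 4 (λ f x y e → f :* (e :- x) :+ x :* (f :* (e :- y)) := f :* (e :- x :+ x :* e :- y :* x)) ≋-refl
            (factorial (i ℕ.+ suc j)) (Q ↑ suc j) (Q ↑ suc i) one ⟩
      factorial (i ℕ.+ suc j) ⊛ (one ⊖ Q ↑ suc j ⊕ Q ↑ suc j ⊛ one ⊖ Q ↑ suc i ⊛ Q ↑ suc j)
        ≈⟨ *-congˡ (+-cong (≋-trans (+-congˡ (*-identityʳ _)) (solve 2 (λ e x → e :- x :+ x := e) ≋-refl one (Q ↑ suc j)))
             (-‿cong (≋-sym (↑-+ Q (suc i) (suc j))))) ⟩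
      factorial (suc i ℕ.+ suc j) ∎
      where open ≋-Reasoning

    expansion : ℕ → (ℕ → Carrier) → Carrier
    expansion L t = ∑ (suc L) (λ k → binomial L k ⊛ t k)

    ∑-binomial-last : ∀ L t → ∑ (suc (suc L)) (λ k → binomial L k ⊛ t k) ≋ expansion L t
    ∑-binomial-last L t = ≋-trans (+-congˡ (≋-trans (*-congʳ (binomial-zero {L} {suc L} ℕ.≤-refl)) (zeroˡ _))) (+-identityʳ _)

    -- One factor of the q-binomial theorem: the ratio condition turns the second summand of the
    -- Pascal rule into `c` times the old sum.
    expansion-sucʳ : ∀ L c t → (∀ {k} → k ≤ L → Q ↑ (L ∸ k) ⊛ t (suc k) ≋ c ⊛ t k) →
                     expansion (suc L) t ≋ (one ⊕ c) ⊛ expansion L t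
    expansion-sucʳ L c t ratio = begin
      ∑ (suc (suc L)) (λ k → binomial (suc L) k ⊛ t k)
        ≈⟨ ∑-head (suc L) _ ⟩
      one ⊛ t 0 ⊕ ∑ (suc L) (λ k → (binomial L (suc k) ⊕ Q ↑ (L ∸ k) ⊛ binomial L k) ⊛ t (suc k))
        ≈⟨ +-congˡ (∑-cong (suc L) λ { {k} (s≤s k≤L) → ≋-trans
             (solve 4 (λ b w b′ t → (b :+ w :* b′) :* t := b :* t :+ b′ :* (w :* t)) ≋-refl (binomial L (suc k)) (Q ↑ (L ∸ k)) (binomial L k) (t (suc k)))
             (+-congˡ (≋-trans (*-congˡ (ratio k≤L)) (solve 3 (λ b c t → b :* (c :* t) := c :* (b :* t)) ≋-refl (binomial L k) c (t k)))) }) ⟩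
      one ⊛ t 0 ⊕ ∑ (suc L) (λ k → binomial L (suc k) ⊛ t (suc k) ⊕ c ⊛ (binomial L k ⊛ t k))
        ≈⟨ +-congˡ (≋-trans (∑-⊕ (suc L) _ _) (+-congˡ (≋-sym (⊛-∑ c (suc L) _)))) ⟩
      one ⊛ t 0 ⊕ (∑ (suc L) (λ k → binomial L (suc k) ⊛ t (suc k)) ⊕ c ⊛ expansion L t)
        ≈⟨ solve 3 (λ a b d → a :+ (b :+ d) := a :+ b :+ d) ≋-refl (one ⊛ t 0) (∑ (suc L) (λ k → binomial L (suc k) ⊛ t (suc k))) (c ⊛ expansion L t) ⟩
      one ⊛ t 0 ⊕ ∑ (suc L) (λ k → binomial L (suc k) ⊛ t (suc k)) ⊕ c ⊛ expansion L t
        ≈⟨ +-congʳ (≋-trans (≋-sym (∑-head (suc L) (λ k → binomial L k ⊛ t k))) (∑-binomial-last L t)) ⟩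
      expansion L t ⊕ c ⊛ expansion L t
        ≈⟨ ≋-sym (≋-trans (distribʳ (expansion L t) one c) (+-congʳ (*-identityˡ _))) ⟩
      (one ⊕ c) ⊛ expansion L t ∎
      where open ≋-Reasoning

    -- With the second Pascal rule both halves become sums over the shifted sequence, so the window
    -- of a bilateral sum grows by one index on the left.
    expansion-sucˡ : ∀ L c t → (∀ k → Q ↑ k ⊛ t k ≋ c ⊛ t (suc k)) →
                     expansion (suc L) t ≋ (one ⊕ c) ⊛ expansion L (t ∘ suc)
    expansion-sucˡ L c t ratio = begin
      ∑ (suc (suc L)) (λ k → binomial (suc L) k ⊛ t k)
        ≈⟨ ∑-head (suc L) _ ⟩
      one ⊛ t 0 ⊕ ∑ (suc L) (λ k → binomial (suc L) (suc k) ⊛ t (suc k))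
        ≈⟨ +-congˡ (≋-trans (∑-cong (suc L) (λ {k} _ → ≋-trans (*-congʳ (binomial-pascal L k)) (distribʳ _ _ _))) (∑-⊕ (suc L) _ _)) ⟩
      one ⊛ t 0 ⊕ (S ⊕ ∑ (suc L) (λ k → Q ↑ suc k ⊛ binomial L (suc k) ⊛ t (suc k)))
        ≈⟨ solve 3 (λ a b d → a :+ (b :+ d) := b :+ (a :+ d)) ≋-refl (one ⊛ t 0) S _ ⟩
      S ⊕ (one ⊛ t 0 ⊕ ∑ (suc L) (λ k → Q ↑ suc k ⊛ binomial L (suc k) ⊛ t (suc k)))
        ≈⟨ +-congˡ (+-congʳ (*-congʳ (≋-sym (*-identityˡ one)))) ⟩
      S ⊕ (one ⊛ one ⊛ t 0 ⊕ ∑ (suc L) (λ k → Q ↑ suc k ⊛ binomial L (suc k) ⊛ t (suc k)))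
        ≈⟨ +-congˡ (≋-sym (∑-head (suc L) (λ k → Q ↑ k ⊛ binomial L k ⊛ t k))) ⟩
      S ⊕ ∑ (suc (suc L)) (λ k → Q ↑ k ⊛ binomial L k ⊛ t k)
        ≈⟨ +-congˡ (∑-cong (suc (suc L)) (λ {k} _ → ≋-trans
             (solve 3 (λ w b t → w :* b :* t := b :* (w :* t)) ≋-refl (Q ↑ k) (binomial L k) (t k))
             (≋-trans (*-congˡ (ratio k)) (solve 3 (λ b c t → b :* (c :* t) := c :* (b :* t)) ≋-refl (binomial L k) c (t (suc k)))))) ⟩
      S ⊕ ∑ (suc (suc L)) (λ k → c ⊛ (binomial L k ⊛ t (suc k)))
        ≈⟨ +-congˡ (≋-trans (≋-sym (⊛-∑ c (suc (suc L)) _)) (*-congˡ (∑-binomial-last L (t ∘ suc)))) ⟩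
      S ⊕ c ⊛ S
        ≈⟨ ≋-sym (≋-trans (distribʳ S one c) (+-congʳ (*-identityˡ _))) ⟩
      (one ⊕ c) ⊛ S ∎
      where
      open ≋-Reasoning
      S : Carrier
      S = expansion L (t ∘ suc)

  -- The finite form of the triple product

  module TripleProduct (a b : Carrier) where

    -- In the usual form `a` is z and `b` is Q/z; with both as parameters no inverse of z occurs.
    Q : Carrier
    Q = a ⊛ b

    open Gaussian Q public

    -- bilateral N k is the term of the theta series of index k - N.

    bilateral : ℕ → ℕ → Carrier
    bilateral zero    k       = triangular a Q k
    bilateral (suc N) zero    = triangular b Q (suc N)
    bilateral (suc N) (suc k) = bilateral N k

    bilateral-zero : ∀ N → bilateral N 0 ≡ triangular b Q N
    bilateral-zero zero    = refl
    bilateral-zero (suc N) = refl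

    bilateral-ratio : ∀ N k → Q ↑ k ⊛ bilateral (suc N) k ≋ (b ⊛ Q ↑ N) ⊛ bilateral N k
    bilateral-ratio N zero = ≋-trans (*-identityˡ _)
      (≋-trans (*-comm _ _) (*-congˡ (≡⇒≋ (sym (bilateral-zero N)))))
    bilateral-ratio zero (suc k) = ≋-trans
      (solve 4 (λ a b z t → a :* b :* z :* t := b :* (t :* (a :* z))) ≋-refl a b (Q ↑ k) (triangular a Q k))
      (*-congʳ (≋-sym (*-identityʳ b)))
    bilateral-ratio (suc N) (suc k) = ≋-trans (*-assoc Q (Q ↑ k) _) (≋-trans (*-congˡ (bilateral-ratio N k))
      (solve 4 (λ Q b z t → Q :* (b :* z :* t) := b :* (Q :* z) :* t) ≋-refl Q b (Q ↑ N) (bilateral N k)))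

    triangular-ratio : ∀ {M k} → k ≤ M → Q ↑ (M ∸ k) ⊛ triangular a Q (suc k) ≋ (a ⊛ Q ↑ M) ⊛ triangular a Q k
    triangular-ratio {M} {k} k≤M = ≋-trans
      (solve 4 (λ w t a z → w :* (t :* (a :* z)) := a :* (w :* z) :* t) ≋-refl (Q ↑ (M ∸ k)) (triangular a Q k) a (Q ↑ k))
      (*-congʳ (*-congˡ (≋-trans (≋-sym (↑-+ Q (M ∸ k) k)) (≡⇒≋ (cong (Q ↑_) (ℕ.m∸n+n≡m k≤M))))))

    expansion-bilateral : ∀ N M → expansion (N ℕ.+ M) (bilateral N) ≋
      ∏ N (λ j → one ⊕ b ⊛ Q ↑ j) ⊛ ∏ M (λ j → one ⊕ a ⊛ Q ↑ j)
    expansion-bilateral zero zero = ≋-trans (+-identityˡ _) ≋-refl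
    expansion-bilateral zero (suc M) = ≋-trans (expansion-sucʳ M (a ⊛ Q ↑ M) (triangular a Q) triangular-ratio)
      (≋-trans (*-congˡ (expansion-bilateral zero M))
        (solve 3 (λ c e p → c :* (e :* p) := e :* (p :* c)) ≋-refl (one ⊕ a ⊛ Q ↑ M) one (∏ M (λ j → one ⊕ a ⊛ Q ↑ j))))
    expansion-bilateral (suc N) M = ≋-trans (expansion-sucˡ (N ℕ.+ M) (b ⊛ Q ↑ N) (bilateral (suc N)) (bilateral-ratio N))
      (≋-trans (*-congˡ (expansion-bilateral N M))
        (solve 3 (λ c p r → c :* (p :* r) := p :* c :* r) ≋-refl (one ⊕ b ⊛ Q ↑ N) (∏ N (λ j → one ⊕ b ⊛ Q ↑ j)) (∏ M (λ j → one ⊕ a ⊛ Q ↑ j))))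

    ∑-bilateral : ∀ N M → ∑ (N ℕ.+ M) (bilateral N) ≋ ∑ N (λ k → triangular b Q (suc k)) ⊕ ∑ M (triangular a Q)
    ∑-bilateral zero    M = ≋-sym (+-identityˡ _)
    ∑-bilateral (suc N) M = ≋-trans (∑-head (N ℕ.+ M) (bilateral (suc N))) (≋-trans (+-congˡ (∑-bilateral N M))
      (solve 3 (λ t s r → t :+ (s :+ r) := s :+ t :+ r) ≋-refl (triangular b Q (suc N)) (∑ N (λ k → triangular b Q (suc k))) (∑ M (triangular a Q))))

  -- The terms of index k and -k-1 of the theta series f(a, b).

  thetaTerm : Carrier → Carrier → ℕ → Carrier
  thetaTerm a b k = triangular a (a ⊛ b) k ⊕ triangular b (a ⊛ b) (suc k)

  cube : Carrier → Carrier
  cube a = a ⊛ a ⊛ a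

  -- Theta terms by the residue of the index modulo 3

  module _ (a b : Carrier) where

    private
      Q : Carrier
      Q = a ⊛ b

    ↑-ninth : ∀ {Q₉} → Q₉ ≋ cube (cube Q) → ∀ k → Q₉ ↑ k ≋ cube (Q ↑ (k ℕ.* 3))
    ↑-ninth {Q₉} p k = begin
      Q₉ ↑ k                                        ≈⟨ ↑-cong k p ⟩
      cube (cube Q) ↑ k                             ≈⟨ ≋-trans (*-↑ (cube Q ⊛ cube Q) (cube Q) k) (*-congʳ (*-↑ (cube Q) (cube Q) k)) ⟩
      cube (cube Q ↑ k)                             ≈⟨ cube-cong cube-↑ ⟩
      cube (Q ↑ (k ℕ.* 3))                          ∎
      where
      open ≋-Reasoning
      cube-cong : ∀ {f g} → f ≋ g → cube f ≋ cube g
      cube-cong p = *-cong (*-cong p p) p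

      cube-↑ : cube Q ↑ k ≋ Q ↑ (k ℕ.* 3)
      cube-↑ = ≋-trans (↑-cong k (≋-trans (*-assoc Q Q Q) (*-congˡ (*-congˡ (≋-sym (*-identityʳ Q)))))) (≋-sym (↑-* Q k 3))

    -- Since 3k(3k-1)/2 = 9·k(k-1)/2 + 3k, the quadratic part has base Q⁹ and the linear part base
    -- (aQ)³ = a⁶b³.
    triangular-section₀ : ∀ {c Q₉} → c ≋ cube a ⊛ cube a ⊛ cube b → Q₉ ≋ cube (cube Q) → ∀ k →
                          triangular a Q (k ℕ.* 3) ≋ triangular c Q₉ k
    triangular-section₀ p r zero = ≋-refl
    triangular-section₀ p r (suc k) = ≋-trans
      (solve 4 (λ a b y t → t :* (a :* y) :* (a :* (a :* b :* y)) :* (a :* (a :* b :* (a :* b :* y))) :=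
          t :* (a :* a :* a :* (a :* a :* a) :* (b :* b :* b) :* (y :* y :* y))) ≋-refl a b (Q ↑ (k ℕ.* 3)) (triangular a Q (k ℕ.* 3)))
      (*-cong (triangular-section₀ p r k) (*-cong (≋-sym p) (≋-sym (↑-ninth r k))))

    triangular-section₁ : ∀ {c Q₉} → c ≋ cube (cube a) ⊛ (cube b ⊛ cube b) → Q₉ ≋ cube (cube Q) → ∀ k →
                          triangular a Q (1 ℕ.+ k ℕ.* 3) ≋ a ⊛ triangular c Q₉ k
    triangular-section₁ p r zero = *-identityˡ _
    triangular-section₁ p r (suc k) = ≋-trans
      (solve 4 (λ a b y t → t :* (a :* (a :* b :* y)) :* (a :* (a :* b :* (a :* b :* y))) :* (a :* (a :* b :* (a :* b :* (a :* b :* y)))) :=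
          t :* (a :* a :* a :* (a :* a :* a) :* (a :* a :* a) :* (b :* b :* b :* (b :* b :* b)) :* (y :* y :* y))) ≋-refl
        a b (Q ↑ (k ℕ.* 3)) (triangular a Q (1 ℕ.+ k ℕ.* 3)))
      (≋-trans (*-cong (triangular-section₁ p r k) (*-cong (≋-sym p) (≋-sym (↑-ninth r k)))) (*-assoc _ _ _))

    -- Here the exponent of Q is 9·(k+1)k/2 + 1 and a²Q = a³b, which completes the term to index
    -- `suc k`. So these positive indices form the negative half of the component with prefactor
    -- `b`.
    triangular-section₂ : ∀ {c Q₉} → c ≋ cube a → Q₉ ≋ cube (cube Q) → ∀ k →
                          triangular a Q (2 ℕ.+ k ℕ.* 3) ≋ b ⊛ triangular c Q₉ (suc k)
    triangular-section₂ {c} p r zero = ≋-trans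
      (*-cong (≋-trans (*-identityˡ _) (*-identityʳ a)) (*-congˡ (*-identityʳ Q)))
      (≋-trans (solve 2 (λ a b → a :* (a :* (a :* b)) := b :* (a :* a :* a)) ≋-refl a b)
        (*-congˡ (≋-sym (≋-trans (*-identityˡ _) (≋-trans (*-identityʳ c) p)))))
    triangular-section₂ {c} {Q₉} p r (suc k) = ≋-trans
      (solve 4 (λ a b y t → t :* (a :* (a :* b :* (a :* b :* y))) :* (a :* (a :* b :* (a :* b :* (a :* b :* y))))
                              :* (a :* (a :* b :* (a :* b :* (a :* b :* (a :* b :* y))))) :=
          t :* (a :* a :* a :* (a :* b :* (a :* b) :* (a :* b) :* (a :* b :* (a :* b) :* (a :* b)) :* (a :* b :* (a :* b) :* (a :* b)) :* (y :* y :* y)))) ≋-refl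
        a b (Q ↑ (k ℕ.* 3)) (triangular a Q (2 ℕ.+ k ℕ.* 3)))
      (≋-trans (*-cong (triangular-section₂ p r k) (*-cong (≋-sym p) (*-cong (≋-sym r) (≋-sym (↑-ninth r k))))) (*-assoc _ _ _))

  -- The finite form of the 3-dissection of Ramanujan's f(a, b). As `thetaTerm` pairs the indices k
  -- and -k-1, which lie in different classes modulo 3, the halves have to be matched crosswise.
  ∑-thetaTerm-triple : ∀ a b n → ∑ (n ℕ.* 3) (thetaTerm a b) ≋
    ∑ n (thetaTerm (cube a ⊛ cube a ⊛ cube b) (cube b ⊛ cube b ⊛ cube a))
      ⊕ a ⊛ ∑ n (thetaTerm (cube (cube a) ⊛ (cube b ⊛ cube b)) (cube b))
      ⊕ b ⊛ ∑ n (thetaTerm (cube (cube b) ⊛ (cube a ⊛ cube a)) (cube a))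
  ∑-thetaTerm-triple a b n = begin
    ∑ (n ℕ.* 3) (thetaTerm a b)
      ≈⟨ ∑-triple n (thetaTerm a b) ⟩
    ∑ n (λ k → thetaTerm a b (k ℕ.* 3)) ⊕ ∑ n (λ k → thetaTerm a b (1 ℕ.+ k ℕ.* 3)) ⊕ ∑ n (λ k → thetaTerm a b (2 ℕ.+ k ℕ.* 3))
      ≈⟨ ≋-sym (≋-trans (∑-⊕ n _ _) (+-congʳ (∑-⊕ n _ _))) ⟩
    ∑ n (λ k → thetaTerm a b (k ℕ.* 3) ⊕ thetaTerm a b (1 ℕ.+ k ℕ.* 3) ⊕ thetaTerm a b (2 ℕ.+ k ℕ.* 3))
      ≈⟨ ∑-cong n (λ {k} _ → regroup k) ⟩
    ∑ n (λ k → thetaTerm A₀ B₀ k ⊕ a ⊛ thetaTerm A₁ (cube b) k ⊕ b ⊛ thetaTerm B₁ (cube a) k)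
      ≈⟨ ≋-trans (∑-⊕ n _ _) (+-cong (≋-trans (∑-⊕ n _ _) (+-congˡ (≋-sym (⊛-∑ a n _)))) (≋-sym (⊛-∑ b n _))) ⟩
    ∑ n (thetaTerm A₀ B₀) ⊕ a ⊛ ∑ n (thetaTerm A₁ (cube b)) ⊕ b ⊛ ∑ n (thetaTerm B₁ (cube a)) ∎
    where
    open ≋-Reasoning
    A₀ B₀ A₁ B₁ : Carrier
    A₀ = cube a ⊛ cube a ⊛ cube b
    B₀ = cube b ⊛ cube b ⊛ cube a
    A₁ = cube (cube a) ⊛ (cube b ⊛ cube b)
    B₁ = cube (cube b) ⊛ (cube a ⊛ cube a)

    Q : Carrier
    Q = a ⊛ b

    flip : ∀ k → triangular b Q k ≋ triangular b (b ⊛ a) k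
    flip k = triangular-cong k ≋-refl (*-comm a b)

    ninth₀ : (cube a ⊛ cube a ⊛ cube b) ⊛ (cube b ⊛ cube b ⊛ cube a) ≋ cube (cube Q)
    ninth₀ = solve 2 (λ a b → let c = λ x → x :* x :* x in
      (c a :* c a :* c b) :* (c b :* c b :* c a) := c (c (a :* b))) ≋-refl a b

    ninth₁ : ∀ a b → (cube (cube a) ⊛ (cube b ⊛ cube b)) ⊛ cube b ≋ cube (cube (a ⊛ b))
    ninth₁ = solve 2 (λ a b → let c = λ x → x :* x :* x in
      c (c a) :* (c b :* c b) :* c b := c (c (a :* b))) ≋-refl

    swap′ : ∀ {z} → z ≋ cube (cube (b ⊛ a)) → z ≋ cube (cube Q)
    swap′ p = ≋-trans p (solve 2 (λ a b → let c = λ x → x :* x :* x in c (c (b :* a)) := c (c (a :* b))) ≋-refl a b)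

    swap : ∀ {z} → z ≋ cube (cube Q) → z ≋ cube (cube (b ⊛ a))
    swap p = ≋-trans p (solve 2 (λ a b → let c = λ x → x :* x :* x in c (c (a :* b)) := c (c (b :* a))) ≋-refl a b)

    regroup : ∀ k → thetaTerm a b (k ℕ.* 3) ⊕ thetaTerm a b (1 ℕ.+ k ℕ.* 3) ⊕ thetaTerm a b (2 ℕ.+ k ℕ.* 3) ≋
                    thetaTerm A₀ B₀ k ⊕ a ⊛ thetaTerm A₁ (cube b) k ⊕ b ⊛ thetaTerm B₁ (cube a) k
    regroup k = ≋-trans
      (+-cong (+-cong
          (+-cong (triangular-section₀ a b ≋-refl ninth₀ k) (≋-trans (flip (1 ℕ.+ k ℕ.* 3)) (triangular-section₁ b a ≋-refl (ninth₁ b a) k)))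
          (+-cong (triangular-section₁ a b ≋-refl (ninth₁ a b) k) (≋-trans (flip (2 ℕ.+ k ℕ.* 3)) (triangular-section₂ b a ≋-refl (swap (ninth₁ a b)) k))))
          (+-cong (triangular-section₂ a b ≋-refl (swap′ (ninth₁ b a)) k) (≋-trans (flip (suc k ℕ.* 3)) (triangular-section₀ b a ≋-refl (swap ninth₀) (suc k)))))
      (solve 8 (λ a b s t u v w z → s :+ b :* t :+ (a :* u :+ a :* v) :+ (b :* w :+ z) := s :+ z :+ a :* (u :+ v) :+ b :* (t :+ w)) ≋-refl
        a b _ _ _ _ _ _)

-- The ring of formal power series

infix 4 _≋_

record _≋_ (f g : Series) : Set where
  constructor pointwise
  infixl 9 _at_
  field _at_ : ∀ n → f n ≡ g n

open _≋_

tail : Series → Series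
tail f n = f (suc n)

scale : ℤ → Series → Series
scale c f n = c ℤ.* f n

module Convolution where
  open Defs using (_+_; _*_)

  *-local : ∀ n {f f′ g g′ : Series} → (∀ {i} → i ≤ n → f i ≡ f′ i) → (∀ {i} → i ≤ n → g i ≡ g′ i) →
            (f * g) n ≡ (f′ * g′) n
  *-local zero    p q = cong₂ (λ a b → a ℤ.* b ℤ.+ 0ℤ) (p z≤n) (q z≤n)
  *-local (suc n) p q = cong₂ ℤ._+_ (cong₂ ℤ._*_ (p z≤n) (q ℕ.≤-refl))
    (*-local n (λ i≤n → p (s≤s i≤n)) (λ i≤n → q (ℕ.m≤n⇒m≤1+n i≤n)))

  -- By computation the convolution unfolds along its left factor; this is the mirror rule, and the
  -- two together give commutativity by induction.
  *-tailʳ : ∀ f g n → (f * g) (suc n) ≡ f (suc n) ℤ.* g 0 ℤ.+ (f * tail g) n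
  *-tailʳ f g zero    = lemma (f 0) (g 1) (f 1) (g 0)
    where
    lemma : ∀ a b c d → a ℤ.* b ℤ.+ (c ℤ.* d ℤ.+ 0ℤ) ≡ c ℤ.* d ℤ.+ (a ℤ.* b ℤ.+ 0ℤ)
    lemma = ℤ-Solver.solve-∀
  *-tailʳ f g (suc n) = trans (cong (ℤ._+_ (f 0 ℤ.* g (suc (suc n)))) (*-tailʳ (tail f) g n))
    (lemma (f 0 ℤ.* g (suc (suc n))) (f (suc (suc n)) ℤ.* g 0) ((tail f * tail g) n))
    where
    lemma : ∀ a b c → a ℤ.+ (b ℤ.+ c) ≡ b ℤ.+ (a ℤ.+ c)
    lemma = ℤ-Solver.solve-∀

  *-commutative : ∀ f g n → (f * g) n ≡ (g * f) n
  *-commutative f g zero    = cong (ℤ._+ 0ℤ) (ℤ.*-comm (f 0) (g 0))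
  *-commutative f g (suc n) = trans
    (cong₂ ℤ._+_ (ℤ.*-comm (f 0) (g (suc n))) (*-commutative (tail f) g n))
    (sym (*-tailʳ g f n))

  *-distribʳ : ∀ h f g n → ((f + g) * h) n ≡ (f * h) n ℤ.+ (g * h) n
  *-distribʳ h f g zero    = lemma (f 0) (g 0) (h 0)
    where
    lemma : ∀ a b c → (a ℤ.+ b) ℤ.* c ℤ.+ 0ℤ ≡ a ℤ.* c ℤ.+ 0ℤ ℤ.+ (b ℤ.* c ℤ.+ 0ℤ)
    lemma = ℤ-Solver.solve-∀
  *-distribʳ h f g (suc n) = trans
    (cong (ℤ._+_ ((f 0 ℤ.+ g 0) ℤ.* h (suc n))) (*-distribʳ h (tail f) (tail g) n))
    (lemma (f 0) (g 0) (h (suc n)) ((tail f * h) n) ((tail g * h) n))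
    where
    lemma : ∀ a b c d e → (a ℤ.+ b) ℤ.* c ℤ.+ (d ℤ.+ e) ≡ a ℤ.* c ℤ.+ d ℤ.+ (b ℤ.* c ℤ.+ e)
    lemma = ℤ-Solver.solve-∀

  scale-* : ∀ c f g n → (scale c f * g) n ≡ c ℤ.* (f * g) n
  scale-* c f g zero    = lemma c (f 0) (g 0)
    where
    lemma : ∀ c a b → c ℤ.* a ℤ.* b ℤ.+ 0ℤ ≡ c ℤ.* (a ℤ.* b ℤ.+ 0ℤ)
    lemma = ℤ-Solver.solve-∀
  scale-* c f g (suc n) = trans
    (cong (ℤ._+_ (c ℤ.* f 0 ℤ.* g (suc n))) (scale-* c (tail f) g n))
    (lemma c (f 0) (g (suc n)) ((tail f * g) n))
    where
    lemma : ∀ c a b d → c ℤ.* a ℤ.* b ℤ.+ c ℤ.* d ≡ c ℤ.* (a ℤ.* b ℤ.+ d)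
    lemma = ℤ-Solver.solve-∀

  *-associative : ∀ f g h n → (f * g * h) n ≡ (f * (g * h)) n
  *-associative f g h zero    = lemma (f 0) (g 0) (h 0)
    where
    lemma : ∀ a b c → (a ℤ.* b ℤ.+ 0ℤ) ℤ.* c ℤ.+ 0ℤ ≡ a ℤ.* (b ℤ.* c ℤ.+ 0ℤ) ℤ.+ 0ℤ
    lemma = ℤ-Solver.solve-∀
  *-associative f g h (suc n) = begin
    -- The left factor of the second product is the tail of `f * g`, by computation.
    (f 0 ℤ.* g 0 ℤ.+ 0ℤ) ℤ.* h (suc n) ℤ.+ ((scale (f 0) (tail g) + tail f * g) * h) n
      ≡⟨ cong (ℤ._+_ ((f 0 ℤ.* g 0 ℤ.+ 0ℤ) ℤ.* h (suc n))) (*-distribʳ h (scale (f 0) (tail g)) (tail f * g) n) ⟩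
    (f 0 ℤ.* g 0 ℤ.+ 0ℤ) ℤ.* h (suc n) ℤ.+ ((scale (f 0) (tail g) * h) n ℤ.+ (tail f * g * h) n)
      ≡⟨ cong (ℤ._+_ ((f 0 ℤ.* g 0 ℤ.+ 0ℤ) ℤ.* h (suc n)))
           (cong₂ ℤ._+_ (scale-* (f 0) (tail g) h n) (*-associative (tail f) g h n)) ⟩
    (f 0 ℤ.* g 0 ℤ.+ 0ℤ) ℤ.* h (suc n) ℤ.+ (f 0 ℤ.* (tail g * h) n ℤ.+ (tail f * (g * h)) n)
      ≡⟨ lemma (f 0) (g 0) (h (suc n)) ((tail g * h) n) ((tail f * (g * h)) n) ⟩
    f 0 ℤ.* (g 0 ℤ.* h (suc n) ℤ.+ (tail g * h) n) ℤ.+ (tail f * (g * h)) n ∎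
    where
    open ≡-Reasoning
    lemma : ∀ a b c d e → (a ℤ.* b ℤ.+ 0ℤ) ℤ.* c ℤ.+ (a ℤ.* d ℤ.+ e) ≡ a ℤ.* (b ℤ.* c ℤ.+ d) ℤ.+ e
    lemma = ℤ-Solver.solve-∀

  const-0 : ∀ n → const 0ℤ n ≡ 0ℤ
  const-0 zero    = refl
  const-0 (suc n) = refl

  zero-* : ∀ f n → (const 0ℤ * f) n ≡ 0ℤ
  zero-* f zero    = refl
  zero-* f (suc n) = trans (ℤ.+-identityˡ _) (trans (*-local n {g = f} (λ {i} _ → sym (const-0 i)) (λ _ → refl)) (zero-* f n))

  const-* : ∀ c f n → (const c * f) n ≡ c ℤ.* f n
  const-* c f zero    = ℤ.+-identityʳ _
  const-* c f (suc n) = trans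
    (cong (ℤ._+_ (c ℤ.* f (suc n))) (trans (*-local n {g = f} (λ {i} _ → sym (const-0 i)) (λ _ → refl)) (zero-* f n)))
    (ℤ.+-identityʳ _)

open Convolution

-- The ring operations are sealed: unfolding them into coefficients would block unification.

infixl 6 _⊕_
infixl 7 _⊛_
infix  8 ⊝_

opaque
  _⊕_ _⊛_ : Series → Series → Series
  _⊕_ = Defs._+_
  _⊛_ = Defs._*_

  ⊝_ : Series → Series
  (⊝ f) n = ℤ.- f n

  ⊕-at : ∀ f g n → (f ⊕ g) n ≡ f n ℤ.+ g n
  ⊕-at f g n = refl

  ⊝-at : ∀ f n → (⊝ f) n ≡ ℤ.- f n
  ⊝-at f n = refl

  +≋⊕ : ∀ f g → f Defs.+ g ≋ f ⊕ g
  +≋⊕ f g = pointwise λ _ → refl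

  -≋⊖ : ∀ f g → f Defs.- g ≋ f ⊕ ⊝ g
  -≋⊖ f g = pointwise λ _ → refl

  *≋⊛ : ∀ f g → f Defs.* g ≋ f ⊛ g
  *≋⊛ f g = pointwise λ _ → refl

  ⊛-at-zero : ∀ f g → (f ⊛ g) 0 ≡ f 0 ℤ.* g 0
  ⊛-at-zero f g = ℤ.+-identityʳ _

  ⊛-at-suc : ∀ f g n → (f ⊛ g) (suc n) ≡ f 0 ℤ.* g (suc n) ℤ.+ (tail f ⊛ g) n
  ⊛-at-suc f g n = refl

  const-⊛ : ∀ c f n → (const c ⊛ f) n ≡ c ℤ.* f n
  const-⊛ = const-*

  ⊛-local : ∀ n {f f′ g g′} → (∀ {i} → i ≤ n → f i ≡ f′ i) → (∀ {i} → i ≤ n → g i ≡ g′ i) →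
            (f ⊛ g) n ≡ (f′ ⊛ g′) n
  ⊛-local = *-local

  tail-⊛ : ∀ f g → tail (f ⊛ g) ≋ const (f 0) ⊛ tail g ⊕ tail f ⊛ g
  tail-⊛ f g = pointwise λ n → cong (ℤ._+ (tail f Defs.* g) n) (sym (const-* (f 0) (tail g) n))

seriesAlgebra : ℤ-Algebra
seriesAlgebra = record
  { commutativeRing = record
    { Carrier = Series
    ; _≈_ = _≋_
    ; _+_ = _⊕_
    ; _*_ = _⊛_
    ; -_ = ⊝_
    ; 0# = const 0ℤ
    ; 1# = const 1ℤ
    ; isCommutativeRing = isCommutativeRing
    }
  ; ι = const
  ; ι-+ = ι-+
  ; ι-* = ι-*
  ; ι-neg = ι-neg
  ; ι-0 = pointwise λ _ → refl
  ; ι-1 = pointwise λ _ → refl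
  }
  where
  opaque
    unfolding _⊕_

    *-comm : ∀ f g → f ⊛ g ≋ g ⊛ f
    *-comm f g = pointwise (*-commutative f g)

    identityˡ : ∀ f → 1# ⊛ f ≋ f
    identityˡ f = pointwise λ n → trans (const-* 1ℤ f n) (ℤ.*-identityˡ (f n))

    distribʳ : ∀ h f g → (f ⊕ g) ⊛ h ≋ f ⊛ h ⊕ g ⊛ h
    distribʳ h f g = pointwise (*-distribʳ h f g)

    ≋-trans′ : ∀ {f g h} → f ≋ g → g ≋ h → f ≋ h
    ≋-trans′ p r = pointwise λ n → trans (p at n) (r at n)

    +-cong′ : ∀ {f f′ g g′} → f ≋ f′ → g ≋ g′ → f ⊕ g ≋ f′ ⊕ g′
    +-cong′ p r = pointwise λ n → cong₂ ℤ._+_ (p at n) (r at n)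

    isCommutativeRing : IsCommutativeRing _≋_ _⊕_ _⊛_ ⊝_ (const 0ℤ) 1#
    isCommutativeRing = record
      { isRing = record
        { +-isAbelianGroup = record
          { isGroup = record
            { isMonoid = record
              { isSemigroup = record
                { isMagma = record
                  { isEquivalence = record
                    { refl = pointwise λ _ → refl ; sym = λ p → pointwise λ n → sym (p at n) ; trans = ≋-trans′ }
                  ; ∙-cong = +-cong′
                  }
                ; assoc = λ f g h → pointwise λ n → ℤ.+-assoc (f n) (g n) (h n)
                }
              ; identity = (λ f → pointwise λ n → trans (cong (ℤ._+ f n) (const-0 n)) (ℤ.+-identityˡ (f n)))
                         , (λ f → pointwise λ n → trans (cong (ℤ._+_ (f n)) (const-0 n)) (ℤ.+-identityʳ (f n)))
              }
            ; inverse = (λ f → pointwise λ n → trans (ℤ.+-inverseˡ (f n)) (sym (const-0 n)))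
                      , (λ f → pointwise λ n → trans (ℤ.+-inverseʳ (f n)) (sym (const-0 n)))
            ; ⁻¹-cong = λ p → pointwise λ n → cong ℤ.-_ (p at n)
            }
          ; comm = λ f g → pointwise λ n → ℤ.+-comm (f n) (g n)
          }
        ; *-cong = λ p r → pointwise λ n → *-local n (λ {i} _ → p at i) (λ {i} _ → r at i)
        ; *-assoc = λ f g h → pointwise (*-associative f g h)
        ; *-identity = identityˡ , λ f → ≋-trans′ (*-comm f 1#) (identityˡ f)
        ; distrib = (λ h f g → ≋-trans′ (*-comm h (f ⊕ g)) (≋-trans′ (distribʳ h f g) (+-cong′ (*-comm f h) (*-comm g h))))
                  , distribʳ
        }
      ; *-comm = *-comm
      }

    ι-+ : ∀ a b → const (a ℤ.+ b) ≋ const a ⊕ const b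
    ι-+ a b = pointwise λ { zero → refl ; (suc n) → refl }

    ι-* : ∀ a b → const (a ℤ.* b) ≋ const a ⊛ const b
    ι-* a b = pointwise λ { zero → sym (ℤ.+-identityʳ _) ; (suc n) → sym (trans (const-* a (const b) (suc n)) (ℤ.*-zeroʳ a)) }

    ι-neg : ∀ a → const (ℤ.- a) ≋ ⊝ const a
    ι-neg a = pointwise λ { zero → refl ; (suc n) → refl }

open ℤ-Algebra seriesAlgebra hiding (_≋_; _⊕_; _⊛_; ⊝_)

private
  pow : ∀ {n} → ℕ → Polynomial n → Polynomial n
  pow zero    z = con 1ℤ
  pow (suc n) z = z :* pow n z

  cub : ∀ {n} → Polynomial n → Polynomial n
  cub z = z :* z :* z

-- Congruences modulo powers of q

infix 4 _≋_mod_

record _≋_mod_ (f g : Series) (n : ℕ) : Set where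
  constructor agreeing
  infixl 9 _below_
  field _below_ : ∀ {i} → i < n → f i ≡ g i

open _≋_mod_

≋⇒mod : ∀ {f g n} → f ≋ g → f ≋ g mod n
≋⇒mod p = agreeing λ {i} _ → p at i

mod-refl : ∀ {f n} → f ≋ f mod n
mod-refl = agreeing λ _ → refl

mod-sym : ∀ {f g n} → f ≋ g mod n → g ≋ f mod n
mod-sym p = agreeing λ i<n → sym (p below i<n)

mod-trans : ∀ {f g h n} → f ≋ g mod n → g ≋ h mod n → f ≋ h mod n
mod-trans p r = agreeing λ i<n → trans (p below i<n) (r below i<n)

mod-weaken : ∀ {f g m n} → m ≤ n → f ≋ g mod n → f ≋ g mod m
mod-weaken m≤n p = agreeing λ i<m → p below (ℕ.<-≤-trans i<m m≤n)

mod⇒≋ : ∀ {f g} → (∀ n → f ≋ g mod n) → f ≋ g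
mod⇒≋ p = pointwise λ n → p (suc n) below ℕ.≤-refl

⊕-mod : ∀ {f f′ g g′ n} → f ≋ f′ mod n → g ≋ g′ mod n → f ⊕ g ≋ f′ ⊕ g′ mod n
⊕-mod {f} {f′} {g} {g′} p r = agreeing λ {i} i<n →
  trans (⊕-at f g i) (trans (cong₂ ℤ._+_ (p below i<n) (r below i<n)) (sym (⊕-at f′ g′ i)))

⊝-mod : ∀ {f g n} → f ≋ g mod n → ⊝ f ≋ ⊝ g mod n
⊝-mod {f} {g} p = agreeing λ {i} i<n → trans (⊝-at f i) (trans (cong ℤ.-_ (p below i<n)) (sym (⊝-at g i)))

⊛-mod : ∀ {f f′ g g′ n} → f ≋ f′ mod n → g ≋ g′ mod n → f ⊛ g ≋ f′ ⊛ g′ mod n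
⊛-mod p r = agreeing λ {i} i<n →
  ⊛-local i (λ j≤i → p below ℕ.≤-<-trans j≤i i<n) (λ j≤i → r below ℕ.≤-<-trans j≤i i<n)

⊛-modˡ : ∀ f {g g′ n} → g ≋ g′ mod n → f ⊛ g ≋ f ⊛ g′ mod n
⊛-modˡ f = ⊛-mod (mod-refl {f})

⊛-order : ∀ f {g n} → g ≋ nil mod n → f ⊛ g ≋ nil mod n
⊛-order f p = mod-trans (⊛-modˡ f p) (≋⇒mod (zeroʳ f))

⊛-order-suc : ∀ {f g n} → f 0 ≡ 0ℤ → g ≋ nil mod n → f ⊛ g ≋ nil mod suc n
⊛-order-suc {f} {g} {n} f0 p = agreeing λ
  { {zero}  _         → trans (⊛-at-zero f g) (cong (ℤ._* g 0) f0)
  ; {suc i} (s≤s i<n) → trans (⊛-at-suc f g i)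
      (trans (cong₂ (λ z w → z ℤ.* g (suc i) ℤ.+ w) f0 (⊛-order (tail f) p below i<n))
        (trans (ℤ.+-identityˡ _) (const-0 i)))
  }

-- Multiplication by a series without constant term is a contraction: it gains one coefficient of
-- agreement. The geometric series converges for this reason.
⊛-stable : ∀ {f g h n} → f 0 ≡ 0ℤ → g ≋ h mod n → f ⊛ g ≋ f ⊛ h mod suc n
⊛-stable {f} {g} {h} {n} f0 p = mod-trans
  (≋⇒mod (solve 3 (λ f g h → f :* g := f :* (g :- h) :+ f :* h) ≋-refl f g h))
  (mod-trans (⊕-mod (⊛-order-suc f0 g-h) mod-refl) (≋⇒mod (+-identityˡ (f ⊛ h))))
  where
  g-h : g ⊖ h ≋ nil mod n
  g-h = mod-trans (⊕-mod p mod-refl) (≋⇒mod (-‿inverseʳ h))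

-- Units

⊛-sum : ∀ {n} (f : Series) (t : Fin n → Series) i → (f ⊛ λ j → sum (λ k → t k j)) i ≡ sum (λ k → (f ⊛ t k) i)
⊛-sum {zero}  f t i = trans (*-congˡ {f} {λ _ → 0ℤ} {nil} (pointwise λ j → sym (const-0 j)) at i) (trans (zeroʳ f at i) (const-0 i))
⊛-sum {suc n} f t i = trans (*-congˡ {f} (pointwise λ j → sym (⊕-at (t zero) (λ j → sum (λ k → t (suc k) j)) j)) at i)
  (trans (distribˡ f (t zero) (λ j → sum (λ k → t (suc k) j)) at i)
    (trans (⊕-at _ _ i) (cong (ℤ._+_ ((f ⊛ t zero) i)) (⊛-sum f (λ k → t (suc k)) i))))

geometric : Series → ℕ → Series
geometric f n i = sum {suc n} λ k → (f ↑ toℕ k) i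

geometric-suc : ∀ f n → geometric f (suc n) ≋ one ⊕ f ⊛ geometric f n
geometric-suc f n = pointwise λ i → sym (trans (⊕-at one _ i) (cong (ℤ._+_ (one i)) (⊛-sum {suc n} f (λ k → f ↑ toℕ k) i)))

geometric-step : ∀ {f} → f 0 ≡ 0ℤ → ∀ n → geometric f (suc n) ≋ geometric f n mod suc n
geometric-step {f} f0 zero = mod-trans (≋⇒mod (geometric-suc f 0))
  (mod-trans (⊕-mod (mod-refl {one}) (⊛-order-suc {f} {geometric f 0} {0} f0 (agreeing λ ())))
    (agreeing λ { {zero} _ → ⊕-at one nil 0 ; {suc i} (s≤s ()) }))
geometric-step {f} f0 (suc n) = mod-trans (≋⇒mod (geometric-suc f (suc n)))
  (mod-trans (⊕-mod mod-refl (⊛-stable f0 (geometric-step f0 n))) (≋⇒mod (≋-sym (geometric-suc f n))))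

geometric-stable : ∀ {f} → f 0 ≡ 0ℤ → ∀ {m n} → m ℕ.≤′ n → geometric f n ≋ geometric f m mod suc m
geometric-stable f0 ℕ.≤′-refl           = mod-refl
geometric-stable f0 (ℕ.≤′-step {n} m≤n) =
  mod-trans (mod-weaken (s≤s (ℕ.≤′⇒≤ m≤n)) (geometric-step f0 n)) (geometric-stable f0 m≤n)

inv : Series → Series
inv f n = geometric (one ⊖ f) n n

-- Normalised to constant term 1, where the geometric series is an inverse. Integer factors such as
-- the 2 in `ψ₂` are left to `const-cancel`.
record IsUnit (f : Series) : Set where
  constructor unit
  field unit-at : f 0 ≡ 1ℤ

open IsUnit

⊖-at : ∀ f g n → (f ⊖ g) n ≡ f n ℤ.- g n
⊖-at f g n = trans (⊕-at f (⊝ g) n) (cong (ℤ._+_ (f n)) (⊝-at g n))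

-- `inv f` is the fixed point of g ↦ 1 + (1 - f) g: the partial sums satisfy this equation with a
-- shift of one, and they agree with `inv f` modulo growing powers of q.
inverseʳ : ∀ {f} → IsUnit f → f ⊛ inv f ≋ one
inverseʳ {f} (unit f0) = ≋-trans (solve 2 (λ f g → f :* g := g :- (con 1ℤ :- f) :* g) ≋-refl f (inv f))
  (≋-trans (+-congʳ unfold) (solve 1 (λ h → con 1ℤ :+ h :- h := con 1ℤ) ≋-refl (e ⊛ inv f)))
  where
  e : Series
  e = one ⊖ f

  e0 : e 0 ≡ 0ℤ
  e0 = trans (⊖-at one f 0) (cong (ℤ._-_ 1ℤ) f0)

  inv≋geometric : ∀ n → inv f ≋ geometric e n mod suc n
  inv≋geometric n = agreeing λ { {i} (s≤s i≤n) → sym (geometric-stable {e} e0 (ℕ.≤⇒≤′ i≤n) below ℕ.≤-refl) }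

  unfold : inv f ≋ one ⊕ e ⊛ inv f
  unfold = mod⇒≋ λ n → mod-trans (mod-weaken (ℕ.≤-trans (ℕ.n≤1+n n) (ℕ.n≤1+n (suc n))) (inv≋geometric (suc n)))
    (mod-trans (≋⇒mod (geometric-suc e n))
      (⊕-mod mod-refl (⊛-modˡ e (mod-weaken (ℕ.n≤1+n n) (mod-sym (inv≋geometric n))))))

⊛-isUnit : ∀ {f g} → IsUnit f → IsUnit g → IsUnit (f ⊛ g)
⊛-isUnit {f} {g} (unit u) (unit w) = unit (trans (⊛-at-zero f g) (cong₂ ℤ._*_ u w))

↑-isUnit : ∀ {f} → IsUnit f → ∀ n → IsUnit (f ↑ n)
↑-isUnit u zero    = unit refl
↑-isUnit u (suc n) = ⊛-isUnit u (↑-isUnit u n)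

inv-⊛ : ∀ {f} → IsUnit f → ∀ g → inv f ⊛ (f ⊛ g) ≋ g
inv-⊛ {f} u g = ≋-trans (≋-sym (*-assoc (inv f) f g))
  (≋-trans (*-congʳ (≋-trans (*-comm (inv f) f) (inverseʳ u))) (*-identityˡ g))

⊛-cancelˡ : ∀ {f g h} → IsUnit f → f ⊛ g ≋ f ⊛ h → g ≋ h
⊛-cancelˡ u p = ≋-trans (≋-sym (inv-⊛ u _)) (≋-trans (*-congˡ p) (inv-⊛ u _))

⊛-cancelˡ-mod : ∀ {f g h n} → IsUnit f → f ⊛ g ≋ f ⊛ h mod n → g ≋ h mod n
⊛-cancelˡ-mod {f} u p =
  mod-trans (≋⇒mod (≋-sym (inv-⊛ u _))) (mod-trans (⊛-modˡ (inv f) p) (≋⇒mod (inv-⊛ u _)))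

-- Multiplication by q

q^-⊛-zero : ∀ k f → (q^ suc k ⊛ f) 0 ≡ 0ℤ
q^-⊛-zero k f = ⊛-at-zero (q^ suc k) f

q^-⊛-suc : ∀ k f n → (q^ suc k ⊛ f) (suc n) ≡ (q^ k ⊛ f) n
q^-⊛-suc k f n = trans (⊛-at-suc (q^ suc k) f n) (ℤ.+-identityˡ _)

q^0 : q^ 0 ≋ one
q^0 = pointwise λ _ → refl

q-⊛-suc : ∀ f n → (q ⊛ f) (suc n) ≡ f n
q-⊛-suc f n = trans (q^-⊛-suc 0 f n) (≋-trans (*-congʳ q^0) (*-identityˡ f) at n)

q^-suc : ∀ k → q^ suc k ≋ q ⊛ q^ k
q^-suc k = pointwise λ { zero → sym (q^-⊛-zero 0 (q^ k)) ; (suc n) → sym (q-⊛-suc (q^ k) n) }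

q^≋q↑ : ∀ k → q^ k ≋ q ↑ k
q^≋q↑ zero    = q^0
q^≋q↑ (suc k) = ≋-trans (q^-suc k) (*-congˡ (q^≋q↑ k))

↑-order : ∀ {f} → f 0 ≡ 0ℤ → ∀ n → f ↑ n ≋ nil mod n
↑-order f0 zero    = agreeing λ ()
↑-order f0 (suc n) = ⊛-order-suc f0 (↑-order f0 n)

-- The substitution q ↦ q³ and the operator U₃

dilate : Series → Series
dilate f 0                   = f 0
dilate f 1                   = 0ℤ
dilate f 2                   = 0ℤ
dilate f (suc (suc (suc n))) = dilate (tail f) n

section : ℕ → Series → Series
section r f n = f (r ℕ.+ n ℕ.* 3)

U₃ : Series → Series
U₃ = section 0

dilate-cong-at : ∀ n {f g} → (∀ {i} → i ≤ n → f i ≡ g i) → dilate f n ≡ dilate g n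
dilate-cong-at 0                   p = p z≤n
dilate-cong-at 1                   p = refl
dilate-cong-at 2                   p = refl
dilate-cong-at (suc (suc (suc n))) p = dilate-cong-at n (λ i≤n → p (s≤s (ℕ.m≤n⇒m≤1+n (ℕ.m≤n⇒m≤1+n i≤n))))

dilate-cong : ∀ {f g} → f ≋ g → dilate f ≋ dilate g
dilate-cong p = pointwise λ n → dilate-cong-at n (λ {i} _ → p at i)

dilate-mod : ∀ {f g n} → f ≋ g mod n → dilate f ≋ dilate g mod n
dilate-mod p = agreeing λ {i} i<n → dilate-cong-at i (λ j≤i → p below ℕ.≤-<-trans j≤i i<n)

dilate-const : ∀ c → dilate (const c) ≋ const c
dilate-const c = pointwise λ { 0 → refl ; 1 → refl ; 2 → refl ; (suc (suc (suc n))) → zeros n }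
  where
  zeros : ∀ n → dilate (λ _ → 0ℤ) n ≡ 0ℤ
  zeros 0                   = refl
  zeros 1                   = refl
  zeros 2                   = refl
  zeros (suc (suc (suc n))) = zeros n

dilate-⊕ : ∀ f g → dilate (f ⊕ g) ≋ dilate f ⊕ dilate g
dilate-⊕ f g = pointwise λ n → trans (dilate-cong-at n (λ {i} _ → ⊕-at f g i)) (trans (go n f g) (sym (⊕-at (dilate f) (dilate g) n)))
  where
  go : ∀ n f g → dilate (λ i → f i ℤ.+ g i) n ≡ dilate f n ℤ.+ dilate g n
  go 0                   f g = refl
  go 1                   f g = refl
  go 2                   f g = refl
  go (suc (suc (suc n))) f g = go n (tail f) (tail g)

dilate-⊝ : ∀ f → dilate (⊝ f) ≋ ⊝ dilate f
dilate-⊝ f = pointwise λ n → trans (dilate-cong-at n (λ {i} _ → ⊝-at f i)) (trans (go n f) (sym (⊝-at (dilate f) n)))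
  where
  go : ∀ n f → dilate (λ i → ℤ.- f i) n ≡ ℤ.- dilate f n
  go 0                   f = refl
  go 1                   f = refl
  go 2                   f = refl
  go (suc (suc (suc n))) f = go n (tail f)

dilate-⊛-step : ∀ f g n → (dilate f ⊛ g) (3 ℕ.+ n) ≡ f 0 ℤ.* g (3 ℕ.+ n) ℤ.+ (dilate (tail f) ⊛ g) n
dilate-⊛-step f g n = trans (⊛-at-suc (dilate f) g (2 ℕ.+ n)) (cong (ℤ._+_ (f 0 ℤ.* g (3 ℕ.+ n)))
  (trans (⊛-at-suc (tail (dilate f)) g (1 ℕ.+ n)) (trans (ℤ.+-identityˡ _)
    (trans (⊛-at-suc (tail (tail (dilate f))) g n) (ℤ.+-identityˡ _)))))

dilate-⊛ : ∀ f g → dilate (f ⊛ g) ≋ dilate f ⊛ dilate g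
dilate-⊛ f g = pointwise (λ n → go n f g)
  where
  go : ∀ n f g → dilate (f ⊛ g) n ≡ (dilate f ⊛ dilate g) n
  go 0 f g = trans (⊛-at-zero f g) (sym (⊛-at-zero (dilate f) (dilate g)))
  go 1 f g = sym (trans (⊛-at-suc (dilate f) (dilate g) 0) (cong₂ ℤ._+_ (ℤ.*-zeroʳ (f 0)) (⊛-at-zero (tail (dilate f)) (dilate g))))
  go 2 f g = sym (trans (⊛-at-suc (dilate f) (dilate g) 1) (cong₂ ℤ._+_ (ℤ.*-zeroʳ (f 0))
    (trans (⊛-at-suc (tail (dilate f)) (dilate g) 0) (cong (ℤ._+_ 0ℤ) (⊛-at-zero (tail (tail (dilate f))) (dilate g))))))
  go (suc (suc (suc n))) f g = begin
    dilate (tail (f ⊛ g)) n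
      ≡⟨ dilate-cong (tail-⊛ f g) at n ⟩
    dilate (const (f 0) ⊛ tail g ⊕ tail f ⊛ g) n
      ≡⟨ trans (dilate-⊕ (const (f 0) ⊛ tail g) (tail f ⊛ g) at n) (⊕-at (dilate (const (f 0) ⊛ tail g)) (dilate (tail f ⊛ g)) n) ⟩
    dilate (const (f 0) ⊛ tail g) n ℤ.+ dilate (tail f ⊛ g) n
      ≡⟨ cong₂ ℤ._+_ (trans (go n (const (f 0)) (tail g)) (trans (*-congʳ (dilate-const (f 0)) at n) (const-⊛ (f 0) (dilate (tail g)) n))) (go n (tail f) g) ⟩
    f 0 ℤ.* dilate (tail g) n ℤ.+ (dilate (tail f) ⊛ dilate g) n
      ≡⟨ sym (dilate-⊛-step f (dilate g) n) ⟩
    (dilate f ⊛ dilate g) (3 ℕ.+ n) ∎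
    where open ≡-Reasoning

dilate-↑ : ∀ f n → dilate (f ↑ n) ≋ dilate f ↑ n
dilate-↑ f zero    = dilate-const 1ℤ
dilate-↑ f (suc n) = ≋-trans (dilate-⊛ f (f ↑ n)) (*-congˡ (dilate-↑ f n))

dilate-q : dilate q ≋ q ↑ 3
dilate-q = ≋-trans (pointwise λ { 0 → refl ; 1 → refl ; 2 → refl ; 3 → refl ; (suc (suc (suc (suc n)))) → lemma n }) (q^≋q↑ 3)
  where
  lemma : ∀ n → dilate q (4 ℕ.+ n) ≡ 0ℤ
  lemma n = trans (dilate-cong-at (suc n) {tail q} {one} (λ _ → refl)) (dilate-const 1ℤ at suc n)

-- A series in q³ keeps exponents in their class modulo 3, so U₃ is linear over such series.
-- Denominators are cleared inside U₃ in this way throughout.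
U₃-dilate : ∀ f g → U₃ (dilate f ⊛ g) ≋ f ⊛ U₃ g
U₃-dilate f g = pointwise (λ n → go n f)
  where
  go : ∀ n f → U₃ (dilate f ⊛ g) n ≡ (f ⊛ U₃ g) n
  go zero    f = trans (⊛-at-zero (dilate f) g) (sym (⊛-at-zero f (U₃ g)))
  go (suc n) f = trans (dilate-⊛-step f g (n ℕ.* 3))
    (trans (cong (ℤ._+_ (f 0 ℤ.* g (3 ℕ.+ n ℕ.* 3))) (go n (tail f))) (sym (⊛-at-suc f (U₃ g) n)))

section-cong : ∀ r {f g} → f ≋ g → section r f ≋ section r g
section-cong r p = pointwise λ n → p at (r ℕ.+ n ℕ.* 3)

section-⊕ : ∀ r f g → section r (f ⊕ g) ≋ section r f ⊕ section r g
section-⊕ r f g = pointwise λ n → trans (⊕-at f g (r ℕ.+ n ℕ.* 3)) (sym (⊕-at (section r f) (section r g) n))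

assemble : Series → Series → Series → Series
assemble a b c = dilate a ⊕ q ⊛ dilate b ⊕ q ⊛ (q ⊛ dilate c)

assemble-at : ∀ a b c n → assemble a b c n ≡ dilate a n ℤ.+ (q ⊛ dilate b) n ℤ.+ (q ⊛ (q ⊛ dilate c)) n
assemble-at a b c n = trans (⊕-at _ (q ⊛ (q ⊛ dilate c)) n) (cong (ℤ._+ (q ⊛ (q ⊛ dilate c)) n) (⊕-at (dilate a) (q ⊛ dilate b) n))

assemble-0 : ∀ a b c → assemble a b c 0 ≡ a 0
assemble-0 a b c = trans (assemble-at a b c 0)
  (trans (cong₂ (λ u v → a 0 ℤ.+ u ℤ.+ v) (q^-⊛-zero 0 (dilate b)) (q^-⊛-zero 0 (q ⊛ dilate c))) (trans (ℤ.+-identityʳ _) (ℤ.+-identityʳ _)))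

assemble-1 : ∀ a b c → assemble a b c 1 ≡ b 0
assemble-1 a b c = trans (assemble-at a b c 1)
  (trans (cong₂ (λ u v → 0ℤ ℤ.+ u ℤ.+ v) (q-⊛-suc (dilate b) 0) (trans (q-⊛-suc (q ⊛ dilate c) 0) (q^-⊛-zero 0 (dilate c)))) (trans (ℤ.+-identityʳ _) (ℤ.+-identityˡ _)))

assemble-2 : ∀ a b c → assemble a b c 2 ≡ c 0
assemble-2 a b c = trans (assemble-at a b c 2)
  (trans (cong₂ (λ u v → 0ℤ ℤ.+ u ℤ.+ v) (q-⊛-suc (dilate b) 1) (trans (q-⊛-suc (q ⊛ dilate c) 1) (q-⊛-suc (dilate c) 0))) (ℤ.+-identityˡ _))

assemble-step : ∀ a b c n → assemble a b c (3 ℕ.+ n) ≡ assemble (tail a) (tail b) (tail c) n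
assemble-step a b c n = trans (assemble-at a b c (3 ℕ.+ n))
  (trans (cong₂ (λ u v → dilate (tail a) n ℤ.+ u ℤ.+ v) (trans (q-⊛-suc (dilate b) (2 ℕ.+ n)) (shift b n))
    (trans (q-⊛-suc (q ⊛ dilate c) (2 ℕ.+ n)) (trans (q-⊛-suc (dilate c) (1 ℕ.+ n)) (shift₂ c n))))
    (sym (assemble-at (tail a) (tail b) (tail c) n)))
  where
  shift : ∀ f n → dilate f (2 ℕ.+ n) ≡ (q ⊛ dilate (tail f)) n
  shift f zero    = sym (q^-⊛-zero 0 (dilate (tail f)))
  shift f (suc n) = sym (q-⊛-suc (dilate (tail f)) n)

  shift₂ : ∀ f n → dilate f (1 ℕ.+ n) ≡ (q ⊛ (q ⊛ dilate (tail f))) n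
  shift₂ f zero    = sym (q^-⊛-zero 0 (q ⊛ dilate (tail f)))
  shift₂ f (suc n) = trans (shift f n) (sym (q-⊛-suc (q ⊛ dilate (tail f)) n))

section₀-assemble : ∀ a b c → section 0 (assemble a b c) ≋ a
section₀-assemble a b c = pointwise (λ n → go n a b c)
  where
  go : ∀ n a b c → assemble a b c (n ℕ.* 3) ≡ a n
  go zero    a b c = assemble-0 a b c
  go (suc n) a b c = trans (assemble-step a b c (n ℕ.* 3)) (go n (tail a) (tail b) (tail c))

section₁-assemble : ∀ a b c → section 1 (assemble a b c) ≋ b
section₁-assemble a b c = pointwise (λ n → go n a b c)
  where
  go : ∀ n a b c → assemble a b c (1 ℕ.+ n ℕ.* 3) ≡ b n
  go zero    a b c = assemble-1 a b c
  go (suc n) a b c = trans (assemble-step a b c (1 ℕ.+ n ℕ.* 3)) (go n (tail a) (tail b) (tail c))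

section₂-assemble : ∀ a b c → section 2 (assemble a b c) ≋ c
section₂-assemble a b c = pointwise (λ n → go n a b c)
  where
  go : ∀ n a b c → assemble a b c (2 ℕ.+ n ℕ.* 3) ≡ c n
  go zero    a b c = assemble-2 a b c
  go (suc n) a b c = trans (assemble-step a b c (2 ℕ.+ n ℕ.* 3)) (go n (tail a) (tail b) (tail c))

assemble-sections : ∀ f → f ≋ assemble (section 0 f) (section 1 f) (section 2 f)
assemble-sections f = pointwise (λ n → go n f)
  where
  go : ∀ n f → f n ≡ assemble (section 0 f) (section 1 f) (section 2 f) n
  go 0 f = sym (assemble-0 (section 0 f) (section 1 f) (section 2 f))
  go 1 f = sym (assemble-1 (section 0 f) (section 1 f) (section 2 f))
  go 2 f = sym (assemble-2 (section 0 f) (section 1 f) (section 2 f))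
  go (suc (suc (suc n))) f = trans (go n (λ i → f (3 ℕ.+ i))) (sym (assemble-step (section 0 f) (section 1 f) (section 2 f) n))

open Finite seriesAlgebra

-- Infinite products

Tame : (ℕ → Series) → Set
Tame g = ∀ j → g j ≋ one mod j

∏∞ : (ℕ → Series) → Series
∏∞ g n = ∏ (suc n) g n

-- Factors from index m on are 1 modulo qᵐ, so the first m of them determine the product modulo qᵐ.
∏-stable : ∀ {g} → Tame g → ∀ {m n} → m ℕ.≤′ n → ∏ n g ≋ ∏ m g mod m
∏-stable tame ℕ.≤′-refl = mod-refl
∏-stable tame (ℕ.≤′-step {n} m≤n) = mod-trans
  (⊛-mod (∏-stable tame m≤n) (mod-weaken (ℕ.≤′⇒≤ m≤n) (tame n))) (≋⇒mod (*-identityʳ _))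

∏∞-∏ : ∀ {g} → Tame g → ∀ {m n} → m ≤ n → ∏∞ g ≋ ∏ n g mod m
∏∞-∏ tame m≤n = agreeing λ i<m → sym (∏-stable tame (ℕ.≤⇒≤′ (ℕ.≤-trans i<m m≤n)) below ℕ.≤-refl)

∏∞-cong : ∀ {g h} → (∀ j → g j ≋ h j) → ∏∞ g ≋ ∏∞ h
∏∞-cong p = pointwise λ n → ∏-cong (suc n) p at n

⊛-tame : ∀ {g h} → Tame g → Tame h → Tame (λ j → g j ⊛ h j)
⊛-tame t u j = mod-trans (⊛-mod (t j) (u j)) (≋⇒mod (*-identityˡ one))

∏∞-⊛ : ∀ {g h} → Tame g → Tame h → ∏∞ (λ j → g j ⊛ h j) ≋ ∏∞ g ⊛ ∏∞ h
∏∞-⊛ {g} {h} t u = mod⇒≋ λ n → mod-trans (∏∞-∏ (⊛-tame t u) ℕ.≤-refl)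
  (mod-trans (≋⇒mod (∏-⊛ n g h)) (mod-sym (⊛-mod (∏∞-∏ t ℕ.≤-refl) (∏∞-∏ u ℕ.≤-refl))))

∏∞-head : ∀ {g} → Tame g → Tame (g ∘ suc) → ∏∞ g ≋ g 0 ⊛ ∏∞ (g ∘ suc)
∏∞-head {g} t u = mod⇒≋ λ n → mod-trans (∏∞-∏ t (ℕ.n≤1+n n))
  (mod-trans (≋⇒mod (∏-head n g)) (⊛-modˡ (g 0) (mod-sym (∏∞-∏ u ℕ.≤-refl))))

stride-tame : ∀ {g} k r .{{_ : ℕ.NonZero k}} → Tame g → Tame (λ j → g (r ℕ.+ j ℕ.* k))
stride-tame k r t j = mod-weaken (ℕ.≤-trans (ℕ.m≤m*n j k) (ℕ.m≤n+m (j ℕ.* k) r)) (t (r ℕ.+ j ℕ.* k))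

∏∞-double : ∀ {g} → Tame g → ∏∞ g ≋ ∏∞ (λ j → g (j ℕ.* 2)) ⊛ ∏∞ (λ j → g (1 ℕ.+ j ℕ.* 2))
∏∞-double {g} t = ≋-trans
  (mod⇒≋ λ n → mod-trans (∏∞-∏ t (ℕ.m≤m*n n 2)) (mod-trans (≋⇒mod (∏-double n g))
    (mod-sym (∏∞-∏ (⊛-tame (stride-tame 2 0 t) (stride-tame 2 1 t)) ℕ.≤-refl))))
  (∏∞-⊛ (stride-tame 2 0 t) (stride-tame 2 1 t))

triples : (ℕ → Series) → ℕ → Series
triples g j = g (j ℕ.* 3) ⊛ g (1 ℕ.+ j ℕ.* 3) ⊛ g (2 ℕ.+ j ℕ.* 3)

triples-tame : ∀ {g} → Tame g → Tame (triples g)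
triples-tame t = ⊛-tame (⊛-tame (stride-tame 3 0 t) (stride-tame 3 1 t)) (stride-tame 3 2 t)

∏∞-triples : ∀ {g} → Tame g → ∏∞ g ≋ ∏∞ (triples g)
∏∞-triples {g} t = mod⇒≋ λ n → mod-trans (∏∞-∏ t (ℕ.m≤m*n n 3))
  (mod-trans (≋⇒mod (∏-triple n g)) (mod-sym (∏∞-∏ (triples-tame t) ℕ.≤-refl)))

∏∞-triple : ∀ {g} → Tame g →
  ∏∞ g ≋ ∏∞ (λ j → g (j ℕ.* 3)) ⊛ ∏∞ (λ j → g (1 ℕ.+ j ℕ.* 3)) ⊛ ∏∞ (λ j → g (2 ℕ.+ j ℕ.* 3))
∏∞-triple t = ≋-trans (∏∞-triples t) (≋-trans (∏∞-⊛ (⊛-tame t₀ t₁) (stride-tame 3 2 t)) (*-congʳ (∏∞-⊛ t₀ t₁)))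
  where
  t₀ = stride-tame 3 0 t
  t₁ = stride-tame 3 1 t

-- Theta series and the Jacobi triple product

triangular-order : ∀ c {Q} → Q 0 ≡ 0ℤ → ∀ k → triangular c Q (suc k) ≋ nil mod k
triangular-order c {Q} Q0 k = ⊛-order (triangular c Q k) (⊛-order c (↑-order Q0 k))

-- Only the last factor of each `triangular` is counted. The bound is far from sharp, but it grows
-- with `k`.
thetaTerm-order : ∀ a b → (a ⊛ b) 0 ≡ 0ℤ → ∀ k → thetaTerm a b (suc k) ≋ nil mod k
thetaTerm-order a b Q0 k = mod-trans
  (⊕-mod (triangular-order a Q0 k) (mod-weaken (ℕ.n≤1+n k) (triangular-order b Q0 (suc k)))) (≋⇒mod (+-identityˡ nil))

∑-stable : ∀ {t} → (∀ k → t (suc k) ≋ nil mod k) → ∀ {m n} → m ℕ.≤′ n → ∑ (suc n) t ≋ ∑ (suc m) t mod m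
∑-stable p ℕ.≤′-refl           = mod-refl
∑-stable p (ℕ.≤′-step {n} m≤n) = mod-trans
  (⊕-mod (∑-stable p m≤n) (mod-weaken (ℕ.≤′⇒≤ m≤n) (p n))) (≋⇒mod (+-identityʳ _))

-- The term of index `suc k` is only shown to vanish modulo qᵏ, so the coefficient of qⁿ takes the
-- terms up to index n + 1.
θ : Series → Series → Series
θ a b n = ∑ (suc (suc n)) (thetaTerm a b) n

θ-∑ : ∀ a b → (a ⊛ b) 0 ≡ 0ℤ → ∀ {m n} → m ≤ n → θ a b ≋ ∑ (suc n) (thetaTerm a b) mod m
θ-∑ a b Q0 m≤n = agreeing λ i<m →
  sym (∑-stable (thetaTerm-order a b Q0) (ℕ.≤⇒≤′ (ℕ.≤-trans i<m m≤n)) below ℕ.≤-refl)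

thetaTerm-cong : ∀ {a a′ b b′} k → a ≋ a′ → b ≋ b′ → thetaTerm a b k ≋ thetaTerm a′ b′ k
thetaTerm-cong k p r = +-cong (triangular-cong k p (*-cong p r)) (triangular-cong (suc k) r (*-cong p r))

θ-cong : ∀ {a a′ b b′} → a ≋ a′ → b ≋ b′ → θ a b ≋ θ a′ b′
θ-cong p r = pointwise λ n → ∑-cong (suc (suc n)) (λ {k} _ → thetaTerm-cong k p r) at n

power-tame : ∀ c {Q} → Q 0 ≡ 0ℤ → Tame (λ j → one ⊕ c ⊛ Q ↑ j)
power-tame c Q0 j = mod-trans (⊕-mod mod-refl (⊛-order c (↑-order Q0 j))) (≋⇒mod (+-identityʳ one))

⊖-tame : ∀ {Q} → Q 0 ≡ 0ℤ → Tame (λ j → one ⊖ Q ↑ suc j)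
⊖-tame {Q} Q0 j = mod-trans (≋⇒mod (+-congˡ (solve 1 (λ z → :- z := con (ℤ.- 1ℤ) :* z) ≋-refl (Q ↑ suc j))))
  (mod-trans (⊕-mod mod-refl (⊛-order _ (mod-weaken (ℕ.n≤1+n j) (↑-order Q0 (suc j))))) (≋⇒mod (+-identityʳ one)))

∏-isUnit : ∀ n {g} → (∀ j → IsUnit (g j)) → IsUnit (∏ n g)
∏-isUnit zero    u = unit refl
∏-isUnit (suc n) u = ⊛-isUnit (∏-isUnit n u) (u n)

module _ (a b : Series) (Q0 : (a ⊛ b) 0 ≡ 0ℤ) where
  open TripleProduct a b

  factorial-isUnit : ∀ n → IsUnit (factorial n)
  factorial-isUnit n = ∏-isUnit n (λ j → unit (trans (⊖-at one (Q ↑ suc j) 0)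
    (cong (ℤ._-_ 1ℤ) (↑-order Q0 (suc j) below s≤s z≤n))))

  factorial-stable : ∀ {m n k} → m ≤ n → m ≤ k → factorial n ≋ factorial k mod m
  factorial-stable m≤n m≤k = mod-trans (∏-stable (⊖-tame Q0) (ℕ.≤⇒≤′ m≤n)) (mod-sym (∏-stable (⊖-tame Q0) (ℕ.≤⇒≤′ m≤k)))

  -- Modulo qᵐ all q-factorials of length at least m agree with one unit F, and `binomial-factorial`
  -- becomes b·F·F = F.
  binomial-limit : ∀ {m n} i j → m ≤ i → m ≤ j → m ≤ n → factorial n ⊛ binomial (i ℕ.+ j) i ≋ one mod m
  binomial-limit {m} {n} i j m≤i m≤j m≤n = ⊛-cancelˡ-mod (factorial-isUnit n) (mod-trans
    (≋⇒mod (solve 2 (λ f b → f :* (f :* b) := b :* (f :* f)) ≋-refl (factorial n) (binomial (i ℕ.+ j) i)))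
    (mod-trans (⊛-modˡ (binomial (i ℕ.+ j) i) (⊛-mod (factorial-stable m≤n m≤i) (factorial-stable m≤n m≤j)))
      (mod-trans (≋⇒mod (binomial-factorial i j))
        (mod-trans (factorial-stable (ℕ.≤-trans m≤i (ℕ.m≤m+n i j)) m≤n) (≋⇒mod (≋-sym (*-identityʳ (factorial n))))))))

  bilateral-order-below : ∀ m N k → k ℕ.+ suc m ≤ N → bilateral N k ≋ nil mod m
  bilateral-order-below m (suc N) zero    (s≤s m≤N) = mod-weaken m≤N (triangular-order b Q0 N)
  bilateral-order-below m (suc N) (suc k) (s≤s p)   = bilateral-order-below m N k p

  bilateral-order-above : ∀ m N k → N ℕ.+ suc m ≤ k → bilateral N k ≋ nil mod m
  bilateral-order-above m zero    (suc k) (s≤s m≤k) = mod-weaken m≤k (triangular-order a Q0 k)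
  bilateral-order-above m (suc N) (suc k) (s≤s p)   = bilateral-order-above m N k p

  -- If the index k - N is further than m from 0, the term itself vanishes modulo qᵐ. Otherwise the
  -- choice N = 2m leaves both k and 2N - k at least m, and `binomial-limit` applies.
  binomial-bilateral : ∀ m {k} → let N = m ℕ.+ m in k ≤ N ℕ.+ N →
    factorial N ⊛ (binomial (N ℕ.+ N) k ⊛ bilateral N k) ≋ bilateral N k mod m
  binomial-bilateral m {k} k≤2N with ℕ.≤-<-connex (k ℕ.+ suc m) (m ℕ.+ m) | ℕ.≤-<-connex (m ℕ.+ m ℕ.+ suc m) k
  ... | inj₁ p | _      = mod-trans (⊛-order _ (⊛-order _ low)) (mod-sym low)
    where low = bilateral-order-below m (m ℕ.+ m) k p
  ... | inj₂ _ | inj₁ p = mod-trans (⊛-order _ (⊛-order _ high)) (mod-sym high)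
    where high = bilateral-order-above m (m ℕ.+ m) k p
  ... | inj₂ p | inj₂ r = mod-trans (≋⇒mod (≋-sym (*-assoc _ _ _)))
    (mod-trans (⊛-mod limit mod-refl) (≋⇒mod (*-identityˡ _)))
    where
    N j : ℕ
    N = m ℕ.+ m
    j = N ℕ.+ N ∸ k

    k+j≡2N : k ℕ.+ j ≡ N ℕ.+ N
    k+j≡2N = ℕ.m+[n∸m]≡n k≤2N

    m≤k : m ≤ k
    m≤k = ℕ.+-cancelʳ-≤ m m k (ℕ.≤-pred (subst (suc N ≤_) (ℕ.+-suc k m) p))

    m≤j : m ≤ j
    m≤j = ℕ.+-cancelˡ-≤ (N ℕ.+ m) m j (subst (_≤ N ℕ.+ m ℕ.+ j) (sym (ℕ.+-assoc N m m))
      (subst (_≤ N ℕ.+ m ℕ.+ j) k+j≡2N (ℕ.+-monoˡ-≤ j (ℕ.≤-pred (subst (suc k ≤_) (ℕ.+-suc N m) r)))))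

    limit : factorial N ⊛ binomial (N ℕ.+ N) k ≋ one mod m
    limit = subst (λ l → factorial N ⊛ binomial l k ≋ one mod m) k+j≡2N (binomial-limit k j m≤k m≤j (ℕ.m≤m+n m m))

  tripleFactor : ℕ → Series
  tripleFactor j = (one ⊕ a ⊛ Q ↑ j) ⊛ (one ⊕ b ⊛ Q ↑ j) ⊛ (one ⊖ Q ↑ suc j)

  tripleFactor-tame : Tame tripleFactor
  tripleFactor-tame = ⊛-tame (⊛-tame (power-tame a Q0) (power-tame b Q0)) (⊖-tame Q0)

  ∏-tripleFactor : ∀ N → ∏ N tripleFactor ≋ factorial N ⊛ expansion (N ℕ.+ N) (bilateral N)
  ∏-tripleFactor N = ≋-trans (≋-trans (∏-⊛ N _ _) (*-congʳ (∏-⊛ N _ _)))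
    (≋-trans (solve 3 (λ x y f → x :* y :* f := f :* (y :* x)) ≋-refl _ _ (factorial N)) (*-congˡ (≋-sym (expansion-bilateral N N))))

  -- The window on the left is -N, ..., N. The pairs of k and -k-1 for k ≤ N reach one index further
  -- down, to -N-1, and that term is subtracted.
  ∑-bilateral-theta : ∀ N → ∑ (suc (N ℕ.+ N)) (bilateral N) ≋ ∑ (suc N) (thetaTerm a b) ⊖ triangular b Q (suc N)
  ∑-bilateral-theta N = ≋-trans (subst (λ l → ∑ l (bilateral N) ≋ ∑ N (λ k → triangular b Q (suc k)) ⊕ ∑ (suc N) (triangular a Q)) (ℕ.+-suc N N) (∑-bilateral N (suc N)))
    (≋-trans (solve 3 (λ s t u → s :+ t := t :+ (s :+ u) :- u) ≋-refl
        (∑ N (λ k → triangular b Q (suc k))) (∑ (suc N) (triangular a Q)) (triangular b Q (suc N)))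
      (+-congʳ (≋-sym (∑-⊕ (suc N) _ _))))

  jacobi-triple-product : θ a b ≋ ∏∞ tripleFactor
  jacobi-triple-product = mod⇒≋ λ m → let N = m ℕ.+ m ; m≤N = ℕ.m≤m+n m m in
    mod-sym (mod-trans (∏∞-∏ tripleFactor-tame m≤N) (mod-trans (≋⇒mod (≋-trans (∏-tripleFactor N) (⊛-∑ (factorial N) (suc (N ℕ.+ N)) _)))
      (mod-trans (∑-mod (suc (N ℕ.+ N)) (λ { (s≤s k≤2N) → binomial-bilateral m k≤2N }))
        (mod-trans (≋⇒mod (∑-bilateral-theta N))
          (mod-trans (⊕-mod (mod-sym (θ-∑ a b Q0 m≤N)) (⊝-mod (mod-weaken m≤N (triangular-order b Q0 N))))
            (≋⇒mod (solve 1 (λ t → t :- con 0ℤ := t) ≋-refl (θ a b))))))))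
    where
    ∑-mod : ∀ {m} n {s t} → (∀ {k} → k < n → s k ≋ t k mod m) → ∑ n s ≋ ∑ n t mod m
    ∑-mod zero    p = mod-refl
    ∑-mod (suc n) p = ⊕-mod (∑-mod n (λ k<n → p (ℕ.m<n⇒m<1+n k<n))) (p ℕ.≤-refl)

θ-dissection : ∀ a b → (a ⊛ b) 0 ≡ 0ℤ → θ a b ≋
  θ (cube a ⊛ cube a ⊛ cube b) (cube b ⊛ cube b ⊛ cube a)
    ⊕ a ⊛ θ (cube (cube a) ⊛ (cube b ⊛ cube b)) (cube b)
    ⊕ b ⊛ θ (cube (cube b) ⊛ (cube a ⊛ cube a)) (cube a)
θ-dissection a b Q0 = mod⇒≋ λ n → mod-trans (θ-∑ a b Q0 (ℕ.m≤n⇒m≤o+n 2 (ℕ.m≤m*n n 3)))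
  (mod-trans (≋⇒mod (∑-thetaTerm-triple a b (suc n)))
    (mod-sym (⊕-mod (⊕-mod (θ-∑ _ _ (vanish p₀) ℕ.≤-refl) (⊛-modˡ a (θ-∑ _ _ (vanish (p₁ a b)) ℕ.≤-refl)))
      (⊛-modˡ b (θ-∑ _ _ (vanish (≋-trans (p₁ b a) (*-congˡ (*-comm b a)))) ℕ.≤-refl)))))
  where
  vanish : ∀ {f g} → f ≋ g ⊛ (a ⊛ b) → f 0 ≡ 0ℤ
  vanish {f} {g} p = trans (p at 0) (trans (⊛-at-zero g (a ⊛ b)) (trans (cong (ℤ._*_ (g 0)) Q0) (ℤ.*-zeroʳ (g 0))))

  p₀ : (cube a ⊛ cube a ⊛ cube b) ⊛ (cube b ⊛ cube b ⊛ cube a) ≋ cube (a ⊛ b) ⊛ cube (a ⊛ b) ⊛ ((a ⊛ b) ⊛ (a ⊛ b)) ⊛ (a ⊛ b)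
  p₀ = solve 2 (λ a b → let c = λ x → x :* x :* x in
    (c a :* c a :* c b) :* (c b :* c b :* c a) := c (a :* b) :* c (a :* b) :* ((a :* b) :* (a :* b)) :* (a :* b)) ≋-refl a b

  p₁ : ∀ a b → (cube (cube a) ⊛ (cube b ⊛ cube b)) ⊛ cube b ≋ cube (a ⊛ b) ⊛ cube (a ⊛ b) ⊛ ((a ⊛ b) ⊛ (a ⊛ b)) ⊛ (a ⊛ b)
  p₁ = solve 2 (λ a b → let c = λ x → x :* x :* x in
    (c (c a) :* (c b :* c b)) :* c b := c (a :* b) :* c (a :* b) :* ((a :* b) :* (a :* b)) :* (a :* b)) ≋-refl

-- Eta products

factor⁻ factor⁺ : ℕ → Series
factor⁻ m = one ⊖ q ↑ m
factor⁺ m = one ⊕ q ↑ m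

q↑-order : ∀ {m n} → n ≤ m → q ↑ m ≋ nil mod n
q↑-order n≤m = mod-weaken n≤m (↑-order refl _)

factor⁻-tame : ∀ {e : ℕ → ℕ} → (∀ j → j ≤ e j) → Tame (factor⁻ ∘ e)
factor⁻-tame p j = mod-trans (⊕-mod mod-refl (agreeing λ {i} i<j →
    trans (⊝-at _ i) (trans (cong ℤ.-_ (q↑-order (p j) below i<j)) (zeros i)))) (≋⇒mod (+-identityʳ one))
  where
  zeros : ∀ i → ℤ.- nil i ≡ nil i
  zeros zero    = refl
  zeros (suc i) = refl

factor⁺-tame : ∀ {e : ℕ → ℕ} → (∀ j → j ≤ e j) → Tame (factor⁺ ∘ e)
factor⁺-tame p j = mod-trans (⊕-mod mod-refl (q↑-order (p j))) (≋⇒mod (+-identityʳ one))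

≤-affine : ∀ r k .{{_ : ℕ.NonZero k}} j → j ≤ r ℕ.+ j ℕ.* k
≤-affine r k j = ℕ.≤-trans (ℕ.m≤m*n j k) (ℕ.m≤n+m (j ℕ.* k) r)

-- In Pochhammer notation (q^r; q^k)∞ and (-q^r; q^k)∞.
∏⁻ ∏⁺ : (r k : ℕ) → Series
∏⁻ r k = ∏∞ (λ j → factor⁻ (r ℕ.+ j ℕ.* k))
∏⁺ r k = ∏∞ (λ j → factor⁺ (r ℕ.+ j ℕ.* k))

∏⁻-tame : ∀ r k .{{_ : ℕ.NonZero k}} → Tame (λ j → factor⁻ (r ℕ.+ j ℕ.* k))
∏⁻-tame r k = factor⁻-tame {λ j → r ℕ.+ j ℕ.* k} (≤-affine r k)

∏⁺-tame : ∀ r k .{{_ : ℕ.NonZero k}} → Tame (λ j → factor⁺ (r ℕ.+ j ℕ.* k))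
∏⁺-tame r k = factor⁺-tame {λ j → r ℕ.+ j ℕ.* k} (≤-affine r k)

^≋↑ : ∀ f n → f ^ n ≋ f ↑ n
^≋↑ f zero    = ≋-refl
^≋↑ f (suc n) = ≋-trans (*≋⊛ f (f ^ n)) (*-congˡ (^≋↑ f n))

partialPochhammer≋∏ : ∀ a b n → partialPochhammer a b n ≋ ∏ n (λ j → one ⊖ a ⊛ b ↑ j)
partialPochhammer≋∏ a b zero    = ≋-refl
partialPochhammer≋∏ a b (suc n) = ≋-trans (*≋⊛ _ _) (*-cong (partialPochhammer≋∏ a b n)
  (≋-trans (-≋⊖ _ _) (+-congˡ (-‿cong (≋-trans (*≋⊛ a (b ^ n)) (*-congˡ (^≋↑ b n)))))))

E≋∏⁻ : ∀ k → E k ≋ ∏⁻ k k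
E≋∏⁻ k = pointwise λ n → ≋-trans (partialPochhammer≋∏ (q^ k) (q^ k) (suc n))
  (∏-cong (suc n) (λ j → +-congˡ (-‿cong (≋-trans (*-cong (q^≋q↑ k) (↑-cong j (q^≋q↑ k)))
    (≋-trans (*-congˡ (≋-sym (↑-* q j k))) (≋-sym (↑-+ q k (j ℕ.* k)))))))) at n

∏⁻-cong : ∀ {r k} {e : ℕ → ℕ} → (∀ j → e j ≡ r ℕ.+ j ℕ.* k) → ∏∞ (factor⁻ ∘ e) ≋ ∏⁻ r k
∏⁻-cong p = ∏∞-cong (λ j → ≡⇒≋ (cong factor⁻ (p j)))

∏⁺-cong : ∀ {r k} {e : ℕ → ℕ} → (∀ j → e j ≡ r ℕ.+ j ℕ.* k) → ∏∞ (factor⁺ ∘ e) ≋ ∏⁺ r k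
∏⁺-cong p = ∏∞-cong (λ j → ≡⇒≋ (cong factor⁺ (p j)))

∏⁻-double : ∀ r k .{{_ : ℕ.NonZero k}} → ∏⁻ r k ≋ ∏⁻ r (k ℕ.* 2) ⊛ ∏⁻ (r ℕ.+ k) (k ℕ.* 2)
∏⁻-double r k = ≋-trans (∏∞-double (∏⁻-tame r k))
  (*-cong (∏⁻-cong (λ j → e₀ j r k)) (∏⁻-cong (λ j → e₁ j r k)))
  where
  e₀ : ∀ j r k → r ℕ.+ j ℕ.* 2 ℕ.* k ≡ r ℕ.+ j ℕ.* (k ℕ.* 2)
  e₀ = solve-∀
  e₁ : ∀ j r k → r ℕ.+ (1 ℕ.+ j ℕ.* 2) ℕ.* k ≡ r ℕ.+ k ℕ.+ j ℕ.* (k ℕ.* 2)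
  e₁ = solve-∀

private
  triple₀ : ∀ j r k → r ℕ.+ j ℕ.* 3 ℕ.* k ≡ r ℕ.+ j ℕ.* (k ℕ.* 3)
  triple₀ = solve-∀
  triple₁ : ∀ j r k → r ℕ.+ (1 ℕ.+ j ℕ.* 3) ℕ.* k ≡ r ℕ.+ k ℕ.+ j ℕ.* (k ℕ.* 3)
  triple₁ = solve-∀
  triple₂ : ∀ j r k → r ℕ.+ (2 ℕ.+ j ℕ.* 3) ℕ.* k ≡ r ℕ.+ k ℕ.+ k ℕ.+ j ℕ.* (k ℕ.* 3)
  triple₂ = solve-∀

∏⁻-triple : ∀ r k .{{_ : ℕ.NonZero k}} →
  ∏⁻ r k ≋ ∏⁻ r (k ℕ.* 3) ⊛ ∏⁻ (r ℕ.+ k) (k ℕ.* 3) ⊛ ∏⁻ (r ℕ.+ k ℕ.+ k) (k ℕ.* 3)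
∏⁻-triple r k = ≋-trans (∏∞-triple (∏⁻-tame r k))
  (*-cong (*-cong (∏⁻-cong (λ j → triple₀ j r k)) (∏⁻-cong (λ j → triple₁ j r k))) (∏⁻-cong (λ j → triple₂ j r k)))

∏⁺-triple : ∀ r k .{{_ : ℕ.NonZero k}} →
  ∏⁺ r k ≋ ∏⁺ r (k ℕ.* 3) ⊛ ∏⁺ (r ℕ.+ k) (k ℕ.* 3) ⊛ ∏⁺ (r ℕ.+ k ℕ.+ k) (k ℕ.* 3)
∏⁺-triple r k = ≋-trans (∏∞-triple (∏⁺-tame r k))
  (*-cong (*-cong (∏⁺-cong (λ j → triple₀ j r k)) (∏⁺-cong (λ j → triple₁ j r k))) (∏⁺-cong (λ j → triple₂ j r k)))

∏⁺-∏⁻ : ∀ r k .{{_ : ℕ.NonZero k}} → ∏⁺ r k ⊛ ∏⁻ r k ≋ ∏⁻ (r ℕ.+ r) (k ℕ.+ k)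
∏⁺-∏⁻ r k = ≋-trans (≋-sym (∏∞-⊛ (∏⁺-tame r k) (∏⁻-tame r k))) (∏∞-cong λ j → begin
  factor⁺ (r ℕ.+ j ℕ.* k) ⊛ factor⁻ (r ℕ.+ j ℕ.* k)
    ≈⟨ solve 1 (λ z → (con 1ℤ :+ z) :* (con 1ℤ :- z) := con 1ℤ :- z :* z) ≋-refl (q ↑ (r ℕ.+ j ℕ.* k)) ⟩
  one ⊖ q ↑ (r ℕ.+ j ℕ.* k) ⊛ q ↑ (r ℕ.+ j ℕ.* k)
    ≈⟨ +-congˡ (-‿cong (≋-sym (↑-+ q (r ℕ.+ j ℕ.* k) (r ℕ.+ j ℕ.* k)))) ⟩
  factor⁻ (r ℕ.+ j ℕ.* k ℕ.+ (r ℕ.+ j ℕ.* k))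
    ≈⟨ ≡⇒≋ (cong factor⁻ (lemma j r k)) ⟩
  factor⁻ (r ℕ.+ r ℕ.+ j ℕ.* (k ℕ.+ k)) ∎)
  where
  open ≋-Reasoning
  lemma : ∀ j r k → r ℕ.+ j ℕ.* k ℕ.+ (r ℕ.+ j ℕ.* k) ≡ r ℕ.+ r ℕ.+ j ℕ.* (k ℕ.+ k)
  lemma = solve-∀

E-isUnit : ∀ k → IsUnit (E (suc k))
E-isUnit k = unit (trans (E≋∏⁻ (suc k) at 0) (unit-at (∏-isUnit 1 {λ j → factor⁻ (suc k ℕ.+ j ℕ.* suc k)} (λ j →
  unit (trans (⊖-at one (q ↑ (suc k ℕ.+ j ℕ.* suc k)) 0) (cong (ℤ._-_ 1ℤ) (⊛-at-zero q (q ↑ (k ℕ.+ j ℕ.* suc k)))))))))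

-- Theta series as eta quotients

module _ (d e : ℕ) .{{_ : ℕ.NonZero (d ℕ.+ e)}} where

  private
    exponent : ∀ {Q} c → Q ≋ q ↑ (d ℕ.+ e) → ∀ j → q ↑ c ⊛ Q ↑ j ≋ q ↑ (c ℕ.+ j ℕ.* (d ℕ.+ e))
    exponent c p j = ≋-trans (*-congˡ (≋-trans (↑-cong j p) (≋-sym (↑-* q j (d ℕ.+ e))))) (≋-sym (↑-+ q c (j ℕ.* (d ℕ.+ e))))

    vanish : ∀ {Q} → Q ≋ q ↑ (d ℕ.+ e) → Q 0 ≡ 0ℤ
    vanish p = trans (p at 0) (q↑-order (ℕ.>-nonZero⁻¹ (d ℕ.+ e)) below ℕ.≤-refl)

    last : ∀ {Q} → Q ≋ q ↑ (d ℕ.+ e) → ∀ j → one ⊖ Q ↑ suc j ≋ factor⁻ (d ℕ.+ e ℕ.+ j ℕ.* (d ℕ.+ e))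
    last p j = +-congˡ (-‿cong (≋-trans (↑-cong (suc j) p) (≋-sym (↑-* q (suc j) (d ℕ.+ e)))))

  θ⁺-product : θ (q ↑ d) (q ↑ e) ≋ ∏⁺ d (d ℕ.+ e) ⊛ ∏⁺ e (d ℕ.+ e) ⊛ ∏⁻ (d ℕ.+ e) (d ℕ.+ e)
  θ⁺-product = ≋-trans (jacobi-triple-product (q ↑ d) (q ↑ e) (vanish Q≋))
    (≋-trans (∏∞-cong (λ j → *-cong (*-cong (+-congˡ (exponent d Q≋ j)) (+-congˡ (exponent e Q≋ j))) (last Q≋ j)))
      (≋-trans (∏∞-⊛ (⊛-tame (∏⁺-tame d _) (∏⁺-tame e _)) (∏⁻-tame (d ℕ.+ e) (d ℕ.+ e))) (*-congʳ (∏∞-⊛ (∏⁺-tame d _) (∏⁺-tame e _)))))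
    where
    Q≋ : q ↑ d ⊛ q ↑ e ≋ q ↑ (d ℕ.+ e)
    Q≋ = ≋-sym (↑-+ q d e)

  θ⁻-product : θ (⊝ q ↑ d) (⊝ q ↑ e) ≋ ∏⁻ d (d ℕ.+ e) ⊛ ∏⁻ e (d ℕ.+ e) ⊛ ∏⁻ (d ℕ.+ e) (d ℕ.+ e)
  θ⁻-product = ≋-trans (jacobi-triple-product (⊝ q ↑ d) (⊝ q ↑ e) (vanish Q≋))
    (≋-trans (∏∞-cong (λ j → *-cong (*-cong (+-congˡ (negative d j)) (+-congˡ (negative e j))) (last Q≋ j)))
      (≋-trans (∏∞-⊛ (⊛-tame (∏⁻-tame d _) (∏⁻-tame e _)) (∏⁻-tame (d ℕ.+ e) (d ℕ.+ e))) (*-congʳ (∏∞-⊛ (∏⁻-tame d _) (∏⁻-tame e _)))))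
    where
    Q≋ : ⊝ q ↑ d ⊛ ⊝ q ↑ e ≋ q ↑ (d ℕ.+ e)
    Q≋ = ≋-trans (solve 2 (λ a b → :- a :* :- b := a :* b) ≋-refl (q ↑ d) (q ↑ e)) (≋-sym (↑-+ q d e))

    negative : ∀ c j → ⊝ q ↑ c ⊛ (⊝ q ↑ d ⊛ ⊝ q ↑ e) ↑ j ≋ ⊝ q ↑ (c ℕ.+ j ℕ.* (d ℕ.+ e))
    negative c j = ≋-trans (solve 2 (λ a b → :- a :* b := :- (a :* b)) ≋-refl (q ↑ c) _) (-‿cong (exponent c Q≋ j))

-- In Ramanujan's notation these are φ(-q), f(q, q²), f(-q, -q⁵) and 2ψ(q).

φ A B ψ₂ : Series
φ  = θ (⊝ q ↑ 1) (⊝ q ↑ 1)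
ψ₂ = θ (q ↑ 0) (q ↑ 1)
A  = θ (q ↑ 1) (q ↑ 2)
B  = θ (⊝ q ↑ 5) (⊝ q ↑ 1)

E₁-odd : ∏⁻ 1 2 ⊛ E 2 ≋ E 1
E₁-odd = ≋-sym (≋-trans (E≋∏⁻ 1) (≋-trans (∏⁻-double 1 1) (*-congˡ (≋-sym (E≋∏⁻ 2)))))

E₃-odd : ∏⁻ 3 6 ⊛ E 6 ≋ E 3
E₃-odd = ≋-sym (≋-trans (E≋∏⁻ 3) (≋-trans (∏⁻-double 3 3) (*-congˡ (≋-sym (E≋∏⁻ 6)))))

E₁-distinct : ∏⁺ 1 1 ⊛ E 1 ≋ E 2
E₁-distinct = ≋-trans (*-congˡ (E≋∏⁻ 1)) (≋-trans (∏⁺-∏⁻ 1 1) (≋-sym (E≋∏⁻ 2)))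

E₃-distinct : ∏⁺ 3 3 ⊛ E 3 ≋ E 6
E₃-distinct = ≋-trans (*-congˡ (E≋∏⁻ 3)) (≋-trans (∏⁺-∏⁻ 3 3) (≋-sym (E≋∏⁻ 6)))

φ-product : φ ⊛ E 2 ≋ E 1 ⊛ E 1
φ-product = ≋-trans (*-congʳ (≋-trans (θ⁻-product 1 1) (*-congˡ (≋-sym (E≋∏⁻ 2)))))
  (≋-trans (solve 2 (λ o e → o :* o :* e :* e := (o :* e) :* (o :* e)) ≋-refl (∏⁻ 1 2) (E 2)) (*-cong E₁-odd E₁-odd))

-- The 2 is 1 + q⁰, the first factor of `∏⁺ 0 1`; what follows it is a second copy of `∏⁺ 1 1`.
ψ₂-product : ψ₂ ⊛ E 1 ≋ const (+ 2) ⊛ (E 2 ⊛ E 2)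
ψ₂-product = ≋-trans (*-congʳ (≋-trans (θ⁺-product 0 1)
    (*-cong (*-congʳ (∏∞-head (∏⁺-tame 0 1) (∏⁺-tame 1 1))) (≋-sym (E≋∏⁻ 1)))))
  (≋-trans (solve 2 (λ d e → (con 1ℤ :+ con 1ℤ) :* d :* d :* e :* e := con (+ 2) :* ((d :* e) :* (d :* e))) ≋-refl (∏⁺ 1 1) (E 1))
    (*-congˡ (*-cong E₁-distinct E₁-distinct)))

-- The triple product contributes 1 + qⁿ for n prime to 3. Written as `∏⁺ 3 3 ⊛ E 3`, `E 6` supplies
-- the multiples of 3, and the completed product is Euler's E 2 / E 1.
A-product : A ⊛ E 6 ⊛ E 1 ≋ E 2 ⊛ (E 3 ⊛ E 3)
A-product = begin
  A ⊛ E 6 ⊛ E 1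
    ≈⟨ *-congʳ (*-cong (≋-trans (θ⁺-product 1 2) (*-congˡ (≋-sym (E≋∏⁻ 3)))) (≋-sym E₃-distinct)) ⟩
  ∏⁺ 1 3 ⊛ ∏⁺ 2 3 ⊛ E 3 ⊛ (∏⁺ 3 3 ⊛ E 3) ⊛ E 1
    ≈⟨ solve 5 (λ a b c e f → a :* b :* e :* (c :* e) :* f := a :* b :* c :* f :* (e :* e)) ≋-refl (∏⁺ 1 3) (∏⁺ 2 3) (∏⁺ 3 3) (E 3) (E 1) ⟩
  ∏⁺ 1 3 ⊛ ∏⁺ 2 3 ⊛ ∏⁺ 3 3 ⊛ E 1 ⊛ (E 3 ⊛ E 3)
    ≈⟨ *-congʳ (≋-trans (*-congʳ (≋-sym (∏⁺-triple 1 1))) E₁-distinct) ⟩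
  E 2 ⊛ (E 3 ⊛ E 3) ∎
  where open ≋-Reasoning

-- The same completion for 1 - qⁿ with n odd; here `E 3` supplies the odd multiples of 3.
B-product : B ⊛ E 3 ⊛ E 2 ≋ E 1 ⊛ (E 6 ⊛ E 6)
B-product = begin
  B ⊛ E 3 ⊛ E 2
    ≈⟨ *-congʳ (*-cong (≋-trans (θ⁻-product 5 1) (*-congˡ (≋-sym (E≋∏⁻ 6)))) (≋-sym E₃-odd)) ⟩
  ∏⁻ 5 6 ⊛ ∏⁻ 1 6 ⊛ E 6 ⊛ (∏⁻ 3 6 ⊛ E 6) ⊛ E 2
    ≈⟨ solve 5 (λ a b c e f → a :* b :* e :* (c :* e) :* f := b :* c :* a :* f :* (e :* e)) ≋-refl (∏⁻ 5 6) (∏⁻ 1 6) (∏⁻ 3 6) (E 6) (E 2) ⟩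
  ∏⁻ 1 6 ⊛ ∏⁻ 3 6 ⊛ ∏⁻ 5 6 ⊛ E 2 ⊛ (E 6 ⊛ E 6)
    ≈⟨ *-congʳ (≋-trans (*-congʳ (≋-sym (∏⁻-triple 1 2))) E₁-odd) ⟩
  E 1 ⊛ (E 6 ⊛ E 6) ∎
  where open ≋-Reasoning

-- Dilations

dilate-q↑ : ∀ n → dilate (q ↑ n) ≋ q ↑ (n ℕ.* 3)
dilate-q↑ n = ≋-trans (dilate-↑ q n) (≋-trans (↑-cong n dilate-q) (≋-sym (↑-* q n 3)))

dilate-⊖ : ∀ f g → dilate (f ⊖ g) ≋ dilate f ⊖ dilate g
dilate-⊖ f g = ≋-trans (dilate-⊕ f (⊝ g)) (+-congˡ (dilate-⊝ g))

dilate-∏ : ∀ n g → dilate (∏ n g) ≋ ∏ n (dilate ∘ g)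
dilate-∏ zero    g = dilate-const 1ℤ
dilate-∏ (suc n) g = ≋-trans (dilate-⊛ (∏ n g) (g n)) (*-congʳ (dilate-∏ n g))

dilate-∑ : ∀ n g → dilate (∑ n g) ≋ ∑ n (dilate ∘ g)
dilate-∑ zero    g = dilate-const 0ℤ
dilate-∑ (suc n) g = ≋-trans (dilate-⊕ (∑ n g) (g n)) (+-congʳ (dilate-∑ n g))

dilate-triangular : ∀ c Q n → dilate (triangular c Q n) ≋ triangular (dilate c) (dilate Q) n
dilate-triangular c Q zero    = dilate-const 1ℤ
dilate-triangular c Q (suc n) = ≋-trans (dilate-⊛ _ _)
  (*-cong (dilate-triangular c Q n) (≋-trans (dilate-⊛ c (Q ↑ n)) (*-congˡ (dilate-↑ Q n))))

dilate-θ : ∀ a b → (a ⊛ b) 0 ≡ 0ℤ → dilate (θ a b) ≋ θ (dilate a) (dilate b)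
dilate-θ a b Q0 = mod⇒≋ λ n → mod-trans (dilate-mod (θ-∑ a b Q0 {n} ℕ.≤-refl))
  (mod-trans (≋⇒mod (≋-trans (dilate-∑ (suc n) (thetaTerm a b)) (∑-cong (suc n) (λ {k} _ → terms k))))
    (mod-sym (θ-∑ (dilate a) (dilate b) Q0′ ℕ.≤-refl)))
  where
  Q0′ : (dilate a ⊛ dilate b) 0 ≡ 0ℤ
  Q0′ = trans (sym (dilate-⊛ a b at 0)) Q0

  terms : ∀ k → dilate (thetaTerm a b k) ≋ thetaTerm (dilate a) (dilate b) k
  terms k = ≋-trans (dilate-⊕ _ _) (+-cong
    (≋-trans (dilate-triangular a (a ⊛ b) k) (triangular-cong k ≋-refl (dilate-⊛ a b)))
    (≋-trans (dilate-triangular b (a ⊛ b) (suc k)) (triangular-cong (suc k) ≋-refl (dilate-⊛ a b))))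

dilate-E : ∀ k → dilate (E (suc k)) ≋ E (suc k ℕ.* 3)
dilate-E k = ≋-trans (≋-trans (dilate-cong (E≋∏⁻ (suc k))) (mod⇒≋ λ n →
    mod-trans (dilate-mod (∏∞-∏ (∏⁻-tame (suc k) (suc k)) {n} ℕ.≤-refl))
      (mod-trans (≋⇒mod (≋-trans (dilate-∏ n _) (∏-cong n factors))) (mod-sym (∏∞-∏ (∏⁻-tame K K) ℕ.≤-refl)))))
  (≋-sym (E≋∏⁻ K))
  where
  K : ℕ
  K = suc k ℕ.* 3

  exponents : ∀ k j → (k ℕ.+ j ℕ.* k) ℕ.* 3 ≡ k ℕ.* 3 ℕ.+ j ℕ.* (k ℕ.* 3)
  exponents = solve-∀

  factors : ∀ j → dilate (factor⁻ (suc k ℕ.+ j ℕ.* suc k)) ≋ factor⁻ (K ℕ.+ j ℕ.* K)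
  factors j = ≋-trans (dilate-⊖ one _) (+-cong (dilate-const 1ℤ) (-‿cong
    (≋-trans (dilate-q↑ (suc k ℕ.+ j ℕ.* suc k)) (≡⇒≋ (cong (q ↑_) (exponents (suc k) j))))))

-- The 3-dissections of the theta series

-- Visible on the product side. The sum would have to be reindexed, since the pairing of k with -k-1
-- is not symmetric.
θ-sym : ∀ a b → (a ⊛ b) 0 ≡ 0ℤ → θ a b ≋ θ b a
θ-sym a b Q0 = ≋-trans (jacobi-triple-product a b Q0) (≋-trans
  (∏∞-cong (λ j → *-cong (≋-trans (*-comm _ _) (*-cong (+-congˡ (*-congˡ (↑-cong j (*-comm a b)))) (+-congˡ (*-congˡ (↑-cong j (*-comm a b))))))
    (+-congˡ (-‿cong (↑-cong (suc j) (*-comm a b))))))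
  (≋-sym (jacobi-triple-product b a (trans (*-comm b a at 0) Q0))))

dilate-neg-q↑ : ∀ n → dilate (⊝ q ↑ n) ≋ ⊝ q ↑ (n ℕ.* 3)
dilate-neg-q↑ n = ≋-trans (dilate-⊝ (q ↑ n)) (-‿cong (dilate-q↑ n))

φ₃ φ₉ ψ₃ ψ₉ : Series
φ₃ = dilate φ
φ₉ = dilate φ₃
ψ₃ = dilate ψ₂
ψ₉ = dilate ψ₃

private
  neg-vanish : ∀ m n → (⊝ q ↑ suc m ⊛ ⊝ q ↑ suc n) 0 ≡ 0ℤ
  neg-vanish m n = trans (⊛-at-zero _ _) (cong (ℤ._* (⊝ q ↑ suc n) 0) (trans (⊝-at (q ↑ suc m) 0) (cong ℤ.-_ (⊛-at-zero q (q ↑ m)))))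

  pos-vanish : ∀ m n → (q ↑ m ⊛ q ↑ suc n) 0 ≡ 0ℤ
  pos-vanish m n = trans (⊛-at-zero _ _) (trans (cong (ℤ._*_ ((q ↑ m) 0)) (⊛-at-zero q (q ↑ n))) (ℤ.*-zeroʳ ((q ↑ m) 0)))

φ₉-theta : φ₉ ≋ θ (⊝ q ↑ 9) (⊝ q ↑ 9)
φ₉-theta = ≋-trans (dilate-cong (≋-trans (dilate-θ _ _ (neg-vanish 0 0)) (θ-cong (dilate-neg-q↑ 1) (dilate-neg-q↑ 1))))
  (≋-trans (dilate-θ _ _ (neg-vanish 2 2)) (θ-cong (dilate-neg-q↑ 3) (dilate-neg-q↑ 3)))

ψ₉-theta : ψ₉ ≋ θ (q ↑ 0) (q ↑ 9)
ψ₉-theta = ≋-trans (dilate-cong (≋-trans (dilate-θ _ _ (pos-vanish 0 0)) (θ-cong (dilate-q↑ 0) (dilate-q↑ 1))))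
  (≋-trans (dilate-θ _ _ (pos-vanish 0 2)) (θ-cong (dilate-q↑ 0) (dilate-q↑ 3)))

A₃-theta : dilate A ≋ θ (q ↑ 3) (q ↑ 6)
A₃-theta = ≋-trans (dilate-θ _ _ (pos-vanish 1 1)) (θ-cong (dilate-q↑ 1) (dilate-q↑ 2))

B₃-theta : dilate B ≋ θ (⊝ q ↑ 15) (⊝ q ↑ 3)
B₃-theta = ≋-trans (dilate-θ _ _ (neg-vanish 4 0)) (θ-cong (dilate-neg-q↑ 5) (dilate-neg-q↑ 1))

-- As `a = b`, the last two components coincide, whence the 2, and the exponents 2 modulo 3 are
-- absent. With one section empty the norm is a combination of two cubes.
φ-dissection : φ ≋ φ₉ ⊖ const (+ 2) ⊛ (q ⊛ dilate B)
φ-dissection = ≋-trans (θ-dissection (⊝ q ↑ 1) (⊝ q ↑ 1) (neg-vanish 0 0)) (≋-trans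
  (+-cong (+-cong (≋-trans (θ-cong ninth ninth) (≋-sym φ₉-theta))
                  (*-congˡ (≋-trans (θ-cong fifteenth third) (≋-sym B₃-theta))))
          (*-congˡ (≋-trans (θ-cong fifteenth third) (≋-sym B₃-theta))))
  (solve 3 (λ q f b → f :+ :- pow 1 q :* b :+ :- pow 1 q :* b := f :- con (+ 2) :* (q :* b)) ≋-refl q φ₉ (dilate B)))
  where
  a : Series
  a = ⊝ q ↑ 1

  ninth : cube a ⊛ cube a ⊛ cube a ≋ ⊝ q ↑ 9
  ninth = solve 1 (λ q → let a = :- pow 1 q in cub a :* cub a :* cub a := :- pow 9 q) ≋-refl q

  fifteenth : cube (cube a) ⊛ (cube a ⊛ cube a) ≋ ⊝ q ↑ 15
  fifteenth = solve 1 (λ q → let a = :- pow 1 q in cub (cub a) :* (cub a :* cub a) := :- pow 15 q) ≋-refl q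

  third : cube a ≋ ⊝ q ↑ 3
  third = solve 1 (λ q → cub (:- pow 1 q) := :- pow 3 q) ≋-refl q

-- As `a = 1`, the first two components coincide up to the order of the arguments of `θ`; again one
-- section is empty.
ψ₂-dissection : ψ₂ ≋ const (+ 2) ⊛ dilate A ⊕ q ⊛ ψ₉
ψ₂-dissection = ≋-trans (θ-dissection (q ↑ 0) (q ↑ 1) (pos-vanish 0 0)) (≋-trans
  (+-cong (+-cong (≋-trans (θ-cong p₁ p₂) (≋-sym A₃-theta))
                  (*-congˡ (≋-trans (θ-cong p₃ p₄) (≋-trans (θ-sym _ _ (pos-vanish 6 2)) (≋-sym A₃-theta)))))
          (*-congˡ (≋-trans (θ-cong p₅ p₆) (≋-trans (θ-sym _ _ (trans (*-comm (q ↑ 9) (q ↑ 0) at 0) (pos-vanish 0 8))) (≋-sym ψ₉-theta)))))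
  (solve 3 (λ q a p → a :+ con 1ℤ :* a :+ pow 1 q :* p := con (+ 2) :* a :+ q :* p) ≋-refl q (dilate A) ψ₉))
  where
  a b : Series
  a = q ↑ 0
  b = q ↑ 1

  p₁ : cube a ⊛ cube a ⊛ cube b ≋ q ↑ 3
  p₁ = solve 1 (λ q → cub (pow 0 q) :* cub (pow 0 q) :* cub (pow 1 q) := pow 3 q) ≋-refl q

  p₂ : cube b ⊛ cube b ⊛ cube a ≋ q ↑ 6
  p₂ = solve 1 (λ q → cub (pow 1 q) :* cub (pow 1 q) :* cub (pow 0 q) := pow 6 q) ≋-refl q

  p₃ : cube (cube a) ⊛ (cube b ⊛ cube b) ≋ q ↑ 6
  p₃ = solve 1 (λ q → cub (cub (pow 0 q)) :* (cub (pow 1 q) :* cub (pow 1 q)) := pow 6 q) ≋-refl q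

  p₄ : cube b ≋ q ↑ 3
  p₄ = solve 1 (λ q → cub (pow 1 q) := pow 3 q) ≋-refl q

  p₅ : cube (cube b) ⊛ (cube a ⊛ cube a) ≋ q ↑ 9
  p₅ = solve 1 (λ q → cub (cub (pow 1 q)) :* (cub (pow 0 q) :* cub (pow 0 q)) := pow 9 q) ≋-refl q

  p₆ : cube a ≋ q ↑ 0
  p₆ = solve 1 (λ q → cub (pow 0 q) := pow 0 q) ≋-refl q

-- The norm from ℤ[[q]] to ℤ[[q³]], composed with q³ ↦ q

normForm : Series → Series → Series → Series
normForm a b c = cube a ⊕ q ⊛ cube b ⊕ q ⊛ (q ⊛ cube c) ⊖ const (+ 3) ⊛ (q ⊛ (a ⊛ b ⊛ c))

norm : Series → Series
norm f = normForm (section 0 f) (section 1 f) (section 2 f)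

cube-cong : ∀ {f g} → f ≋ g → cube f ≋ cube g
cube-cong p = *-cong (*-cong p p) p

normForm-cong : ∀ {a a′ b b′ c c′} → a ≋ a′ → b ≋ b′ → c ≋ c′ → normForm a b c ≋ normForm a′ b′ c′
normForm-cong p r s = +-cong (+-cong (+-cong (cube-cong p) (*-congˡ (cube-cong r))) (*-congˡ (*-congˡ (cube-cong s))))
  (-‿cong (*-congˡ (*-congˡ (*-cong (*-cong p r) s))))

norm-cong : ∀ {f g} → f ≋ g → norm f ≋ norm g
norm-cong p = normForm-cong (section-cong 0 p) (section-cong 1 p) (section-cong 2 p)

norm-assemble : ∀ {f} a b c → f ≋ assemble a b c → norm f ≋ normForm a b c
norm-assemble a b c p = ≋-trans (norm-cong p)
  (normForm-cong (section₀-assemble a b c) (section₁-assemble a b c) (section₂-assemble a b c))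

assemble-⊛ : ∀ a b c a′ b′ c′ → assemble a b c ⊛ assemble a′ b′ c′ ≋
  assemble (a ⊛ a′ ⊕ q ⊛ (b ⊛ c′ ⊕ c ⊛ b′)) (a ⊛ b′ ⊕ b ⊛ a′ ⊕ q ⊛ (c ⊛ c′)) (a ⊛ c′ ⊕ c ⊛ a′ ⊕ b ⊛ b′)
assemble-⊛ a b c a′ b′ c′ = ≋-trans
  (solve 7 (λ q a b c a′ b′ c′ → (a :+ q :* b :+ q :* (q :* c)) :* (a′ :+ q :* b′ :+ q :* (q :* c′)) :=
      a :* a′ :+ pow 3 q :* (b :* c′ :+ c :* b′) :+ q :* (a :* b′ :+ b :* a′ :+ pow 3 q :* (c :* c′)) :+ q :* (q :* (a :* c′ :+ c :* a′ :+ b :* b′)))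
    ≋-refl q (dilate a) (dilate b) (dilate c) (dilate a′) (dilate b′) (dilate c′))
  (+-cong (+-cong
      (≋-sym (distrib₂ (dilate-⊛ a a′) (≋-trans (dilate-⊛ q _) (*-cong dilate-q (distrib₂ (dilate-⊛ b c′) (dilate-⊛ c b′))))))
      (*-congˡ (≋-sym (distrib₂ (distrib₂ (dilate-⊛ a b′) (dilate-⊛ b a′)) (≋-trans (dilate-⊛ q _) (*-cong dilate-q (dilate-⊛ c c′)))))))
    (*-congˡ (*-congˡ (≋-sym (distrib₂ (distrib₂ (dilate-⊛ a c′) (dilate-⊛ c a′)) (dilate-⊛ b b′))))))
  where
  distrib₂ : ∀ {f g f′ g′} → dilate f ≋ f′ → dilate g ≋ g′ → dilate (f ⊕ g) ≋ f′ ⊕ g′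
  distrib₂ p r = ≋-trans (dilate-⊕ _ _) (+-cong p r)

-- The norm is the determinant of multiplication by f over series in q³. Written in the three
-- sections, its multiplicativity is a polynomial identity, without cube roots of unity.
norm-⊛ : ∀ f g → norm (f ⊛ g) ≋ norm f ⊛ norm g
norm-⊛ f g = ≋-trans
  (norm-assemble _ _ _ (≋-trans (*-cong (assemble-sections f) (assemble-sections g)) (assemble-⊛ _ _ _ _ _ _)))
  (≋-sym (solve 7 (λ q a b c a′ b′ c′ →
      let n = λ a b c → cub a :+ q :* cub b :+ q :* (q :* cub c) :- con (+ 3) :* (q :* (a :* b :* c)) in
      n a b c :* n a′ b′ c′ := n (a :* a′ :+ q :* (b :* c′ :+ c :* b′)) (a :* b′ :+ b :* a′ :+ q :* (c :* c′)) (a :* c′ :+ c :* a′ :+ b :* b′))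
    ≋-refl q (section 0 f) (section 1 f) (section 2 f) (section 0 g) (section 1 g) (section 2 g)))

norm-dilate : ∀ f → norm (dilate f) ≋ cube f
norm-dilate f = ≋-trans
  (norm-assemble f nil nil (≋-trans (solve 2 (λ f q → f := f :+ q :* con 0ℤ :+ q :* (q :* con 0ℤ)) ≋-refl (dilate f) q)
    (+-cong (+-congˡ (*-congˡ (≋-sym (dilate-const 0ℤ)))) (*-congˡ (*-congˡ (≋-sym (dilate-const 0ℤ)))))))
  (solve 2 (λ q f → cub f :+ q :* cub (con 0ℤ) :+ q :* (q :* cub (con 0ℤ)) :- con (+ 3) :* (q :* (f :* con 0ℤ :* con 0ℤ)) := cub f) ≋-refl q f)

norm-one : norm one ≋ one
norm-one = ≋-trans (norm-cong (≋-sym (dilate-const 1ℤ))) (≋-trans (norm-dilate one) (solve 0 (cub (con 1ℤ) := con 1ℤ) ≋-refl))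

norm-∏ : ∀ n g → norm (∏ n g) ≋ ∏ n (norm ∘ g)
norm-∏ zero    g = norm-one
norm-∏ (suc n) g = ≋-trans (norm-⊛ (∏ n g) (g n)) (*-congʳ (norm-∏ n g))

norm-mod : ∀ {f g n} → f ≋ g mod (n ℕ.* 3) → norm f ≋ norm g mod n
norm-mod {f} {g} {n} p = ⊕-mod (⊕-mod (⊕-mod (cube-mod (sec 0 (s≤s z≤n))) (⊛-modˡ q (cube-mod (sec 1 (s≤s (s≤s z≤n))))))
    (⊛-modˡ q (⊛-modˡ q (cube-mod (sec 2 (s≤s (s≤s (s≤s z≤n))))))))
  (⊝-mod (⊛-modˡ (const (+ 3)) (⊛-modˡ q (⊛-mod (⊛-mod (sec 0 (s≤s z≤n)) (sec 1 (s≤s (s≤s z≤n)))) (sec 2 (s≤s (s≤s (s≤s z≤n))))))))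
  where
  cube-mod : ∀ {f g} → f ≋ g mod n → cube f ≋ cube g mod n
  cube-mod p = ⊛-mod (⊛-mod p p) p

  sec : ∀ r → r < 3 → section r f ≋ section r g mod n
  sec r r<3 = agreeing λ {i} i<n → p below ℕ.<-≤-trans (ℕ.+-monoˡ-< (i ℕ.* 3) r<3) (ℕ.*-monoˡ-≤ 3 i<n)

norm-∏∞ : ∀ {g} → Tame g → Tame (norm ∘ g) → norm (∏∞ g) ≋ ∏∞ (norm ∘ g)
norm-∏∞ {g} t u = mod⇒≋ λ n → mod-trans (norm-mod (∏∞-∏ t {n ℕ.* 3} ℕ.≤-refl))
  (mod-trans (≋⇒mod (norm-∏ (n ℕ.* 3) g)) (mod-sym (∏∞-∏ u (ℕ.m≤m*n n 3))))

private
  q↑-triple : ∀ r t → q ↑ (r ℕ.+ t ℕ.* 3) ≋ q ↑ r ⊛ cube (q ↑ t)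
  q↑-triple r t = ≋-trans (↑-+ q r (t ℕ.* 3)) (*-congˡ (≋-trans (↑-* q t 3)
    (≋-trans (↑-cong t (solve 1 (λ q → pow 3 q := cub q) ≋-refl q)) (≋-trans (*-↑ (q ⊛ q) q t) (*-congʳ (*-↑ q q t))))))

-- For n prime to 3 the product of 1 - (ωq)ⁿ over the cube roots of unity ω is 1 - q^(3n), and q³ ↦
-- q restores the factor. For n divisible by 3 the conjugates are equal, whence the cube in
-- `norm-factor⁻-0`.
norm-factor⁻-1 : ∀ t → norm (factor⁻ (1 ℕ.+ t ℕ.* 3)) ≋ factor⁻ (1 ℕ.+ t ℕ.* 3)
norm-factor⁻-1 t = ≋-trans (norm-assemble one (⊝ q ↑ t) nil
    (≋-trans (solve 2 (λ q y → con 1ℤ :- q :* y := con 1ℤ :+ q :* :- y :+ q :* (q :* con 0ℤ)) ≋-refl q (q ↑ (t ℕ.* 3)))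
      (+-cong (+-cong (≋-sym (dilate-const 1ℤ)) (*-congˡ (≋-sym (≋-trans (dilate-neg-q↑ t) ≋-refl)))) (*-congˡ (*-congˡ (≋-sym (dilate-const 0ℤ)))))))
  (≋-trans (solve 2 (λ q z → cub (con 1ℤ) :+ q :* cub (:- z) :+ q :* (q :* cub (con 0ℤ)) :- con (+ 3) :* (q :* (con 1ℤ :* :- z :* con 0ℤ)) := con 1ℤ :- pow 1 q :* cub z) ≋-refl q (q ↑ t))
    (+-congˡ (-‿cong (≋-sym (q↑-triple 1 t)))))

norm-factor⁻-2 : ∀ t → norm (factor⁻ (2 ℕ.+ t ℕ.* 3)) ≋ factor⁻ (2 ℕ.+ t ℕ.* 3)
norm-factor⁻-2 t = ≋-trans (norm-assemble one nil (⊝ q ↑ t)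
    (≋-trans (solve 2 (λ q y → con 1ℤ :- q :* (q :* y) := con 1ℤ :+ q :* con 0ℤ :+ q :* (q :* :- y)) ≋-refl q (q ↑ (t ℕ.* 3)))
      (+-cong (+-cong (≋-sym (dilate-const 1ℤ)) (*-congˡ (≋-sym (dilate-const 0ℤ)))) (*-congˡ (*-congˡ (≋-sym (dilate-neg-q↑ t)))))))
  (≋-trans (solve 2 (λ q z → cub (con 1ℤ) :+ q :* cub (con 0ℤ) :+ q :* (q :* cub (:- z)) :- con (+ 3) :* (q :* (con 1ℤ :* con 0ℤ :* :- z)) := con 1ℤ :- pow 2 q :* cub z) ≋-refl q (q ↑ t))
    (+-congˡ (-‿cong (≋-sym (q↑-triple 2 t)))))

norm-factor⁻-0 : ∀ t → norm (factor⁻ (t ℕ.* 3)) ≋ cube (factor⁻ t)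
norm-factor⁻-0 t = ≋-trans (norm-cong (≋-sym (≋-trans (dilate-⊖ one (q ↑ t)) (+-cong (dilate-const 1ℤ) (-‿cong (dilate-q↑ t)))))) (norm-dilate (factor⁻ t))

cube-tame : ∀ {g} → Tame g → Tame (cube ∘ g)
cube-tame t = ⊛-tame (⊛-tame t t) t

∏∞-cube : ∀ {g} → Tame g → ∏∞ (cube ∘ g) ≋ cube (∏∞ g)
∏∞-cube t = ≋-trans (∏∞-⊛ (⊛-tame t t) t) (*-congʳ (∏∞-⊛ t t))

tame-cong : ∀ {g h} → (∀ j → g j ≋ h j) → Tame g → Tame h
tame-cong p t j = mod-trans (≋⇒mod (≋-sym (p j))) (t j)

-- The norm divides orders of agreement by three, so tameness does not simply pass through it. For
-- groups of three consecutive factors it is read off from the explicit value in the hypothesis.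
norm-∏⁻ : ∀ r k .{{_ : ℕ.NonZero k}} {r₁ r₂ k₃} .{{_ : ℕ.NonZero k₃}} →
  (∀ j → norm (triples (λ j → factor⁻ (r ℕ.+ j ℕ.* k)) j) ≋ factor⁻ (r₁ ℕ.+ j ℕ.* k₃) ⊛ factor⁻ (r₂ ℕ.+ j ℕ.* k₃) ⊛ cube (factor⁻ (r ℕ.+ j ℕ.* k))) →
  norm (∏⁻ r k) ≋ ∏⁻ r₁ k₃ ⊛ ∏⁻ r₂ k₃ ⊛ cube (∏⁻ r k)
norm-∏⁻ r k {r₁} {r₂} {k₃} p = ≋-trans (norm-cong (∏∞-triples (∏⁻-tame r k)))
  (≋-trans (norm-∏∞ (triples-tame (∏⁻-tame r k)) (tame-cong (λ j → ≋-sym (p j)) tame))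
    (≋-trans (∏∞-cong p) (≋-trans (∏∞-⊛ (⊛-tame (∏⁻-tame r₁ k₃) (∏⁻-tame r₂ k₃)) (cube-tame (∏⁻-tame r k)))
      (*-cong (∏∞-⊛ (∏⁻-tame r₁ k₃) (∏⁻-tame r₂ k₃)) (∏∞-cube (∏⁻-tame r k))))))
  where
  tame : Tame (λ j → factor⁻ (r₁ ℕ.+ j ℕ.* k₃) ⊛ factor⁻ (r₂ ℕ.+ j ℕ.* k₃) ⊛ cube (factor⁻ (r ℕ.+ j ℕ.* k)))
  tame = ⊛-tame (⊛-tame (∏⁻-tame r₁ k₃) (∏⁻-tame r₂ k₃)) (cube-tame (∏⁻-tame r k))

private
  norm-factors : ∀ {f g h f′ g′ h′} → norm f ≋ f′ → norm g ≋ g′ → norm h ≋ h′ → norm (f ⊛ g ⊛ h) ≋ f′ ⊛ g′ ⊛ h′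
  norm-factors p r s = ≋-trans (norm-⊛ _ _) (*-cong (≋-trans (norm-⊛ _ _) (*-cong p r)) s)

  re : ∀ {m n} {f : Series} → m ≡ n → norm (factor⁻ n) ≋ f → norm (factor⁻ m) ≋ f
  re refl p = p

-- Exponents prime to 3 contribute E 1 / E 3, multiples of 3 the cube of `E 1`.
norm-E₁ : norm (E 1) ⊛ E 3 ≋ E 1 ⊛ cube (E 1)
norm-E₁ = ≋-trans (*-cong (≋-trans (norm-cong (E≋∏⁻ 1)) (norm-∏⁻ 1 1 {1} {2} {3} factors)) (E≋∏⁻ 3))
  (≋-trans (solve 4 (λ a b c d → a :* b :* c :* d := a :* b :* d :* c) ≋-refl (∏⁻ 1 3) (∏⁻ 2 3) (cube (∏⁻ 1 1)) (∏⁻ 3 3))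
    (*-cong (≋-trans (≋-sym (∏⁻-triple 1 1)) (≋-sym (E≋∏⁻ 1))) (cube-cong (≋-sym (E≋∏⁻ 1)))))
  where
  e₁ : ∀ j → 1 ℕ.+ j ℕ.* 3 ℕ.* 1 ≡ 1 ℕ.+ j ℕ.* 3
  e₁ = solve-∀
  e₂ : ∀ j → 1 ℕ.+ (1 ℕ.+ j ℕ.* 3) ℕ.* 1 ≡ 2 ℕ.+ j ℕ.* 3
  e₂ = solve-∀
  e₃ : ∀ j → 1 ℕ.+ (2 ℕ.+ j ℕ.* 3) ℕ.* 1 ≡ (1 ℕ.+ j ℕ.* 1) ℕ.* 3
  e₃ = solve-∀

  factors : ∀ j → norm (triples (λ j → factor⁻ (1 ℕ.+ j ℕ.* 1)) j) ≋ factor⁻ (1 ℕ.+ j ℕ.* 3) ⊛ factor⁻ (2 ℕ.+ j ℕ.* 3) ⊛ cube (factor⁻ (1 ℕ.+ j ℕ.* 1))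
  factors j = norm-factors (re (e₁ j) (norm-factor⁻-1 j)) (re (e₂ j) (norm-factor⁻-2 j)) (re (e₃ j) (norm-factor⁻-0 (1 ℕ.+ j ℕ.* 1)))

norm-E₂ : norm (E 2) ⊛ E 6 ≋ E 2 ⊛ cube (E 2)
norm-E₂ = ≋-trans (*-cong (≋-trans (norm-cong (E≋∏⁻ 2)) (norm-∏⁻ 2 2 {2} {4} {6} factors)) (E≋∏⁻ 6))
  (≋-trans (solve 4 (λ a b c d → a :* b :* c :* d := a :* b :* d :* c) ≋-refl (∏⁻ 2 6) (∏⁻ 4 6) (cube (∏⁻ 2 2)) (∏⁻ 6 6))
    (*-cong (≋-trans (≋-sym (∏⁻-triple 2 2)) (≋-sym (E≋∏⁻ 2))) (cube-cong (≋-sym (E≋∏⁻ 2)))))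
  where
  e₁ : ∀ j → 2 ℕ.+ j ℕ.* 3 ℕ.* 2 ≡ 2 ℕ.+ (j ℕ.* 2) ℕ.* 3
  e₁ = solve-∀
  e₁′ : ∀ j → 2 ℕ.+ (j ℕ.* 2) ℕ.* 3 ≡ 2 ℕ.+ j ℕ.* 6
  e₁′ = solve-∀
  e₂ : ∀ j → 2 ℕ.+ (1 ℕ.+ j ℕ.* 3) ℕ.* 2 ≡ 1 ℕ.+ (1 ℕ.+ j ℕ.* 2) ℕ.* 3
  e₂ = solve-∀
  e₂′ : ∀ j → 1 ℕ.+ (1 ℕ.+ j ℕ.* 2) ℕ.* 3 ≡ 4 ℕ.+ j ℕ.* 6
  e₂′ = solve-∀
  e₃ : ∀ j → 2 ℕ.+ (2 ℕ.+ j ℕ.* 3) ℕ.* 2 ≡ (2 ℕ.+ j ℕ.* 2) ℕ.* 3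
  e₃ = solve-∀

  factors : ∀ j → norm (triples (λ j → factor⁻ (2 ℕ.+ j ℕ.* 2)) j) ≋ factor⁻ (2 ℕ.+ j ℕ.* 6) ⊛ factor⁻ (4 ℕ.+ j ℕ.* 6) ⊛ cube (factor⁻ (2 ℕ.+ j ℕ.* 2))
  factors j = norm-factors
    (≋-trans (re (e₁ j) (norm-factor⁻-2 (j ℕ.* 2))) (≡⇒≋ (cong factor⁻ (e₁′ j))))
    (≋-trans (re (e₂ j) (norm-factor⁻-1 (1 ℕ.+ j ℕ.* 2))) (≡⇒≋ (cong factor⁻ (e₂′ j))))
    (re (e₃ j) (norm-factor⁻-0 (2 ℕ.+ j ℕ.* 2)))

norm-φ : norm φ ≋ cube φ₃ ⊖ const (+ 8) ⊛ (q ⊛ cube B)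
norm-φ = ≋-trans (norm-assemble φ₃ (const (ℤ.- + 2) ⊛ B) nil
    (≋-trans φ-dissection (≋-trans
      (solve 3 (λ q f b → f :- con (+ 2) :* (q :* b) := f :+ q :* (con (ℤ.- + 2) :* b) :+ q :* (q :* con 0ℤ)) ≋-refl q φ₉ (dilate B))
      (+-cong (+-congˡ (*-congˡ (≋-sym (≋-trans (dilate-⊛ _ B) (*-congʳ (dilate-const _)))))) (*-congˡ (*-congˡ (≋-sym (dilate-const 0ℤ))))))))
  (solve 3 (λ q f b → cub f :+ q :* cub (con (ℤ.- + 2) :* b) :+ q :* (q :* cub (con 0ℤ)) :- con (+ 3) :* (q :* (f :* (con (ℤ.- + 2) :* b) :* con 0ℤ))
      := cub f :- con (+ 8) :* (q :* cub b)) ≋-refl q φ₃ B)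

norm-ψ₂ : norm ψ₂ ≋ const (+ 8) ⊛ cube A ⊕ q ⊛ cube ψ₃
norm-ψ₂ = ≋-trans (norm-assemble (const (+ 2) ⊛ A) ψ₃ nil
    (≋-trans ψ₂-dissection (≋-trans
      (solve 3 (λ q a p → con (+ 2) :* a :+ q :* p := con (+ 2) :* a :+ q :* p :+ q :* (q :* con 0ℤ)) ≋-refl q (dilate A) ψ₉)
      (+-cong (+-congʳ (≋-sym (≋-trans (dilate-⊛ _ A) (*-congʳ (dilate-const _))))) (*-congˡ (*-congˡ (≋-sym (dilate-const 0ℤ))))))))
  (solve 3 (λ q a p → cub (con (+ 2) :* a) :+ q :* cub p :+ q :* (q :* cub (con 0ℤ)) :- con (+ 3) :* (q :* (con (+ 2) :* a :* p :* con 0ℤ))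
      := con (+ 8) :* cub a :+ q :* cub p) ≋-refl q A ψ₃)

-- Cancellation of units and integers; the product formulas at q³ and q⁹

inverse≋inv : ∀ f → inverse f ≋ inv f
inverse≋inv f = pointwise λ n → sum-cong-≗ {suc n} λ k →
  ≋-trans (^≋↑ (1# Defs.- f) (toℕ k)) (↑-cong (toℕ k) (-≋⊖ 1# f)) at n

÷-⊛ : ∀ {f g} → IsUnit g → (f ÷ g) ⊛ g ≋ f
÷-⊛ {f} {g} u = ≋-trans (*-congʳ (≋-trans (*≋⊛ f (inverse g)) (*-congˡ (inverse≋inv g))))
  (≋-trans (*-assoc _ _ _) (≋-trans (*-congˡ (≋-trans (*-comm _ _) (inverseʳ u))) (*-identityʳ f)))

⊛-isUnitˡ : ∀ {f g h} → IsUnit g → IsUnit h → f ⊛ g ≋ h → IsUnit f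
⊛-isUnitˡ {f} {g} (unit u) (unit w) p = unit (trans (sym (ℤ.*-identityʳ (f 0)))
  (trans (cong (ℤ._*_ (f 0)) (sym u)) (trans (sym (⊛-at-zero f g)) (trans (p at 0) w))))

isUnit-cong : ∀ {f g} → f ≋ g → IsUnit g → IsUnit f
isUnit-cong p (unit u) = unit (trans (p at 0) u)

-- Identities that involve `ψ₂` carry factors 2 or 8, which are not units; they cancel
-- coefficientwise in ℤ.
const-cancel : ∀ c .{{_ : ℤ.NonZero c}} {f g} → const c ⊛ f ≋ const c ⊛ g → f ≋ g
const-cancel c {f} {g} p = pointwise λ n → ℤ.*-cancelˡ-≡ c (f n) (g n)
  (trans (sym (const-⊛ c f n)) (trans (p at n) (const-⊛ c g n)))

private
  dilate-⊛₂ : ∀ {f g f′ g′} → dilate f ≋ f′ → dilate g ≋ g′ → dilate (f ⊛ g) ≋ f′ ⊛ g′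
  dilate-⊛₂ p r = ≋-trans (dilate-⊛ _ _) (*-cong p r)

A₃ B₃ : Series
A₃ = dilate A
B₃ = dilate B

φ₃-product : φ₃ ⊛ E 6 ≋ E 3 ⊛ E 3
φ₃-product = ≋-trans (≋-sym (dilate-⊛₂ ≋-refl (dilate-E 1))) (≋-trans (dilate-cong φ-product) (dilate-⊛₂ (dilate-E 0) (dilate-E 0)))

φ₉-product : φ₉ ⊛ E 18 ≋ E 9 ⊛ E 9
φ₉-product = ≋-trans (≋-sym (dilate-⊛₂ ≋-refl (dilate-E 5))) (≋-trans (dilate-cong φ₃-product) (dilate-⊛₂ (dilate-E 2) (dilate-E 2)))

ψ₃-product : ψ₃ ⊛ E 3 ≋ const (+ 2) ⊛ (E 6 ⊛ E 6)
ψ₃-product = ≋-trans (≋-sym (dilate-⊛₂ ≋-refl (dilate-E 0)))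
  (≋-trans (dilate-cong ψ₂-product) (dilate-⊛₂ (dilate-const (+ 2)) (dilate-⊛₂ (dilate-E 1) (dilate-E 1))))

A₃-product : A₃ ⊛ E 18 ⊛ E 3 ≋ E 6 ⊛ (E 9 ⊛ E 9)
A₃-product = ≋-trans (≋-sym (dilate-⊛₂ (dilate-⊛₂ ≋-refl (dilate-E 5)) (dilate-E 0)))
  (≋-trans (dilate-cong A-product) (dilate-⊛₂ (dilate-E 1) (dilate-⊛₂ (dilate-E 2) (dilate-E 2))))

B₃-product : B₃ ⊛ E 9 ⊛ E 6 ≋ E 3 ⊛ (E 18 ⊛ E 18)
B₃-product = ≋-trans (≋-sym (dilate-⊛₂ (dilate-⊛₂ ≋-refl (dilate-E 2)) (dilate-E 1)))
  (≋-trans (dilate-cong B-product) (dilate-⊛₂ (dilate-E 0) (dilate-⊛₂ (dilate-E 5) (dilate-E 5))))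

E₁-isUnit : IsUnit (E 1)
E₁-isUnit = E-isUnit 0
E₂-isUnit : IsUnit (E 2)
E₂-isUnit = E-isUnit 1
E₃-isUnit : IsUnit (E 3)
E₃-isUnit = E-isUnit 2
E₆-isUnit : IsUnit (E 6)
E₆-isUnit = E-isUnit 5
E₉-isUnit : IsUnit (E 9)
E₉-isUnit = E-isUnit 8
E₁₈-isUnit : IsUnit (E 18)
E₁₈-isUnit = E-isUnit 17

φ-isUnit : IsUnit φ
φ-isUnit = ⊛-isUnitˡ E₂-isUnit (⊛-isUnit E₁-isUnit E₁-isUnit) φ-product

A-isUnit : IsUnit A
A-isUnit = ⊛-isUnitˡ E₆-isUnit (⊛-isUnitˡ E₁-isUnit (⊛-isUnit E₂-isUnit (⊛-isUnit E₃-isUnit E₃-isUnit)) A-product) ≋-refl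

dilate-isUnit : ∀ {f} → IsUnit f → IsUnit (dilate f)
dilate-isUnit (unit u) = unit u

BA-product : B ⊛ A ≋ E 3 ⊛ E 6
BA-product = ⊛-cancelˡ (⊛-isUnit (⊛-isUnit E₁-isUnit E₂-isUnit) (⊛-isUnit E₃-isUnit E₆-isUnit)) (begin
  E 1 ⊛ E 2 ⊛ (E 3 ⊛ E 6) ⊛ (B ⊛ A)
    ≈⟨ solve 6 (λ e f g h b a → e :* f :* (g :* h) :* (b :* a) := (b :* g :* f) :* (a :* h :* e)) ≋-refl (E 1) (E 2) (E 3) (E 6) B A ⟩
  (B ⊛ E 3 ⊛ E 2) ⊛ (A ⊛ E 6 ⊛ E 1)
    ≈⟨ *-cong B-product A-product ⟩
  E 1 ⊛ (E 6 ⊛ E 6) ⊛ (E 2 ⊛ (E 3 ⊛ E 3))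
    ≈⟨ solve 4 (λ e f g h → e :* (h :* h) :* (f :* (g :* g)) := e :* f :* (g :* h) :* (g :* h)) ≋-refl (E 1) (E 2) (E 3) (E 6) ⟩
  E 1 ⊛ E 2 ⊛ (E 3 ⊛ E 6) ⊛ (E 3 ⊛ E 6) ∎)
  where open ≋-Reasoning

B₃A₃-product : B₃ ⊛ A₃ ≋ E 9 ⊛ E 18
B₃A₃-product = ≋-trans (≋-sym (dilate-⊛ B A)) (≋-trans (dilate-cong BA-product) (dilate-⊛₂ (dilate-E 2) (dilate-E 5)))

ψ₃φ₃-product : ψ₃ ⊛ φ₃ ≋ const (+ 2) ⊛ (B ⊛ A)
ψ₃φ₃-product = ⊛-cancelˡ (⊛-isUnit E₃-isUnit E₆-isUnit) (begin
  E 3 ⊛ E 6 ⊛ (ψ₃ ⊛ φ₃)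
    ≈⟨ solve 4 (λ e f p r → e :* f :* (p :* r) := (p :* e) :* (r :* f)) ≋-refl (E 3) (E 6) ψ₃ φ₃ ⟩
  (ψ₃ ⊛ E 3) ⊛ (φ₃ ⊛ E 6)
    ≈⟨ *-cong ψ₃-product φ₃-product ⟩
  const (+ 2) ⊛ (E 6 ⊛ E 6) ⊛ (E 3 ⊛ E 3)
    ≈⟨ solve 2 (λ e f → con (+ 2) :* (f :* f) :* (e :* e) := e :* f :* (con (+ 2) :* (e :* f))) ≋-refl (E 3) (E 6) ⟩
  E 3 ⊛ E 6 ⊛ (const (+ 2) ⊛ (E 3 ⊛ E 6))
    ≈⟨ *-congˡ (*-congˡ (≋-sym BA-product)) ⟩
  E 3 ⊛ E 6 ⊛ (const (+ 2) ⊛ (B ⊛ A)) ∎)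
  where open ≋-Reasoning

-- The hauptmoduln

private
  eta-quotient : ∀ {a b c d} → IsUnit c → IsUnit d →
    (q Defs.* ((a Defs.* b ^ 5) ÷ (c ^ 5 Defs.* d))) ⊛ (c ↑ 5 ⊛ d) ≋ q ⊛ (a ⊛ b ↑ 5)
  eta-quotient {a} {b} {c} {d} u w = ≋-trans (*-cong (*≋⊛ q _) (≋-sym denominator)) (≋-trans (*-assoc _ _ _)
    (*-congˡ (≋-trans (÷-⊛ (isUnit-cong denominator (⊛-isUnit (↑-isUnit u 5) w))) (≋-trans (*≋⊛ _ _) (*-congˡ (^≋↑ b 5))))))
    where
    denominator : c ^ 5 Defs.* d ≋ c ↑ 5 ⊛ d
    denominator = ≋-trans (*≋⊛ _ _) (*-congʳ (^≋↑ c 5))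

-- ξ is x, sealed so that unification does not unfold the eta quotient.

opaque
  ξ : Series
  ξ = x

  ξ≋x : ξ ≋ x
  ξ≋x = ≋-refl

hauptmodul : ξ ⊛ (E 1 ↑ 5 ⊛ E 3) ≋ q ⊛ (E 2 ⊛ E 6 ↑ 5)
hauptmodul = ≋-trans (*-congʳ ξ≋x) (eta-quotient {E 2} {E 6} {E 1} {E 3} E₁-isUnit E₃-isUnit)

-- The norm of `φ` computed twice: from its dissection, and from `φ-product` with the norms of the
-- eta products. Divided by the cube of `φ₃` it evaluates 1 - 8C.
eightfold : (cube φ₃ ⊖ const (+ 8) ⊛ (q ⊛ cube B)) ⊛ (E 2 ↑ 4 ⊛ E 3 ↑ 2) ≋ E 1 ↑ 8 ⊛ E 6
eightfold = ⊛-cancelˡ E₆-isUnit (begin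
  E 6 ⊛ (n ⊛ (E 2 ↑ 4 ⊛ E 3 ↑ 2))
    ≈⟨ solve 4 (λ g n e f → g :* (n :* (pow 4 e :* pow 2 f)) := n :* (e :* cub e) :* (f :* f) :* g) ≋-refl (E 6) n (E 2) (E 3) ⟩
  n ⊛ (E 2 ⊛ cube (E 2)) ⊛ (E 3 ⊛ E 3) ⊛ E 6
    ≈⟨ *-congʳ (*-congʳ (*-cong (≋-sym norm-φ) (≋-sym norm-E₂))) ⟩
  norm φ ⊛ (norm (E 2) ⊛ E 6) ⊛ (E 3 ⊛ E 3) ⊛ E 6
    ≈⟨ solve 4 (λ a b g f → a :* (b :* g) :* (f :* f) :* g := a :* b :* (g :* (f :* f) :* g)) ≋-refl (norm φ) (norm (E 2)) (E 6) (E 3) ⟩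
  norm φ ⊛ norm (E 2) ⊛ (E 6 ⊛ (E 3 ⊛ E 3) ⊛ E 6)
    ≈⟨ *-congʳ (≋-trans (≋-sym (norm-⊛ φ (E 2))) (≋-trans (norm-cong φ-product) (norm-⊛ (E 1) (E 1)))) ⟩
  norm (E 1) ⊛ norm (E 1) ⊛ (E 6 ⊛ (E 3 ⊛ E 3) ⊛ E 6)
    ≈⟨ solve 3 (λ a g f → a :* a :* (g :* (f :* f) :* g) := (a :* f) :* (a :* f) :* (g :* g)) ≋-refl (norm (E 1)) (E 6) (E 3) ⟩
  (norm (E 1) ⊛ E 3) ⊛ (norm (E 1) ⊛ E 3) ⊛ (E 6 ⊛ E 6)
    ≈⟨ *-congʳ (*-cong norm-E₁ norm-E₁) ⟩
  (E 1 ⊛ cube (E 1)) ⊛ (E 1 ⊛ cube (E 1)) ⊛ (E 6 ⊛ E 6)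
    ≈⟨ solve 2 (λ e g → (e :* cub e) :* (e :* cub e) :* (g :* g) := g :* (pow 8 e :* g)) ≋-refl (E 1) (E 6) ⟩
  E 6 ⊛ (E 1 ↑ 8 ⊛ E 6) ∎)
  where
  open ≋-Reasoning
  n : Series
  n = cube φ₃ ⊖ const (+ 8) ⊛ (q ⊛ cube B)

-- The same comparison for `ψ₂`. After multiplication by the cube of `φ₃`, `ψ₃φ₃-product` gives both
-- cubes a factor 8; without it, 1 + C is evaluated.
onefold : cube A ⊛ (cube φ₃ ⊕ q ⊛ cube B) ⊛ (E 1 ↑ 4 ⊛ E 6 ↑ 2) ≋ E 2 ↑ 8 ⊛ E 3 ⊛ cube φ₃
onefold = const-cancel (+ 8) (begin
  const (+ 8) ⊛ (cube A ⊛ (cube φ₃ ⊕ q ⊛ cube B) ⊛ (E 1 ↑ 4 ⊛ E 6 ↑ 2))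
    ≈⟨ solve 6 (λ a f b q e g → con (+ 8) :* (cub a :* (cub f :+ q :* cub b) :* (pow 4 e :* pow 2 g)) :=
          (con (+ 8) :* cub a :* cub f :+ q :* cub (con (+ 2) :* (b :* a))) :* ((e :* cub e) :* (g :* g))) ≋-refl A φ₃ B q (E 1) (E 6) ⟩
  (const (+ 8) ⊛ cube A ⊛ cube φ₃ ⊕ q ⊛ cube (const (+ 2) ⊛ (B ⊛ A))) ⊛ ((E 1 ⊛ cube (E 1)) ⊛ (E 6 ⊛ E 6))
    ≈⟨ *-cong (+-congˡ (*-congˡ (cube-cong (≋-sym ψ₃φ₃-product)))) (*-congʳ (≋-sym norm-E₁)) ⟩
  (const (+ 8) ⊛ cube A ⊛ cube φ₃ ⊕ q ⊛ cube (ψ₃ ⊛ φ₃)) ⊛ ((norm (E 1) ⊛ E 3) ⊛ (E 6 ⊛ E 6))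
    ≈⟨ solve 7 (λ a f p q n e g → (con (+ 8) :* cub a :* cub f :+ q :* cub (p :* f)) :* ((n :* e) :* (g :* g)) :=
          (con (+ 8) :* cub a :+ q :* cub p) :* n :* (cub f :* e :* (g :* g))) ≋-refl A φ₃ ψ₃ q (norm (E 1)) (E 3) (E 6) ⟩
  (const (+ 8) ⊛ cube A ⊕ q ⊛ cube ψ₃) ⊛ norm (E 1) ⊛ (cube φ₃ ⊛ E 3 ⊛ (E 6 ⊛ E 6))
    ≈⟨ *-congʳ (≋-trans (*-congʳ (≋-sym norm-ψ₂)) (≋-trans (≋-sym (norm-⊛ ψ₂ (E 1))) (≋-trans (norm-cong ψ₂-product)
         (≋-trans (norm-⊛ _ _) (*-cong (≋-trans (norm-cong (≋-sym (dilate-const (+ 2)))) (norm-dilate (const (+ 2)))) (norm-⊛ (E 2) (E 2))))))) ⟩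
  cube (const (+ 2)) ⊛ (norm (E 2) ⊛ norm (E 2)) ⊛ (cube φ₃ ⊛ E 3 ⊛ (E 6 ⊛ E 6))
    ≈⟨ solve 4 (λ n f e g → cub (con (+ 2)) :* (n :* n) :* (f :* e :* (g :* g)) := con (+ 8) :* (f :* e) :* ((n :* g) :* (n :* g)))
         ≋-refl (norm (E 2)) (cube φ₃) (E 3) (E 6) ⟩
  const (+ 8) ⊛ (cube φ₃ ⊛ E 3) ⊛ ((norm (E 2) ⊛ E 6) ⊛ (norm (E 2) ⊛ E 6))
    ≈⟨ *-congˡ (*-cong norm-E₂ norm-E₂) ⟩
  const (+ 8) ⊛ (cube φ₃ ⊛ E 3) ⊛ ((E 2 ⊛ cube (E 2)) ⊛ (E 2 ⊛ cube (E 2)))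
    ≈⟨ solve 3 (λ f e h → con (+ 8) :* (f :* e) :* ((h :* cub h) :* (h :* cub h)) := con (+ 8) :* (pow 8 h :* e :* f)) ≋-refl (cube φ₃) (E 3) (E 2) ⟩
  const (+ 8) ⊛ (E 2 ↑ 8 ⊛ E 3 ⊛ cube φ₃) ∎)
  where open ≋-Reasoning

-- C and v = C(q³)^⅓ are Hauptmoduln of level 6 and 18; x = C/(1 - 8C) by x-C, and U₃ kills the
-- powers of v whose exponent is prime to 3.

g C v u w y : Series
g = B ⊛ inv φ₃
C = q ⊛ cube g
v = q ⊛ dilate g
u = one ⊖ const (+ 2) ⊛ v
w = v ⊛ inv u
y = dilate ξ

g-φ₃ : g ⊛ φ₃ ≋ B
g-φ₃ = ≋-trans (*-assoc _ _ _) (≋-trans (*-congˡ (≋-trans (*-comm _ _) (inverseʳ (dilate-isUnit φ-isUnit)))) (*-identityʳ B))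

v-φ₉ : v ⊛ φ₉ ≋ q ⊛ B₃
v-φ₉ = ≋-trans (*-assoc _ _ _) (*-congˡ (≋-trans (≋-sym (dilate-⊛ g φ₃)) (dilate-cong g-φ₃)))

dilate-C : dilate C ≋ cube v
dilate-C = ≋-trans (dilate-⊛₂ dilate-q (dilate-⊛₂ (dilate-⊛ g g) ≋-refl))
  (solve 2 (λ q g → pow 3 q :* (g :* g :* g) := cub (q :* g)) ≋-refl q (dilate g))

u-φ₉ : u ⊛ φ₉ ≋ φ
u-φ₉ = ≋-trans (solve 2 (λ v f → (con 1ℤ :- con (+ 2) :* v) :* f := f :- con (+ 2) :* (v :* f)) ≋-refl v φ₉)
  (≋-trans (+-congˡ (-‿cong (*-congˡ v-φ₉))) (≋-sym φ-dissection))

φ₉-isUnit : IsUnit φ₉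
φ₉-isUnit = dilate-isUnit (dilate-isUnit φ-isUnit)

u-isUnit : IsUnit u
u-isUnit = ⊛-isUnitˡ φ₉-isUnit φ-isUnit u-φ₉

w-u : w ⊛ u ≋ v
w-u = ≋-trans (*-assoc _ _ _) (≋-trans (*-congˡ (≋-trans (*-comm _ _) (inverseʳ u-isUnit))) (*-identityʳ v))

C-φ₃ : (one ⊖ const (+ 8) ⊛ C) ⊛ cube φ₃ ≋ cube φ₃ ⊖ const (+ 8) ⊛ (q ⊛ cube B)
C-φ₃ = ≋-trans (solve 3 (λ q g f → (con 1ℤ :- con (+ 8) :* (q :* cub g)) :* cub f := cub f :- con (+ 8) :* (q :* cub (g :* f))) ≋-refl q g φ₃)
  (+-congˡ (-‿cong (*-congˡ (*-congˡ (cube-cong g-φ₃)))))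

cube-isUnit : ∀ {f} → IsUnit f → IsUnit (cube f)
cube-isUnit u = ⊛-isUnit (⊛-isUnit u u) u

x-C : ξ ⊛ (one ⊖ const (+ 8) ⊛ C) ≋ C
x-C = ⊛-cancelˡ (⊛-isUnit (cube-isUnit (dilate-isUnit φ-isUnit)) (⊛-isUnit (⊛-isUnit (↑-isUnit E₂-isUnit 4) (↑-isUnit E₃-isUnit 2)) E₃-isUnit)) (begin
  cube φ₃ ⊛ (E 2 ↑ 4 ⊛ E 3 ↑ 2 ⊛ E 3) ⊛ (ξ ⊛ (one ⊖ const (+ 8) ⊛ C))
    ≈⟨ solve 5 (λ f m e ξ c → f :* (m :* e) :* (ξ :* c) := ξ :* (c :* f :* m) :* e) ≋-refl (cube φ₃) (E 2 ↑ 4 ⊛ E 3 ↑ 2) (E 3) ξ _ ⟩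
  ξ ⊛ ((one ⊖ const (+ 8) ⊛ C) ⊛ cube φ₃ ⊛ (E 2 ↑ 4 ⊛ E 3 ↑ 2)) ⊛ E 3
    ≈⟨ *-congʳ (*-congˡ (≋-trans (*-congʳ C-φ₃) eightfold)) ⟩
  ξ ⊛ (E 1 ↑ 8 ⊛ E 6) ⊛ E 3
    ≈⟨ solve 4 (λ ξ e f g → ξ :* (pow 8 e :* g) :* f := ξ :* (pow 5 e :* f) :* (cub e :* g)) ≋-refl ξ (E 1) (E 3) (E 6) ⟩
  ξ ⊛ (E 1 ↑ 5 ⊛ E 3) ⊛ (cube (E 1) ⊛ E 6)
    ≈⟨ *-congʳ hauptmodul ⟩
  q ⊛ (E 2 ⊛ E 6 ↑ 5) ⊛ (cube (E 1) ⊛ E 6)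
    ≈⟨ solve 4 (λ q e g h → q :* (h :* pow 5 g) :* (cub e :* g) := q :* cub (e :* (g :* g)) :* h) ≋-refl q (E 1) (E 6) (E 2) ⟩
  q ⊛ cube (E 1 ⊛ (E 6 ⊛ E 6)) ⊛ E 2
    ≈⟨ *-congʳ (*-congˡ (cube-cong (≋-sym (≋-trans (*-congʳ (*-congʳ g-φ₃)) B-product)))) ⟩
  q ⊛ cube (g ⊛ φ₃ ⊛ E 3 ⊛ E 2) ⊛ E 2
    ≈⟨ solve 5 (λ q g f e h → q :* cub (g :* f :* e :* h) :* h := cub f :* (pow 4 h :* pow 2 e :* e) :* (q :* cub g)) ≋-refl q g φ₃ (E 3) (E 2) ⟩
  cube φ₃ ⊛ (E 2 ↑ 4 ⊛ E 3 ↑ 2 ⊛ E 3) ⊛ C ∎)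
  where open ≋-Reasoning

y-v : y ⊛ (one ⊖ const (+ 8) ⊛ cube v) ≋ cube v
y-v = ≋-trans (≋-sym (dilate-⊛₂ ≋-refl (≋-trans (dilate-⊖ one _)
    (+-cong (dilate-const 1ℤ) (-‿cong (dilate-⊛₂ (dilate-const (+ 8)) dilate-C))))))
  (≋-trans (dilate-cong x-C) dilate-C)

-- The relation v³ = y(1 - 8v³) made homogeneous: 1 - 8v³ = (u + 2v)³ - (2v)³ = u³ + 6u²v + 12uv²,
-- to be divided by u³.
w-cubic : cube w ≋ y ⊛ (one ⊕ const (+ 6) ⊛ w ⊕ const (+ 12) ⊛ (w ⊛ w))
w-cubic = ⊛-cancelˡ (cube-isUnit u-isUnit) (begin
  cube u ⊛ cube w
    ≈⟨ solve 2 (λ u w → cub u :* cub w := cub (w :* u)) ≋-refl u w ⟩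
  cube (w ⊛ u)
    ≈⟨ cube-cong w-u ⟩
  cube v
    ≈⟨ ≋-sym y-v ⟩
  y ⊛ (one ⊖ const (+ 8) ⊛ cube v)
    ≈⟨ solve 2 (λ y v → let u = con 1ℤ :- con (+ 2) :* v in
         y :* (con 1ℤ :- con (+ 8) :* cub v) := y :* (cub u :+ con (+ 6) :* (u :* u) :* v :+ con (+ 12) :* u :* (v :* v))) ≋-refl y v ⟩
  y ⊛ (cube u ⊕ const (+ 6) ⊛ (u ⊛ u) ⊛ v ⊕ const (+ 12) ⊛ u ⊛ (v ⊛ v))
    ≈⟨ *-congˡ (+-cong (+-congˡ (*-congˡ (≋-sym w-u))) (*-congˡ (*-cong (≋-sym w-u) (≋-sym w-u)))) ⟩
  y ⊛ (cube u ⊕ const (+ 6) ⊛ (u ⊛ u) ⊛ (w ⊛ u) ⊕ const (+ 12) ⊛ u ⊛ (w ⊛ u ⊛ (w ⊛ u)))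
    ≈⟨ solve 3 (λ y u w → y :* (cub u :+ con (+ 6) :* (u :* u) :* (w :* u) :+ con (+ 12) :* u :* (w :* u :* (w :* u))) :=
         cub u :* (y :* (con 1ℤ :+ con (+ 6) :* w :+ con (+ 12) :* (w :* w)))) ≋-refl y u w ⟩
  cube u ⊛ (y ⊛ (one ⊕ const (+ 6) ⊛ w ⊕ const (+ 12) ⊛ (w ⊛ w))) ∎)
  where open ≋-Reasoning

-- By `ψ₃φ₃-product` at q³ the second part of the dissection is 2 A₃ q B₃ / φ₉ = 2 A₃ v, so both
-- parts share 2 A₃. This expresses 1 + v by products.
ψ₂-v : ψ₂ ≋ const (+ 2) ⊛ (A₃ ⊛ (one ⊕ v))
ψ₂-v = ⊛-cancelˡ φ₉-isUnit (begin
  φ₉ ⊛ ψ₂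
    ≈⟨ *-congˡ ψ₂-dissection ⟩
  φ₉ ⊛ (const (+ 2) ⊛ A₃ ⊕ q ⊛ ψ₉)
    ≈⟨ solve 4 (λ f a q p → f :* (con (+ 2) :* a :+ q :* p) := con (+ 2) :* a :* f :+ q :* (p :* f)) ≋-refl φ₉ A₃ q ψ₉ ⟩
  const (+ 2) ⊛ A₃ ⊛ φ₉ ⊕ q ⊛ (ψ₉ ⊛ φ₉)
    ≈⟨ +-congˡ (*-congˡ (≋-trans (≋-sym (dilate-⊛ ψ₃ φ₃)) (≋-trans (dilate-cong ψ₃φ₃-product) (dilate-⊛₂ (dilate-const (+ 2)) (dilate-⊛ B A))))) ⟩
  const (+ 2) ⊛ A₃ ⊛ φ₉ ⊕ q ⊛ (const (+ 2) ⊛ (B₃ ⊛ A₃))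
    ≈⟨ solve 4 (λ a f q b → con (+ 2) :* a :* f :+ q :* (con (+ 2) :* (b :* a)) := con (+ 2) :* a :* (f :+ q :* b)) ≋-refl A₃ φ₉ q B₃ ⟩
  const (+ 2) ⊛ A₃ ⊛ (φ₉ ⊕ q ⊛ B₃)
    ≈⟨ *-congˡ (+-congˡ (≋-sym v-φ₉)) ⟩
  const (+ 2) ⊛ A₃ ⊛ (φ₉ ⊕ v ⊛ φ₉)
    ≈⟨ solve 3 (λ a f v → con (+ 2) :* a :* (f :+ v :* f) := f :* (con (+ 2) :* (a :* (con 1ℤ :+ v)))) ≋-refl A₃ φ₉ v ⟩
  φ₉ ⊛ (const (+ 2) ⊛ (A₃ ⊛ (one ⊕ v))) ∎)
  where open ≋-Reasoning

A-C : cube A ⊛ (one ⊕ C) ⊛ (E 1 ↑ 4 ⊛ E 6 ↑ 2) ≋ E 2 ↑ 8 ⊛ E 3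
A-C = ⊛-cancelˡ (cube-isUnit (dilate-isUnit φ-isUnit)) (begin
  cube φ₃ ⊛ (cube A ⊛ (one ⊕ q ⊛ cube g) ⊛ m)
    ≈⟨ solve 5 (λ f a q g m → cub f :* (a :* (con 1ℤ :+ q :* cub g) :* m) := a :* (cub f :+ q :* cub (g :* f)) :* m) ≋-refl φ₃ (cube A) q g m ⟩
  cube A ⊛ (cube φ₃ ⊕ q ⊛ cube (g ⊛ φ₃)) ⊛ m
    ≈⟨ *-congʳ (*-congˡ (+-congˡ (*-congˡ (cube-cong g-φ₃)))) ⟩
  cube A ⊛ (cube φ₃ ⊕ q ⊛ cube B) ⊛ m
    ≈⟨ onefold ⟩
  E 2 ↑ 8 ⊛ E 3 ⊛ cube φ₃
    ≈⟨ *-comm _ _ ⟩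
  cube φ₃ ⊛ (E 2 ↑ 8 ⊛ E 3) ∎)
  where
  open ≋-Reasoning
  m : Series
  m = E 1 ↑ 4 ⊛ E 6 ↑ 2

A₃-v : cube A₃ ⊛ (one ⊕ cube v) ⊛ (E 3 ↑ 4 ⊛ E 18 ↑ 2) ≋ E 6 ↑ 8 ⊛ E 9
A₃-v = ≋-trans (≋-sym (dilate-⊛₂ (dilate-⊛₂ (dilate-⊛₂ (dilate-⊛ A A) ≋-refl)
      (≋-trans (dilate-⊕ one C) (+-cong (dilate-const 1ℤ) dilate-C)))
    (dilate-⊛₂ (≋-trans (dilate-↑ (E 1) 4) (↑-cong 4 (dilate-E 0))) (≋-trans (dilate-↑ (E 6) 2) (↑-cong 2 (dilate-E 5))))))
  (≋-trans (dilate-cong A-C) (dilate-⊛₂ (≋-trans (dilate-↑ (E 2) 8) (↑-cong 8 (dilate-E 1))) (dilate-E 2)))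

v-at-zero : v 0 ≡ 0ℤ
v-at-zero = ⊛-at-zero q (dilate g)

1+v-isUnit : IsUnit (one ⊕ v)
1+v-isUnit = unit (trans (⊕-at one v 0) (cong (ℤ._+_ 1ℤ) v-at-zero))

A₃-isUnit : IsUnit A₃
A₃-isUnit = dilate-isUnit A-isUnit

-- The right side is v(1 + v³)/(1 + v), and `u-φ₉`, `v-φ₉`, `ψ₂-v` and `A₃-v` express u, v, 1 + v
-- and 1 + v³ by products. `K` collects the denominators.
x-v : ξ ⊛ cube u ≋ v ⊛ (one ⊖ v ⊕ v ⊛ v)
x-v = ⊛-cancelˡ K-isUnit (const-cancel (+ 2) (begin
  const (+ 2) ⊛ (K ⊛ (ξ ⊛ cube u))
    ≈⟨ solve 13 (λ v a f e₃ e₁₈ e₂ e₁ e₉ e₆ ξ u ψ φ →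
          con (+ 2) :* ((con 1ℤ :+ v) :* cub a :* cub f :* (pow 4 e₃ :* pow 2 e₁₈) :* (cub e₂ :* pow 6 e₁ :* cub e₃ :* pow 2 e₁₈ :* e₉ :* e₆) :* (ξ :* cub u)) :=
          cub ((u :* f) :* e₂) :* ((con (+ 2) :* (a :* (con 1ℤ :+ v))) :* e₁) :* (ξ :* (pow 5 e₁ :* e₃)) :* pow 2 (a :* e₁₈ :* e₃) :* (pow 4 e₃ :* pow 2 e₁₈ :* e₉ :* e₆))
        ≋-refl v A₃ φ₉ (E 3) (E 18) (E 2) (E 1) (E 9) (E 6) ξ u ψ₂ φ ⟩
  cube (u ⊛ φ₉ ⊛ E 2) ⊛ (const (+ 2) ⊛ (A₃ ⊛ (one ⊕ v)) ⊛ E 1) ⊛ (ξ ⊛ (E 1 ↑ 5 ⊛ E 3)) ⊛ (A₃ ⊛ E 18 ⊛ E 3) ↑ 2 ⊛ (E 3 ↑ 4 ⊛ E 18 ↑ 2 ⊛ E 9 ⊛ E 6)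
    ≈⟨ *-congʳ (*-cong (*-cong (*-cong (cube-cong (≋-trans (*-congʳ u-φ₉) φ-product)) (≋-trans (*-congʳ (≋-sym ψ₂-v)) ψ₂-product)) hauptmodul) (↑-cong 2 A₃-product)) ⟩
  cube (E 1 ⊛ E 1) ⊛ (const (+ 2) ⊛ (E 2 ⊛ E 2)) ⊛ (q ⊛ (E 2 ⊛ E 6 ↑ 5)) ⊛ (E 6 ⊛ (E 9 ⊛ E 9)) ↑ 2 ⊛ (E 3 ↑ 4 ⊛ E 18 ↑ 2 ⊛ E 9 ⊛ E 6)
    ≈⟨ solve 7 (λ q e₁ e₂ e₃ e₆ e₉ e₁₈ →
          cub (e₁ :* e₁) :* (con (+ 2) :* (e₂ :* e₂)) :* (q :* (e₂ :* pow 5 e₆)) :* pow 2 (e₆ :* (e₉ :* e₉)) :* (pow 4 e₃ :* pow 2 e₁₈ :* e₉ :* e₆) :=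
          con (+ 2) :* (q :* ((e₃ :* (e₁₈ :* e₁₈)) :* pow 2 (e₉ :* e₉) :* (pow 8 e₆ :* e₉) :* (cub e₂ :* pow 6 e₁ :* cub e₃)))) ≋-refl
        q (E 1) (E 2) (E 3) (E 6) (E 9) (E 18) ⟩
  const (+ 2) ⊛ (q ⊛ ((E 3 ⊛ (E 18 ⊛ E 18)) ⊛ (E 9 ⊛ E 9) ↑ 2 ⊛ (E 6 ↑ 8 ⊛ E 9) ⊛ M))
    ≈⟨ *-congˡ (*-congˡ (*-congʳ (*-cong (*-cong (≋-sym B₃-product) (↑-cong 2 (≋-sym φ₉-product))) (≋-sym A₃-v)))) ⟩
  const (+ 2) ⊛ (q ⊛ ((B₃ ⊛ E 9 ⊛ E 6) ⊛ (φ₉ ⊛ E 18) ↑ 2 ⊛ (cube A₃ ⊛ (one ⊕ cube v) ⊛ (E 3 ↑ 4 ⊛ E 18 ↑ 2)) ⊛ M))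
    ≈⟨ solve 10 (λ q b e₉ e₆ f e₁₈ a v m n → con (+ 2) :* (q :* ((b :* e₉ :* e₆) :* pow 2 (f :* e₁₈) :* (a :* (con 1ℤ :+ v) :* n) :* m)) :=
          con (+ 2) :* ((q :* b) :* (e₉ :* e₆ :* pow 2 (f :* e₁₈) :* (a :* (con 1ℤ :+ v) :* n) :* m)))
        ≋-refl q B₃ (E 9) (E 6) φ₉ (E 18) (cube A₃) (cube v) M (E 3 ↑ 4 ⊛ E 18 ↑ 2) ⟩
  const (+ 2) ⊛ ((q ⊛ B₃) ⊛ (E 9 ⊛ E 6 ⊛ (φ₉ ⊛ E 18) ↑ 2 ⊛ (cube A₃ ⊛ (one ⊕ cube v) ⊛ (E 3 ↑ 4 ⊛ E 18 ↑ 2)) ⊛ M))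
    ≈⟨ *-congˡ (*-congʳ (≋-sym v-φ₉)) ⟩
  const (+ 2) ⊛ ((v ⊛ φ₉) ⊛ (E 9 ⊛ E 6 ⊛ (φ₉ ⊛ E 18) ↑ 2 ⊛ (cube A₃ ⊛ (one ⊕ cube v) ⊛ (E 3 ↑ 4 ⊛ E 18 ↑ 2)) ⊛ M))
    ≈⟨ solve 9 (λ v f a e₁ e₂ e₃ e₆ e₉ e₁₈ →
          con (+ 2) :* ((v :* f) :* (e₉ :* e₆ :* pow 2 (f :* e₁₈) :* (cub a :* (con 1ℤ :+ cub v) :* (pow 4 e₃ :* pow 2 e₁₈)) :* (cub e₂ :* pow 6 e₁ :* cub e₃))) :=
          con (+ 2) :* ((con 1ℤ :+ v) :* cub a :* cub f :* (pow 4 e₃ :* pow 2 e₁₈) :* (cub e₂ :* pow 6 e₁ :* cub e₃ :* pow 2 e₁₈ :* e₉ :* e₆) :* (v :* (con 1ℤ :- v :+ v :* v))))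
        ≋-refl v φ₉ A₃ (E 1) (E 2) (E 3) (E 6) (E 9) (E 18) ⟩
  const (+ 2) ⊛ (K ⊛ (v ⊛ (one ⊖ v ⊕ v ⊛ v))) ∎))
  where
  open ≋-Reasoning
  M K : Series
  M = cube (E 2) ⊛ E 1 ↑ 6 ⊛ cube (E 3)
  K = (one ⊕ v) ⊛ cube A₃ ⊛ cube φ₉ ⊛ (E 3 ↑ 4 ⊛ E 18 ↑ 2) ⊛ (cube (E 2) ⊛ E 1 ↑ 6 ⊛ cube (E 3) ⊛ E 18 ↑ 2 ⊛ E 9 ⊛ E 6)

  K-isUnit : IsUnit K
  K-isUnit = ⊛-isUnit (⊛-isUnit (⊛-isUnit (⊛-isUnit 1+v-isUnit (cube-isUnit A₃-isUnit)) (cube-isUnit φ₉-isUnit)) (⊛-isUnit (↑-isUnit E₃-isUnit 4) (↑-isUnit E₁₈-isUnit 2)))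
    (⊛-isUnit (⊛-isUnit (⊛-isUnit (⊛-isUnit (⊛-isUnit (cube-isUnit E₂-isUnit) (↑-isUnit E₁-isUnit 6)) (cube-isUnit E₃-isUnit)) (↑-isUnit E₁₈-isUnit 2)) E₉-isUnit) E₆-isUnit)

x-w : ξ ≋ w ⊕ const (+ 3) ⊛ (w ⊛ w) ⊕ const (+ 3) ⊛ cube w
x-w = ⊛-cancelˡ (cube-isUnit u-isUnit) (begin
  cube u ⊛ ξ
    ≈⟨ ≋-trans (*-comm _ _) x-v ⟩
  v ⊛ (one ⊖ v ⊕ v ⊛ v)
    -- Homogeneous of degree 3 in u and v, by 1 = u + 2v.
    ≈⟨ solve 1 (λ v → let u = con 1ℤ :- con (+ 2) :* v in v :* (con 1ℤ :- v :+ v :* v) := v :* (u :* u) :+ con (+ 3) :* (v :* v) :* u :+ con (+ 3) :* cub v) ≋-refl v ⟩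
  v ⊛ (u ⊛ u) ⊕ const (+ 3) ⊛ (v ⊛ v) ⊛ u ⊕ const (+ 3) ⊛ cube v
    ≈⟨ +-cong (+-cong (*-congʳ (≋-sym w-u)) (*-congʳ (*-congˡ (*-cong (≋-sym w-u) (≋-sym w-u))))) (*-congˡ (cube-cong (≋-sym w-u))) ⟩
  (w ⊛ u) ⊛ (u ⊛ u) ⊕ const (+ 3) ⊛ (w ⊛ u ⊛ (w ⊛ u)) ⊛ u ⊕ const (+ 3) ⊛ cube (w ⊛ u)
    ≈⟨ solve 2 (λ w u → (w :* u) :* (u :* u) :+ con (+ 3) :* (w :* u :* (w :* u)) :* u :+ con (+ 3) :* cub (w :* u) :=
          cub u :* (w :+ con (+ 3) :* (w :* w) :+ con (+ 3) :* cub w)) ≋-refl w u ⟩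
  cube u ⊛ (w ⊕ const (+ 3) ⊛ (w ⊛ w) ⊕ const (+ 3) ⊛ cube w) ∎)
  where open ≋-Reasoning

-- The action of U₃ on the powers of w

U₃-cong : ∀ {f g} → f ≋ g → U₃ f ≋ U₃ g
U₃-cong = section-cong 0

U₃-one : U₃ one ≋ one
U₃-one = pointwise λ { zero → refl ; (suc n) → refl }

1-8C-isUnit : IsUnit (one ⊖ const (+ 8) ⊛ C)
1-8C-isUnit = unit (trans (⊖-at one (const (+ 8) ⊛ C) 0)
  (cong (ℤ._-_ 1ℤ) (trans (⊛-at-zero (const (+ 8)) C) (trans (cong (ℤ._*_ (+ 8)) (⊛-at-zero q (cube g))) refl))))

dilate-1-8C : dilate (one ⊖ const (+ 8) ⊛ C) ≋ u ⊛ (one ⊕ const (+ 2) ⊛ v ⊕ const (+ 4) ⊛ (v ⊛ v))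
dilate-1-8C = ≋-trans (≋-trans (dilate-⊖ one _) (+-cong (dilate-const 1ℤ) (-‿cong
    (≋-trans (dilate-⊛ _ C) (*-cong (dilate-const (+ 8)) dilate-C)))))
  (solve 1 (λ v → con 1ℤ :- con (+ 8) :* cub v := (con 1ℤ :- con (+ 2) :* v) :* (con 1ℤ :+ con (+ 2) :* v :+ con (+ 4) :* (v :* v))) ≋-refl v)

-- The series 1 - 8v³ is 1 - 8C at q³, so it passes through U₃, and it is divisible by u: (1 - 8v³)
-- w = v + 2v² + 4v³. Of these powers U₃ keeps only 4v³, as 4C.
U₃-w : U₃ w ≋ const (+ 4) ⊛ ξ
U₃-w = ⊛-cancelˡ 1-8C-isUnit (begin
  (one ⊖ const (+ 8) ⊛ C) ⊛ U₃ w
    ≈⟨ ≋-sym (U₃-dilate _ w) ⟩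
  U₃ (dilate (one ⊖ const (+ 8) ⊛ C) ⊛ w)
    ≈⟨ U₃-cong (≋-trans (*-congʳ dilate-1-8C) (≋-trans
         (solve 3 (λ u t w → u :* t :* w := w :* u :* t) ≋-refl u _ w) (≋-trans (*-congʳ w-u)
         (≋-trans (solve 2 (λ q d → let v = q :* d in v :* (con 1ℤ :+ con (+ 2) :* v :+ con (+ 4) :* (v :* v)) :=
                con (+ 4) :* cub v :+ q :* d :+ q :* (q :* (con (+ 2) :* (d :* d)))) ≋-refl q (dilate g))
           (+-cong (+-congʳ (≋-sym (≋-trans (dilate-⊛ _ C) (*-cong (dilate-const (+ 4)) dilate-C))))
             (*-congˡ (*-congˡ (≋-sym (≋-trans (dilate-⊛ _ _) (*-cong (dilate-const (+ 2)) (dilate-⊛ g g)))))))))))  ⟩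
  U₃ (assemble (const (+ 4) ⊛ C) g (const (+ 2) ⊛ (g ⊛ g)))
    ≈⟨ section₀-assemble _ _ _ ⟩
  const (+ 4) ⊛ C
    ≈⟨ *-congˡ (≋-sym x-C) ⟩
  const (+ 4) ⊛ (ξ ⊛ (one ⊖ const (+ 8) ⊛ C))
    ≈⟨ solve 2 (λ ξ c → con (+ 4) :* (ξ :* c) := c :* (con (+ 4) :* ξ)) ≋-refl ξ _ ⟩
  (one ⊖ const (+ 8) ⊛ C) ⊛ (const (+ 4) ⊛ ξ) ∎)
  where open ≋-Reasoning

U₃-w² : U₃ (w ⊛ w) ≋ const (+ 4) ⊛ ξ ⊕ const (+ 48) ⊛ (ξ ⊛ ξ)
U₃-w² = ⊛-cancelˡ (⊛-isUnit 1-8C-isUnit 1-8C-isUnit) (begin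
  (z ⊛ z) ⊛ U₃ (w ⊛ w)
    ≈⟨ ≋-sym (U₃-dilate _ (w ⊛ w)) ⟩
  U₃ (dilate (z ⊛ z) ⊛ (w ⊛ w))
    ≈⟨ U₃-cong (≋-trans (*-congʳ (≋-trans (dilate-⊛ z z) (*-cong dilate-1-8C dilate-1-8C))) (≋-trans
         (solve 3 (λ u t w → u :* t :* (u :* t) :* (w :* w) := (w :* u) :* (w :* u) :* (t :* t)) ≋-refl u _ w) (≋-trans (*-congʳ (*-cong w-u w-u))
         (≋-trans (solve 2 (λ q d → let v = q :* d ; t = con 1ℤ :+ con (+ 2) :* v :+ con (+ 4) :* (v :* v) in v :* v :* (t :* t) :=
                (con (+ 4) :* cub v :+ con (+ 16) :* (cub v :* cub v)) :+ q :* (con (+ 12) :* (cub v :* d))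
                  :+ q :* (q :* (d :* d :+ con (+ 16) :* (cub v :* (d :* d))))) ≋-refl q (dilate g))
           (+-cong (+-cong
               (≋-sym (≋-trans (dilate-⊕ _ _) (+-cong (D (+ 4) dilate-C) (D (+ 16) (≋-trans (dilate-⊛ C C) (*-cong dilate-C dilate-C))))))
               (*-congˡ (≋-sym (D (+ 12) (≋-trans (dilate-⊛ C g) (*-congʳ dilate-C))))))
             (*-congˡ (*-congˡ (≋-sym (≋-trans (dilate-⊕ _ _) (+-cong (dilate-⊛ g g)
               (D (+ 16) (≋-trans (dilate-⊛ C (g ⊛ g)) (*-cong dilate-C (dilate-⊛ g g)))))))))))))) ⟩
  U₃ (assemble (const (+ 4) ⊛ C ⊕ const (+ 16) ⊛ (C ⊛ C)) (const (+ 12) ⊛ (C ⊛ g)) (g ⊛ g ⊕ const (+ 16) ⊛ (C ⊛ (g ⊛ g))))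
    ≈⟨ section₀-assemble _ _ _ ⟩
  const (+ 4) ⊛ C ⊕ const (+ 16) ⊛ (C ⊛ C)
    -- Homogeneous of degree 2 in C and `z = 1 - 8C`, so that `x-C` applies to every C.
    ≈⟨ solve 1 (λ c → con (+ 4) :* c :+ con (+ 16) :* (c :* c) := con (+ 4) :* c :* (con 1ℤ :- con (+ 8) :* c) :+ con (+ 48) :* (c :* c)) ≋-refl C ⟩
  const (+ 4) ⊛ C ⊛ z ⊕ const (+ 48) ⊛ (C ⊛ C)
    ≈⟨ +-cong (*-congʳ (*-congˡ (≋-sym x-C))) (*-congˡ (*-cong (≋-sym x-C) (≋-sym x-C))) ⟩
  const (+ 4) ⊛ (ξ ⊛ z) ⊛ z ⊕ const (+ 48) ⊛ (ξ ⊛ z ⊛ (ξ ⊛ z))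
    ≈⟨ solve 2 (λ ξ z → con (+ 4) :* (ξ :* z) :* z :+ con (+ 48) :* (ξ :* z :* (ξ :* z)) := (z :* z) :* (con (+ 4) :* ξ :+ con (+ 48) :* (ξ :* ξ))) ≋-refl ξ z ⟩
  (z ⊛ z) ⊛ (const (+ 4) ⊛ ξ ⊕ const (+ 48) ⊛ (ξ ⊛ ξ)) ∎)
  where
  open ≋-Reasoning
  z : Series
  z = one ⊖ const (+ 8) ⊛ C

  D : ∀ c {f f′} → dilate f ≋ f′ → dilate (const c ⊛ f) ≋ const c ⊛ f′
  D c p = ≋-trans (dilate-⊛ (const c) _) (*-cong (dilate-const c) p)

-- The recursion for L

power-quotient : ∀ a b m n → IsUnit b → (a ^ m ÷ b ^ n) ⊛ b ↑ n ≋ a ↑ m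
power-quotient a b m n u = ≋-trans (*-congˡ (≋-sym (^≋↑ b n)))
  (≋-trans (÷-⊛ (isUnit-cong (^≋↑ b n) (↑-isUnit u n))) (^≋↑ a m))

-- `multiplier` is the A of the overview; the series `A` of the code is the theta function f(q, q²).
evenPrefactor oddPrefactor multiplier : Series
evenPrefactor = E 1 ^ 7 ÷ E 2 ^ 2
oddPrefactor  = E 3 ^ 7 ÷ E 6 ^ 2
multiplier    = dilate oddPrefactor ⊛ (q ⊛ d₂)

dilate-evenPrefactor : dilate evenPrefactor ≋ oddPrefactor
dilate-evenPrefactor = ⊛-cancelˡ (↑-isUnit E₆-isUnit 2) (≋-trans (*-comm _ _) (≋-trans
  (≋-sym (≋-trans (dilate-⊛ evenPrefactor (E 2 ↑ 2)) (*-congˡ (≋-trans (dilate-↑ (E 2) 2) (↑-cong 2 (dilate-E 1))))))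
  (≋-trans (dilate-cong (power-quotient (E 1) (E 2) 7 2 E₂-isUnit)) (≋-trans (dilate-↑ (E 1) 7) (≋-trans (↑-cong 7 (dilate-E 0))
    (≋-trans (≋-sym (power-quotient (E 3) (E 6) 7 2 E₆-isUnit)) (*-comm _ _)))))))

d₂-product : d₂ ⊛ E 1 ↑ 7 ≋ E 2 ↑ 2
d₂-product = power-quotient (E 2) (E 1) 2 7 E₁-isUnit

d₂-evenPrefactor : d₂ ⊛ evenPrefactor ≋ one
d₂-evenPrefactor = ⊛-cancelˡ (⊛-isUnit (↑-isUnit E₁-isUnit 7) (↑-isUnit E₂-isUnit 2)) (≋-trans
  (solve 4 (λ a b d p → a :* b :* (d :* p) := (d :* a) :* (p :* b)) ≋-refl (E 1 ↑ 7) (E 2 ↑ 2) d₂ evenPrefactor)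
  (≋-trans (*-cong d₂-product (power-quotient (E 1) (E 2) 7 2 E₂-isUnit)) (solve 2 (λ a b → b :* a := a :* b :* con 1ℤ) ≋-refl (E 1 ↑ 7) (E 2 ↑ 2))))

-- After the eta products in q and q² have cancelled against u⁴(1 + v), the product formulas for
-- `φ₉` and `B₃ ⊛ A₃` leave q B₃ / φ₉ = v.
multiplier-v : u ↑ 4 ⊛ (one ⊕ v) ⊛ multiplier ≋ v
multiplier-v = ⊛-cancelˡ K-isUnit (const-cancel (+ 2) (begin
  const (+ 2) ⊛ (K ⊛ (u ↑ 4 ⊛ (one ⊕ v) ⊛ multiplier))
    ≈⟨ solve 10 (λ a f e₂ e₁ e₁₈ u v p q d →
          con (+ 2) :* ((a :* pow 4 f :* (pow 4 e₂ :* pow 8 e₁ :* pow 3 e₁₈)) :* (pow 4 u :* (con 1ℤ :+ v) :* (p :* (q :* d)))) :=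
          pow 4 (u :* f :* e₂) :* ((con (+ 2) :* (a :* (con 1ℤ :+ v))) :* e₁) :* q :* (d :* pow 7 e₁) :* (p :* pow 2 e₁₈) :* e₁₈) ≋-refl
        A₃ φ₉ (E 2) (E 1) (E 18) u v (dilate oddPrefactor) q d₂ ⟩
  (u ⊛ φ₉ ⊛ E 2) ↑ 4 ⊛ (const (+ 2) ⊛ (A₃ ⊛ (one ⊕ v)) ⊛ E 1) ⊛ q ⊛ (d₂ ⊛ E 1 ↑ 7) ⊛ (dilate oddPrefactor ⊛ E 18 ↑ 2) ⊛ E 18
    ≈⟨ *-congʳ (*-cong (*-cong (*-congʳ (*-cong (↑-cong 4 (≋-trans (*-congʳ u-φ₉) φ-product)) (≋-trans (*-congʳ (≋-sym ψ₂-v)) ψ₂-product))) d₂-product) p-product) ⟩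
  (E 1 ⊛ E 1) ↑ 4 ⊛ (const (+ 2) ⊛ (E 2 ⊛ E 2)) ⊛ q ⊛ E 2 ↑ 2 ⊛ E 9 ↑ 7 ⊛ E 18
    ≈⟨ solve 5 (λ e₁ e₂ e₉ e₁₈ q → pow 4 (e₁ :* e₁) :* (con (+ 2) :* (e₂ :* e₂)) :* q :* pow 2 e₂ :* pow 7 e₉ :* e₁₈ :=
          con (+ 2) :* (pow 4 e₂ :* pow 8 e₁ :* (q :* ((e₉ :* e₁₈) :* pow 3 (e₉ :* e₉))))) ≋-refl (E 1) (E 2) (E 9) (E 18) q ⟩
  const (+ 2) ⊛ (E 2 ↑ 4 ⊛ E 1 ↑ 8 ⊛ (q ⊛ ((E 9 ⊛ E 18) ⊛ (E 9 ⊛ E 9) ↑ 3)))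
    ≈⟨ *-congˡ (*-congˡ (*-congˡ (*-cong (≋-sym B₃A₃-product) (↑-cong 3 (≋-sym φ₉-product))))) ⟩
  const (+ 2) ⊛ (E 2 ↑ 4 ⊛ E 1 ↑ 8 ⊛ (q ⊛ ((B₃ ⊛ A₃) ⊛ (φ₉ ⊛ E 18) ↑ 3)))
    ≈⟨ solve 7 (λ e₂ e₁ q b a f e₁₈ → con (+ 2) :* (pow 4 e₂ :* pow 8 e₁ :* (q :* ((b :* a) :* pow 3 (f :* e₁₈)))) :=
          con (+ 2) :* (pow 4 e₂ :* pow 8 e₁ :* pow 3 e₁₈ :* a :* pow 3 f :* (q :* b))) ≋-refl (E 2) (E 1) q B₃ A₃ φ₉ (E 18) ⟩
  const (+ 2) ⊛ (E 2 ↑ 4 ⊛ E 1 ↑ 8 ⊛ E 18 ↑ 3 ⊛ A₃ ⊛ φ₉ ↑ 3 ⊛ (q ⊛ B₃))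
    ≈⟨ *-congˡ (*-congˡ (≋-sym v-φ₉)) ⟩
  const (+ 2) ⊛ (E 2 ↑ 4 ⊛ E 1 ↑ 8 ⊛ E 18 ↑ 3 ⊛ A₃ ⊛ φ₉ ↑ 3 ⊛ (v ⊛ φ₉))
    ≈⟨ solve 4 (λ n a f v → con (+ 2) :* (n :* a :* pow 3 f :* (v :* f)) := con (+ 2) :* (a :* pow 4 f :* n :* v)) ≋-refl (E 2 ↑ 4 ⊛ E 1 ↑ 8 ⊛ E 18 ↑ 3) A₃ φ₉ v ⟩
  const (+ 2) ⊛ (K ⊛ v) ∎))
  where
  open ≋-Reasoning
  K : Series
  K = A₃ ⊛ φ₉ ↑ 4 ⊛ (E 2 ↑ 4 ⊛ E 1 ↑ 8 ⊛ E 18 ↑ 3)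

  K-isUnit : IsUnit K
  K-isUnit = ⊛-isUnit (⊛-isUnit A₃-isUnit (↑-isUnit φ₉-isUnit 4)) (⊛-isUnit (⊛-isUnit (↑-isUnit E₂-isUnit 4) (↑-isUnit E₁-isUnit 8)) (↑-isUnit E₁₈-isUnit 3))

  p-product : dilate oddPrefactor ⊛ E 18 ↑ 2 ≋ E 9 ↑ 7
  p-product = ≋-trans (*-congˡ (≋-sym (≋-trans (dilate-↑ (E 6) 2) (↑-cong 2 (dilate-E 5)))))
    (≋-trans (≋-sym (dilate-⊛ oddPrefactor (E 6 ↑ 2))) (≋-trans (dilate-cong (power-quotient (E 3) (E 6) 7 2 E₆-isUnit))
      (≋-trans (dilate-↑ (E 3) 7) (↑-cong 7 (dilate-E 2)))))

multiplier-w : (one ⊕ const (+ 3) ⊛ w) ⊛ multiplier ≋ w ⊛ (one ⊕ const (+ 2) ⊛ w) ↑ 4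
multiplier-w = ⊛-cancelˡ (↑-isUnit u-isUnit 5) (begin
  u ↑ 5 ⊛ ((one ⊕ const (+ 3) ⊛ w) ⊛ multiplier)
    ≈⟨ solve 3 (λ u w m → pow 5 u :* ((con 1ℤ :+ con (+ 3) :* w) :* m) := pow 4 u :* (u :+ con (+ 3) :* (w :* u)) :* m) ≋-refl u w multiplier ⟩
  u ↑ 4 ⊛ (u ⊕ const (+ 3) ⊛ (w ⊛ u)) ⊛ multiplier
    ≈⟨ *-congʳ (*-congˡ (≋-trans (+-congˡ (*-congˡ w-u)) (solve 1 (λ v → con 1ℤ :- con (+ 2) :* v :+ con (+ 3) :* v := con 1ℤ :+ v) ≋-refl v))) ⟩
  u ↑ 4 ⊛ (one ⊕ v) ⊛ multiplier
    ≈⟨ multiplier-v ⟩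
  v
    -- Inserting 1 = (u + 2v)⁴ brings the degree to 5, that of the cancelled power of u; (1 + 2w)⁴
    -- arises here.
    ≈⟨ solve 1 (λ v → v := v :* pow 4 (con 1ℤ :- con (+ 2) :* v :+ con (+ 2) :* v)) ≋-refl v ⟩
  v ⊛ (u ⊕ const (+ 2) ⊛ v) ↑ 4
    ≈⟨ *-cong (≋-sym w-u) (↑-cong 4 (+-congˡ (*-congˡ (≋-sym w-u)))) ⟩
  (w ⊛ u) ⊛ (u ⊕ const (+ 2) ⊛ (w ⊛ u)) ↑ 4
    ≈⟨ solve 2 (λ u w → (w :* u) :* pow 4 (u :+ con (+ 2) :* (w :* u)) := pow 5 u :* (w :* pow 4 (con 1ℤ :+ con (+ 2) :* w))) ≋-refl u w ⟩
  u ↑ 5 ⊛ (w ⊛ (one ⊕ const (+ 2) ⊛ w) ↑ 4) ∎)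
  where open ≋-Reasoning

U₃-q : ∀ f → U₃ (q ⊛ f) ≋ q ⊛ section 2 f
U₃-q f = pointwise λ
  { zero    → trans (⊛-at-zero q f) (sym (⊛-at-zero q (section 2 f)))
  ; (suc n) → trans (q-⊛-suc f (2 ℕ.+ n ℕ.* 3)) (sym (q-⊛-suc (section 2 f) n))
  }

U₃-q² : ∀ f → U₃ (q ⊛ (q ⊛ f)) ≋ q ⊛ section 1 f
U₃-q² f = pointwise λ
  { zero    → trans (⊛-at-zero q (q ⊛ f)) (sym (⊛-at-zero q (section 1 f)))
  ; (suc n) → trans (q-⊛-suc (q ⊛ f) (2 ℕ.+ n ℕ.* 3)) (trans (q-⊛-suc f (1 ℕ.+ n ℕ.* 3)) (sym (q-⊛-suc (section 1 f) n)))
  }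

progression : ℕ → Series
progression α n = d₂ (3 ℕ.^ α ℕ.* n ℕ.+ λ[ α ])

-- Matching on parity α in a type that mentions the eta quotients would normalise them.

data PrefactorView : Parity → Series → Set where
  odd  : PrefactorView 1ℙ (E 3 ^ 7 ÷ E 6 ^ 2)
  even : PrefactorView 0ℙ (E 1 ^ 7 ÷ E 2 ^ 2)

prefactorView : ∀ α → PrefactorView (parity α) (prefactor α)
prefactorView α with parity α
... | 1ℙ = odd
... | 0ℙ = even

oddView : ∀ {p f} → PrefactorView p f → p ≡ 1ℙ → f ≋ oddPrefactor
oddView odd _ = ≋-refl

evenView : ∀ {p f} → PrefactorView p f → p ≡ 0ℙ → f ≋ evenPrefactor
evenView even _ = ≋-refl

L-odd : ∀ {α} → parity α ≡ 1ℙ → L α ≋ oddPrefactor ⊛ (q ⊛ progression α)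
L-odd {α} p = ≋-trans (*≋⊛ (prefactor α) (q Defs.* progression α)) (*-cong (oddView (prefactorView α) p) (*≋⊛ q (progression α)))

L-even : ∀ {α} → parity α ≡ 0ℙ → L α ≋ evenPrefactor ⊛ (q ⊛ progression α)
L-even {α} p = ≋-trans (*≋⊛ (prefactor α) (q Defs.* progression α)) (*-cong (evenView (prefactorView α) p) (*≋⊛ q (progression α)))

λ-odd : ∀ {α} → parity α ≡ 1ℙ → λ[ α ] ≡ (1 ℕ.+ 5 ℕ.* 3 ℕ.^ α) / 8
λ-odd {α} p with parity α | p
... | .1ℙ | refl = refl

λ-even : ∀ {α} → parity α ≡ 0ℙ → λ[ α ] ≡ (1 ℕ.+ 7 ℕ.* 3 ℕ.^ α) / 8
λ-even {α} p with parity α | p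
... | .0ℙ | refl = refl

[m+n*8]/8 : ∀ m n → (m ℕ.+ n ℕ.* 8) / 8 ≡ m / 8 ℕ.+ n
[m+n*8]/8 m n = trans (+-distrib-/-∣ʳ m (n∣m*n n {8})) (cong (m / 8 ℕ.+_) (m*n/n≡m n 8))

-- With t = 3^α, 1 + 7·3t exceeds 1 + 5t by 8·2t, so λ grows by 2t and the class 2 modulo 3 is
-- selected.
progression-even : ∀ {α} → parity α ≡ 1ℙ → parity (suc α) ≡ 0ℙ → ∀ n → section 2 (progression α) n ≡ progression (suc α) n
progression-even {α} p p′ n = cong d₂ (trans (cong (3 ℕ.^ α ℕ.* (2 ℕ.+ n ℕ.* 3) ℕ.+_) (λ-odd {α} p))
  (trans (rearrange (3 ℕ.^ α) n ((1 ℕ.+ 5 ℕ.* 3 ℕ.^ α) / 8))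
    (cong (3 ℕ.^ suc α ℕ.* n ℕ.+_) (sym (trans (λ-even {suc α} p′) (trans (cong (_/ 8) (numerator (3 ℕ.^ α))) ([m+n*8]/8 (1 ℕ.+ 5 ℕ.* 3 ℕ.^ α) (2 ℕ.* 3 ℕ.^ α))))))))
  where
  rearrange : ∀ t n l → t ℕ.* (2 ℕ.+ n ℕ.* 3) ℕ.+ l ≡ 3 ℕ.* t ℕ.* n ℕ.+ (l ℕ.+ 2 ℕ.* t)
  rearrange = solve-∀
  numerator : ∀ t → 1 ℕ.+ 7 ℕ.* (3 ℕ.* t) ≡ 1 ℕ.+ 5 ℕ.* t ℕ.+ 2 ℕ.* t ℕ.* 8
  numerator = solve-∀

-- Here 1 + 5·3t exceeds 1 + 7t by 8t, which selects the class 1.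
progression-odd : ∀ {α} → parity α ≡ 0ℙ → parity (suc α) ≡ 1ℙ → ∀ n → section 1 (progression α) n ≡ progression (suc α) n
progression-odd {α} p p′ n = cong d₂ (trans (cong (3 ℕ.^ α ℕ.* (1 ℕ.+ n ℕ.* 3) ℕ.+_) (λ-even {α} p))
  (trans (rearrange (3 ℕ.^ α) n ((1 ℕ.+ 7 ℕ.* 3 ℕ.^ α) / 8))
    (cong (3 ℕ.^ suc α ℕ.* n ℕ.+_) (sym (trans (λ-odd {suc α} p′) (trans (cong (_/ 8) (numerator (3 ℕ.^ α))) ([m+n*8]/8 (1 ℕ.+ 7 ℕ.* 3 ℕ.^ α) (3 ℕ.^ α))))))))
  where
  rearrange : ∀ t n l → t ℕ.* (1 ℕ.+ n ℕ.* 3) ℕ.+ l ≡ 3 ℕ.* t ℕ.* n ℕ.+ (l ℕ.+ t)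
  rearrange = solve-∀
  numerator : ∀ t → 1 ℕ.+ 5 ℕ.* (3 ℕ.* t) ≡ 1 ℕ.+ 7 ℕ.* t ℕ.+ t ℕ.* 8
  numerator = solve-∀

progression-one : ∀ n → section 2 d₂ n ≡ progression 1 n
progression-one n = cong d₂ (index n)
  where
  rearrange : ∀ n → 2 ℕ.+ n ℕ.* 3 ≡ 3 ℕ.* n ℕ.+ 2
  rearrange = solve-∀

  index : ∀ n → 2 ℕ.+ n ℕ.* 3 ≡ 3 ℕ.^ 1 ℕ.* n ℕ.+ λ[ 1 ]
  index = rearrange

L-one : L 1 ≋ U₃ multiplier
L-one = ≋-trans (L-odd {1} refl) (≋-sym (≋-trans (U₃-dilate oddPrefactor (q ⊛ d₂)) (*-congˡ (≋-trans (U₃-q d₂)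
  (*-congˡ (pointwise progression-one))))))

-- The odd prefactor is the even one at q³, so it leaves U₃ as the prefactor of the next index; the
-- factor q makes U₃ pick section 2.
L-suc-odd : ∀ {α} → parity α ≡ 1ℙ → parity (suc α) ≡ 0ℙ → L (suc α) ≋ U₃ (L α)
L-suc-odd {α} p p′ = ≋-trans (L-even {suc α} p′) (≋-sym (≋-trans (U₃-cong (≋-trans (L-odd {α} p) (*-congʳ (≋-sym dilate-evenPrefactor))))
  (≋-trans (U₃-dilate evenPrefactor (q ⊛ progression α)) (*-congˡ (≋-trans (U₃-q (progression α)) (*-congˡ (pointwise (progression-even {α} p p′))))))))

-- In the multiplier `d₂` cancels the even prefactor, `dilate oddPrefactor` becomes the next
-- prefactor, and the additional q makes U₃ pick section 1.
L-suc-even : ∀ {α} → parity α ≡ 0ℙ → parity (suc α) ≡ 1ℙ → L (suc α) ≋ U₃ (multiplier ⊛ L α)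
L-suc-even {α} p p′ = ≋-trans (L-odd {suc α} p′) (≋-sym (≋-trans (U₃-cong rearrange)
  (≋-trans (U₃-dilate oddPrefactor (q ⊛ (q ⊛ progression α))) (*-congˡ (≋-trans (U₃-q² (progression α)) (*-congˡ (pointwise (progression-odd {α} p p′))))))))
  where
  rearrange : multiplier ⊛ L α ≋ dilate oddPrefactor ⊛ (q ⊛ (q ⊛ progression α))
  rearrange = ≋-trans (*-congˡ (L-even {α} p)) (≋-trans
    (solve 5 (λ o q d e f → o :* (q :* d) :* (e :* (q :* f)) := o :* (q :* (q :* f)) :* (d :* e)) ≋-refl (dilate oddPrefactor) q d₂ evenPrefactor (progression α))
    (≋-trans (*-congˡ d₂-evenPrefactor) (*-identityʳ _)))

-- Polynomials as coefficient lists

infixl 6 _⊞_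
infixl 7 _·_ _⊠_

_⊞_ : List ℤ → List ℤ → List ℤ
[]       ⊞ bs       = bs
(a ∷ as) ⊞ []       = a ∷ as
(a ∷ as) ⊞ (b ∷ bs) = a ℤ.+ b ∷ as ⊞ bs

_·_ : ℤ → List ℤ → List ℤ
c · as = map (c ℤ.*_) as

_⊠_ : List ℤ → List ℤ → List ℤ
[]       ⊠ bs = []
(a ∷ as) ⊠ bs = a · bs ⊞ (0ℤ ∷ as ⊠ bs)

eval : List ℤ → Series → Series
eval []       z = nil
eval (c ∷ cs) z = const c ⊕ z ⊛ eval cs z

evaluate≋eval : ∀ cs z → evaluate cs z ≋ eval cs z
evaluate≋eval []       z = ≋-refl
evaluate≋eval (c ∷ cs) z = ≋-trans (+≋⊕ _ _) (+-congˡ (≋-trans (*≋⊛ _ _) (*-congˡ (evaluate≋eval cs z))))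

eval-cong : ∀ cs {z z′} → z ≋ z′ → eval cs z ≋ eval cs z′
eval-cong []       p = ≋-refl
eval-cong (c ∷ cs) p = +-congˡ (*-cong p (eval-cong cs p))

eval-⊞ : ∀ as bs z → eval (as ⊞ bs) z ≋ eval as z ⊕ eval bs z
eval-⊞ []       bs       z = ≋-sym (+-identityˡ _)
eval-⊞ (a ∷ as) []       z = ≋-sym (+-identityʳ _)
eval-⊞ (a ∷ as) (b ∷ bs) z = ≋-trans (+-cong (ι-+ a b) (*-congˡ (eval-⊞ as bs z)))
  (solve 5 (λ a b z s t → a :+ b :+ z :* (s :+ t) := a :+ z :* s :+ (b :+ z :* t)) ≋-refl (const a) (const b) z (eval as z) (eval bs z))

eval-· : ∀ c as z → eval (c · as) z ≋ const c ⊛ eval as z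
eval-· c []       z = ≋-sym (zeroʳ (const c))
eval-· c (a ∷ as) z = ≋-trans (+-cong (ι-* c a) (*-congˡ (eval-· c as z)))
  (solve 4 (λ c a z s → c :* a :+ z :* (c :* s) := c :* (a :+ z :* s)) ≋-refl (const c) (const a) z (eval as z))

eval-shift : ∀ as z → eval (0ℤ ∷ as) z ≋ z ⊛ eval as z
eval-shift as z = +-identityˡ _

eval-⊠ : ∀ as bs z → eval (as ⊠ bs) z ≋ eval as z ⊛ eval bs z
eval-⊠ []       bs z = ≋-sym (zeroˡ _)
eval-⊠ (a ∷ as) bs z = ≋-trans (eval-⊞ (a · bs) (0ℤ ∷ as ⊠ bs) z)
  (≋-trans (+-cong (eval-· a bs z) (≋-trans (eval-shift (as ⊠ bs) z) (*-congˡ (eval-⊠ as bs z))))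
    (solve 4 (λ a b z s → a :* b :+ z :* (s :* b) := (a :+ z :* s) :* b) ≋-refl (const a) (eval bs z) z (eval as z)))

dilate-eval : ∀ cs z → dilate (eval cs z) ≋ eval cs (dilate z)
dilate-eval []       z = dilate-const 0ℤ
dilate-eval (c ∷ cs) z = ≋-trans (dilate-⊕ _ _) (+-cong (dilate-const c) (≋-trans (dilate-⊛ z _) (*-congˡ (dilate-eval cs z))))

-- ℤ[w] as a module over ℤ[y] with basis 1, w, w²

data Triple : Set where
  ⟨_,_,_⟩ : (a b c : List ℤ) → Triple

⟦_⟧ : Triple → Series
⟦ ⟨ a , b , c ⟩ ⟧ = eval a y ⊕ eval b y ⊛ w ⊕ eval c y ⊛ (w ⊛ w)

-- The coordinates move up by one, and the resulting w³ is reduced by `w-cubic`; `0ℤ ∷ c` is y times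
-- c.
mulw : Triple → Triple
mulw ⟨ a , b , c ⟩ = ⟨ 0ℤ ∷ c , a ⊞ + 6 · (0ℤ ∷ c) , b ⊞ + 12 · (0ℤ ∷ c) ⟩

⟦mulw⟧ : ∀ t → ⟦ mulw t ⟧ ≋ w ⊛ ⟦ t ⟧
⟦mulw⟧ ⟨ a , b , c ⟩ = begin
  eval (0ℤ ∷ c) y ⊕ eval (a ⊞ + 6 · (0ℤ ∷ c)) y ⊛ w ⊕ eval (b ⊞ + 12 · (0ℤ ∷ c)) y ⊛ (w ⊛ w)
    ≈⟨ +-cong (+-cong (eval-shift c y) (*-congʳ (added a (+ 6)))) (*-congʳ (added b (+ 12))) ⟩
  y ⊛ C′ ⊕ (A′ ⊕ const (+ 6) ⊛ (y ⊛ C′)) ⊛ w ⊕ (B′ ⊕ const (+ 12) ⊛ (y ⊛ C′)) ⊛ (w ⊛ w)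
    ≈⟨ solve 5 (λ y a b c w → y :* c :+ (a :+ con (+ 6) :* (y :* c)) :* w :+ (b :+ con (+ 12) :* (y :* c)) :* (w :* w) :=
         a :* w :+ b :* (w :* w) :+ c :* (y :* (con 1ℤ :+ con (+ 6) :* w :+ con (+ 12) :* (w :* w)))) ≋-refl y A′ B′ C′ w ⟩
  A′ ⊛ w ⊕ B′ ⊛ (w ⊛ w) ⊕ C′ ⊛ (y ⊛ (one ⊕ const (+ 6) ⊛ w ⊕ const (+ 12) ⊛ (w ⊛ w)))
    ≈⟨ +-congˡ (*-congˡ (≋-sym w-cubic)) ⟩
  A′ ⊛ w ⊕ B′ ⊛ (w ⊛ w) ⊕ C′ ⊛ cube w
    ≈⟨ solve 4 (λ a b c w → a :* w :+ b :* (w :* w) :+ c :* (w :* w :* w) := w :* (a :+ b :* w :+ c :* (w :* w))) ≋-refl A′ B′ C′ w ⟩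
  w ⊛ (A′ ⊕ B′ ⊛ w ⊕ C′ ⊛ (w ⊛ w)) ∎
  where
  open ≋-Reasoning
  A′ B′ C′ : Series
  A′ = eval a y
  B′ = eval b y
  C′ = eval c y

  added : ∀ p k → eval (p ⊞ k · (0ℤ ∷ c)) y ≋ eval p y ⊕ const k ⊛ (y ⊛ C′)
  added p k = ≋-trans (eval-⊞ p (k · (0ℤ ∷ c)) y) (+-congˡ (≋-trans (eval-· k (0ℤ ∷ c) y) (*-congˡ (eval-shift c y))))

infixl 6 _⊞ₜ_

_⊞ₜ_ : Triple → Triple → Triple
⟨ a , b , c ⟩ ⊞ₜ ⟨ a′ , b′ , c′ ⟩ = ⟨ a ⊞ a′ , b ⊞ b′ , c ⊞ c′ ⟩

⟦⊞ₜ⟧ : ∀ s t → ⟦ s ⊞ₜ t ⟧ ≋ ⟦ s ⟧ ⊕ ⟦ t ⟧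
⟦⊞ₜ⟧ ⟨ a , b , c ⟩ ⟨ a′ , b′ , c′ ⟩ = ≋-trans
  (+-cong (+-cong (eval-⊞ a a′ y) (*-congʳ (eval-⊞ b b′ y))) (*-congʳ (eval-⊞ c c′ y)))
  (solve 7 (λ a b c a′ b′ c′ w → a :+ a′ :+ (b :+ b′) :* w :+ (c :+ c′) :* (w :* w) := a :+ b :* w :+ c :* (w :* w) :+ (a′ :+ b′ :* w :+ c′ :* (w :* w)))
    ≋-refl (eval a y) (eval b y) (eval c y) (eval a′ y) (eval b′ y) (eval c′ y) w)

_⊠ₜ_ : List ℤ → Triple → Triple
p ⊠ₜ ⟨ a , b , c ⟩ = ⟨ p ⊠ a , p ⊠ b , p ⊠ c ⟩

⟦⊠ₜ⟧ : ∀ p t → ⟦ p ⊠ₜ t ⟧ ≋ eval p y ⊛ ⟦ t ⟧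
⟦⊠ₜ⟧ p ⟨ a , b , c ⟩ = ≋-trans
  (+-cong (+-cong (eval-⊠ p a y) (*-congʳ (eval-⊠ p b y))) (*-congʳ (eval-⊠ p c y)))
  (solve 5 (λ p a b c w → p :* a :+ p :* b :* w :+ p :* c :* (w :* w) := p :* (a :+ b :* w :+ c :* (w :* w))) ≋-refl (eval p y) (eval a y) (eval b y) (eval c y) w)

_⊙_ : List ℤ → Triple → Triple
[]       ⊙ t = ⟨ [] , [] , [] ⟩
(c ∷ cs) ⊙ t = (c ∷ []) ⊠ₜ t ⊞ₜ mulw (cs ⊙ t)

eval-[] : ∀ c z → eval (c ∷ []) z ≋ const c
eval-[] c z = ≋-trans (+-congˡ (zeroʳ z)) (+-identityʳ (const c))

⟦⊙⟧ : ∀ p t → ⟦ p ⊙ t ⟧ ≋ eval p w ⊛ ⟦ t ⟧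
⟦⊙⟧ []       t = solve 2 (λ w t → con 0ℤ :+ con 0ℤ :* w :+ con 0ℤ :* (w :* w) := con 0ℤ :* t) ≋-refl w ⟦ t ⟧
⟦⊙⟧ (c ∷ cs) t = ≋-trans (⟦⊞ₜ⟧ ((c ∷ []) ⊠ₜ t) (mulw (cs ⊙ t))) (≋-trans
  (+-cong (≋-trans (⟦⊠ₜ⟧ (c ∷ []) t) (*-congʳ (eval-[] c y))) (≋-trans (⟦mulw⟧ (cs ⊙ t)) (*-congˡ (⟦⊙⟧ cs t))))
  (solve 4 (λ c w p t → c :* t :+ w :* (p :* t) := (c :+ w :* p) :* t) ≋-refl (const c) w (eval cs w) ⟦ t ⟧))

oneₜ : Triple
oneₜ = ⟨ 1ℤ ∷ [] , [] , [] ⟩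

⟦oneₜ⟧ : ⟦ oneₜ ⟧ ≋ one
⟦oneₜ⟧ = solve 2 (λ y w → con 1ℤ :+ y :* con 0ℤ :+ con 0ℤ :* w :+ con 0ℤ :* (w :* w) := con 1ℤ) ≋-refl y w

x-poly s-poly X-poly : List ℤ
x-poly = 0ℤ ∷ 1ℤ ∷ + 3 ∷ + 3 ∷ []
s-poly = 1ℤ ∷ + 3 ∷ []
X-poly = 1ℤ ∷ + 9 ∷ + 27 ∷ + 27 ∷ []

eval-x-poly : eval x-poly w ≋ ξ
eval-x-poly = ≋-trans (solve 1 (λ w → con 0ℤ :+ w :* (con 1ℤ :+ w :* (con (+ 3) :+ w :* (con (+ 3) :+ w :* con 0ℤ)))
  := w :+ con (+ 3) :* (w :* w) :+ con (+ 3) :* (w :* w :* w)) ≋-refl w) (≋-sym x-w)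

U₃-⊕ : ∀ f g → U₃ (f ⊕ g) ≋ U₃ f ⊕ U₃ g
U₃-⊕ = section-⊕ 0

U₃-eval : ∀ p f → U₃ (eval p y ⊛ f) ≋ eval p ξ ⊛ U₃ f
U₃-eval p f = ≋-trans (U₃-cong (*-congʳ (≋-sym (dilate-eval p ξ)))) (U₃-dilate (eval p ξ) f)

-- Coordinates are read in y before U₃ and in x after it, so the lists themselves stay; 1, 4x and 4x
-- + 48x² are the images of the basis.
Uₜ : Triple → List ℤ
Uₜ ⟨ a , b , c ⟩ = a ⊞ + 4 · (0ℤ ∷ b) ⊞ (0ℤ ∷ + 4 ∷ + 48 ∷ []) ⊠ c

U₃-⟦⟧ : ∀ t → U₃ ⟦ t ⟧ ≋ eval (Uₜ t) ξ
U₃-⟦⟧ ⟨ a , b , c ⟩ = begin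
  U₃ (eval a y ⊕ eval b y ⊛ w ⊕ eval c y ⊛ (w ⊛ w))
    ≈⟨ ≋-trans (U₃-⊕ _ _) (+-congʳ (U₃-⊕ _ _)) ⟩
  U₃ (eval a y) ⊕ U₃ (eval b y ⊛ w) ⊕ U₃ (eval c y ⊛ (w ⊛ w))
    ≈⟨ +-cong (+-cong (≋-trans (U₃-cong (≋-sym (*-identityʳ (eval a y)))) (≋-trans (U₃-eval a one) (*-congˡ U₃-one)))
         (≋-trans (U₃-eval b w) (*-congˡ U₃-w))) (≋-trans (U₃-eval c (w ⊛ w)) (*-congˡ U₃-w²)) ⟩
  A′ ⊛ one ⊕ B′ ⊛ (const (+ 4) ⊛ ξ) ⊕ C′ ⊛ (const (+ 4) ⊛ ξ ⊕ const (+ 48) ⊛ (ξ ⊛ ξ))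
    ≈⟨ solve 4 (λ a b c ξ → a :* con 1ℤ :+ b :* (con (+ 4) :* ξ) :+ c :* (con (+ 4) :* ξ :+ con (+ 48) :* (ξ :* ξ)) :=
         a :+ con (+ 4) :* (ξ :* b) :+ (con 0ℤ :+ ξ :* (con (+ 4) :+ ξ :* (con (+ 48) :+ ξ :* con 0ℤ))) :* c) ≋-refl A′ B′ C′ ξ ⟩
  A′ ⊕ const (+ 4) ⊛ (ξ ⊛ B′) ⊕ eval (0ℤ ∷ + 4 ∷ + 48 ∷ []) ξ ⊛ C′
    ≈⟨ ≋-sym (≋-trans (eval-⊞ (a ⊞ + 4 · (0ℤ ∷ b)) ((0ℤ ∷ + 4 ∷ + 48 ∷ []) ⊠ c) ξ) (+-cong
         (≋-trans (eval-⊞ a (+ 4 · (0ℤ ∷ b)) ξ) (+-congˡ (≋-trans (eval-· (+ 4) (0ℤ ∷ b) ξ) (*-congˡ (eval-shift b ξ)))))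
         (eval-⊠ (0ℤ ∷ + 4 ∷ + 48 ∷ []) c ξ))) ⟩
  eval (a ⊞ + 4 · (0ℤ ∷ b) ⊞ (0ℤ ∷ + 4 ∷ + 48 ∷ []) ⊠ c) ξ ∎
  where
  open ≋-Reasoning
  A′ B′ C′ : Series
  A′ = eval a ξ
  B′ = eval b ξ
  C′ = eval c ξ

xPower : ℕ → Triple
xPower zero    = oneₜ
xPower (suc n) = x-poly ⊙ xPower n

⟦xPower⟧ : ∀ n → ⟦ xPower n ⟧ ≋ ξ ↑ n
⟦xPower⟧ zero    = ⟦oneₜ⟧
⟦xPower⟧ (suc n) = ≋-trans (⟦⊙⟧ x-poly (xPower n)) (*-cong eval-x-poly (⟦xPower⟧ n))

-- Conjugates of s = 1 + 3w and X = 1 + 9x over ℤ[y]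

s s′ X X′ N : Series
s  = eval s-poly w
s′ = s ⊛ s ⊕ eval (-[1+ 2 ] ∷ -[1+ 35 ] ∷ []) y ⊛ s ⊕ eval (+ 3 ∷ + 18 ∷ []) y
N  = eval (1ℤ ∷ + 9 ∷ []) y
X  = eval (1ℤ ∷ + 9 ∷ []) ξ

-- The characteristic polynomial of X over ℤ[y] is T³ + t₁ T² + t₂ T - N³ with t₁, t₂ taken at 9y.

t₁ t₂ : List ℤ
t₁ = -[1+ 2 ] ∷ -[1+ 56 ] ∷ -[1+ 119 ] ∷ -[1+ 63 ] ∷ []
t₂ = + 3 ∷ -[1+ 20 ] ∷ -[1+ 38 ] ∷ -[1+ 15 ] ∷ []

9y : Series
9y = const (+ 9) ⊛ y

X′ = X ⊛ X ⊕ eval t₁ 9y ⊛ X ⊕ eval t₂ 9y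

homothety : ℤ → List ℤ → List ℤ
homothety c []       = []
homothety c (a ∷ as) = a ∷ c · homothety c as

eval-homothety : ∀ c as z → eval (homothety c as) z ≋ eval as (const c ⊛ z)
eval-homothety c []       z = ≋-refl
eval-homothety c (a ∷ as) z = +-congˡ (≋-trans (*-congˡ (≋-trans (eval-· c (homothety c as) z) (*-congˡ (eval-homothety c as z))))
  (solve 3 (λ c z e → z :* (c :* e) := c :* z :* e) ≋-refl (const c) z (eval as (const c ⊛ z))))

mulS mulS′ mulX mulX′ : Triple → Triple
mulS t  = s-poly ⊙ t
mulS′ t = mulS (mulS t) ⊞ₜ (-[1+ 2 ] ∷ -[1+ 35 ] ∷ []) ⊠ₜ mulS t ⊞ₜ (+ 3 ∷ + 18 ∷ []) ⊠ₜ t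
mulX t  = X-poly ⊙ t
mulX′ t = mulX (mulX t) ⊞ₜ homothety (+ 9) t₁ ⊠ₜ mulX t ⊞ₜ homothety (+ 9) t₂ ⊠ₜ t

consTrimmed : ℤ → List ℤ → List ℤ
consTrimmed (+ 0) [] = []
consTrimmed c     as = c ∷ as

trim : List ℤ → List ℤ
trim []       = []
trim (c ∷ cs) = consTrimmed c (trim cs)

eval-consTrimmed : ∀ c as z → eval (consTrimmed c as) z ≋ eval (c ∷ as) z
eval-consTrimmed (+ zero)  []       z = ≋-sym (≋-trans (+-congˡ (zeroʳ z)) (+-identityʳ nil))
eval-consTrimmed (+ zero)  (_ ∷ _)  z = ≋-refl
eval-consTrimmed (+ suc _) _        z = ≋-refl
eval-consTrimmed -[1+ _ ]  _        z = ≋-refl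

eval-trim : ∀ as z → eval (trim as) z ≋ eval as z
eval-trim []       z = ≋-refl
eval-trim (a ∷ as) z = ≋-trans (eval-consTrimmed a (trim as) z) (+-congˡ (*-congˡ (eval-trim as z)))

-- Equality up to trailing zeros, as a decision: unlike refl, it evaluates each list only once.

infix 4 _≐_

_≐_ : List ℤ → List ℤ → Set
as ≐ bs = True (≡-dec ℤ._≟_ (trim as) (trim bs))

≐⇒≋ : ∀ as bs z → as ≐ bs → eval as z ≋ eval bs z
≐⇒≋ as bs z p = ≋-trans (≋-sym (eval-trim as z)) (≋-trans (≡⇒≋ (cong (λ cs → eval cs z) (toWitness p))) (eval-trim bs z))

trimₜ : Triple → Triple
trimₜ ⟨ a , b , c ⟩ = ⟨ trim a , trim b , trim c ⟩

⟦trimₜ⟧ : ∀ t → ⟦ trimₜ t ⟧ ≋ ⟦ t ⟧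
⟦trimₜ⟧ ⟨ a , b , c ⟩ = +-cong (+-cong (eval-trim a y) (*-congʳ (eval-trim b y))) (*-congʳ (eval-trim c y))

trimₜ≡⇒≋ : ∀ t t′ → trimₜ t ≡ trimₜ t′ → ⟦ t ⟧ ≋ ⟦ t′ ⟧
trimₜ≡⇒≋ t t′ p = ≋-trans (≋-sym (⟦trimₜ⟧ t)) (≋-trans (≡⇒≋ (cong ⟦_⟧ p)) (⟦trimₜ⟧ t′))

⟦scalar⟧ : ∀ p → ⟦ ⟨ p , [] , [] ⟩ ⟧ ≋ eval p y
⟦scalar⟧ p = solve 2 (λ p w → p :+ con 0ℤ :* w :+ con 0ℤ :* (w :* w) := p) ≋-refl (eval p y) w

private
  combine : ∀ {a b c f g h} → ⟦ a ⟧ ≋ f → ⟦ b ⟧ ≋ g → ⟦ c ⟧ ≋ h → ⟦ a ⊞ₜ b ⊞ₜ c ⟧ ≋ f ⊕ g ⊕ h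
  combine {a} {b} {c} p r t = ≋-trans (⟦⊞ₜ⟧ (a ⊞ₜ b) c) (+-cong (≋-trans (⟦⊞ₜ⟧ a b) (+-cong p r)) t)

⟦mulS′⟧ : ∀ t → ⟦ mulS′ t ⟧ ≋ s′ ⊛ ⟦ t ⟧
⟦mulS′⟧ t = ≋-trans
  (combine {mulS (mulS t)} {c₁ ⊠ₜ mulS t} {c₀ ⊠ₜ t} (≋-trans (⟦⊙⟧ s-poly (mulS t)) (*-congˡ (⟦⊙⟧ s-poly t)))
    (≋-trans (⟦⊠ₜ⟧ c₁ (mulS t)) (*-congˡ (⟦⊙⟧ s-poly t))) (⟦⊠ₜ⟧ c₀ t))
  (solve 4 (λ s a b t → s :* (s :* t) :+ a :* (s :* t) :+ b :* t := (s :* s :+ a :* s :+ b) :* t) ≋-refl s (eval c₁ y) (eval c₀ y) ⟦ t ⟧)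
  where
  c₀ c₁ : List ℤ
  c₀ = + 3 ∷ + 18 ∷ []
  c₁ = -[1+ 2 ] ∷ -[1+ 35 ] ∷ []

⟦mulX⟧ : ∀ t → ⟦ mulX t ⟧ ≋ X ⊛ ⟦ t ⟧
⟦mulX⟧ t = ≋-trans (⟦⊙⟧ X-poly t) (*-congʳ (≋-trans
  (solve 1 (λ w → con 1ℤ :+ w :* (con (+ 9) :+ w :* (con (+ 27) :+ w :* (con (+ 27) :+ w :* con 0ℤ))) :=
     con 1ℤ :+ (w :+ con (+ 3) :* (w :* w) :+ con (+ 3) :* (w :* w :* w)) :* (con (+ 9) :+ (w :+ con (+ 3) :* (w :* w) :+ con (+ 3) :* (w :* w :* w)) :* con 0ℤ)) ≋-refl w)
  (+-congˡ (*-cong (≋-sym x-w) (+-congˡ (*-congʳ (≋-sym x-w)))))))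

⟦mulX′⟧ : ∀ t → ⟦ mulX′ t ⟧ ≋ X′ ⊛ ⟦ t ⟧
⟦mulX′⟧ t = ≋-trans
  (combine {mulX (mulX t)} {homothety (+ 9) t₁ ⊠ₜ mulX t} {homothety (+ 9) t₂ ⊠ₜ t} (≋-trans (⟦mulX⟧ (mulX t)) (*-congˡ (⟦mulX⟧ t)))
    (≋-trans (⟦⊠ₜ⟧ (homothety (+ 9) t₁) (mulX t)) (*-cong (eval-homothety (+ 9) t₁ y) (⟦mulX⟧ t)))
    (≋-trans (⟦⊠ₜ⟧ (homothety (+ 9) t₂) t) (*-congʳ (eval-homothety (+ 9) t₂ y))))
  (solve 4 (λ s a b t → s :* (s :* t) :+ a :* (s :* t) :+ b :* t := (s :* s :+ a :* s :+ b) :* t) ≋-refl X (eval t₁ 9y) (eval t₂ 9y) ⟦ t ⟧)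

-- `s′` comes from the characteristic polynomial T³ - (3 + 36y)T² + (3 + 18y)T - (1 + 9y) of s; the
-- identity is checked by computation in the basis 1, w, w².
s-s′ : s ⊛ s′ ≋ N
s-s′ = ≋-trans (≋-sym (≋-trans (⟦⊙⟧ s-poly (mulS′ oneₜ)) (*-congˡ (≋-trans (⟦mulS′⟧ oneₜ) (≋-trans (*-congˡ ⟦oneₜ⟧) (*-identityʳ s′))))))
  (≋-trans (trimₜ≡⇒≋ (mulS (mulS′ oneₜ)) ⟨ 1ℤ ∷ + 9 ∷ [] , [] , [] ⟩ refl) (⟦scalar⟧ (1ℤ ∷ + 9 ∷ [])))

-- As X = s³, its norm is N³. `X′` is written through X and 9y instead of s′, so that multiplication
-- by it can be followed within lattices of polynomials in x.
X-X′ : X ⊛ X′ ≋ N ↑ 3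
X-X′ = ≋-trans (≋-sym (≋-trans (⟦mulX⟧ (mulX′ oneₜ)) (*-congˡ (≋-trans (⟦mulX′⟧ oneₜ) (≋-trans (*-congˡ ⟦oneₜ⟧) (*-identityʳ X′))))))
  (≋-trans (trimₜ≡⇒≋ (mulX (mulX′ oneₜ)) ⟨ 1ℤ ∷ + 27 ∷ + 243 ∷ + 729 ∷ [] , [] , [] ⟩ refl)
    (≋-trans (⟦scalar⟧ (1ℤ ∷ + 27 ∷ + 243 ∷ + 729 ∷ []))
      (solve 1 (λ y → let n = con 1ℤ :+ y :* (con (+ 9) :+ y :* con 0ℤ) in
        con 1ℤ :+ y :* (con (+ 27) :+ y :* (con (+ 243) :+ y :* (con (+ 729) :+ y :* con 0ℤ))) := n :* (n :* (n :* con 1ℤ))) ≋-refl y)))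

3x 3y : Series
3x = const (+ 3) ⊛ ξ
3y = const (+ 3) ⊛ y

dilate-const⊛ : ∀ c f → dilate (const c ⊛ f) ≋ const c ⊛ dilate f
dilate-const⊛ c f = ≋-trans (dilate-⊛ (const c) f) (*-congʳ (dilate-const c))

-- The coefficients of the cubic equation of 3x over ℤ[3y].

z₁ z₂ z₃ : List ℤ
z₁ = 0ℤ ∷ + 57 ∷ + 360 ∷ + 576 ∷ []
z₂ = 0ℤ ∷ + 45 ∷ + 279 ∷ + 432 ∷ []
z₃ = 0ℤ ∷ + 9 ∷ + 54 ∷ + 81 ∷ []

private
  compare : ∀ s t {f g} → trimₜ s ≡ trimₜ t → ⟦ s ⟧ ≋ f → ⟦ t ⟧ ≋ g → f ≋ g
  compare s t e p r = ≋-trans (≋-sym p) (≋-trans (trimₜ≡⇒≋ s t e) r)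

  homothetic : ∀ p c n → ⟦ (c · homothety (+ 3) p) ⊠ₜ xPower n ⟧ ≋ const c ⊛ eval p 3y ⊛ ξ ↑ n
  homothetic p c n = ≋-trans (⟦⊠ₜ⟧ (c · homothety (+ 3) p) (xPower n))
    (*-cong (≋-trans (eval-· c (homothety (+ 3) p) y) (*-congˡ (eval-homothety (+ 3) p y))) (⟦xPower⟧ n))

  27x³ : ⟦ (+ 27 ∷ []) ⊠ₜ xPower 3 ⟧ ≋ const (+ 27) ⊛ ξ ↑ 3
  27x³ = ≋-trans (⟦⊠ₜ⟧ (+ 27 ∷ []) (xPower 3)) (*-cong (eval-[] (+ 27) y) (⟦xPower⟧ 3))

  x-cubic : const (+ 27) ⊛ ξ ↑ 3 ≋ const (+ 9) ⊛ eval z₁ 3y ⊛ ξ ↑ 2 ⊕ const (+ 3) ⊛ eval z₂ 3y ⊛ ξ ↑ 1 ⊕ const 1ℤ ⊛ eval z₃ 3y ⊛ ξ ↑ 0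
  x-cubic = compare ((+ 27 ∷ []) ⊠ₜ xPower 3) (a ⊞ₜ b ⊞ₜ c) refl 27x³
    (combine {a} {b} {c} (homothetic z₁ (+ 9) 2) (homothetic z₂ (+ 3) 1) (homothetic z₃ 1ℤ 0))
    where
    a b c : Triple
    a = (+ 9 · homothety (+ 3) z₁) ⊠ₜ xPower 2
    b = (+ 3 · homothety (+ 3) z₂) ⊠ₜ xPower 1
    c = (1ℤ · homothety (+ 3) z₃) ⊠ₜ xPower 0

3x-cubic : 3x ⊛ (3x ⊛ 3x) ≋ eval z₁ 3y ⊛ (3x ⊛ 3x) ⊕ eval z₂ 3y ⊛ 3x ⊕ eval z₃ 3y
3x-cubic = ≋-trans
  (solve 1 (λ ξ → let z = con (+ 3) :* ξ in z :* (z :* z) := con (+ 27) :* (ξ :* (ξ :* (ξ :* con 1ℤ)))) ≋-refl ξ)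
  (≋-trans x-cubic
    (solve 4 (λ a b c ξ → con (+ 9) :* a :* (ξ :* (ξ :* con 1ℤ)) :+ con (+ 3) :* b :* (ξ :* con 1ℤ) :+ con 1ℤ :* c :* con 1ℤ :=
          a :* (con (+ 3) :* ξ :* (con (+ 3) :* ξ)) :+ b :* (con (+ 3) :* ξ) :+ c) ≋-refl (eval z₁ 3y) (eval z₂ 3y) (eval z₃ 3y) ξ))

-- Submodules of ℤ[x] over ℤ[z]

record IsSubmodule (z : Series) (M : Series → Set) : Set where
  field
    resp    : ∀ {f g} → f ≋ g → M f → M g
    ⊕-mem   : ∀ {f g} → M f → M g → M (f ⊕ g)
    const-mem : ∀ c {f} → M f → M (const c ⊛ f)
    z-mem   : ∀ {f} → M f → M (z ⊛ f)

  eval-mem : ∀ p {f} → M f → M (eval p z ⊛ f)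
  eval-mem []       {f} m = const-mem 0ℤ m
  eval-mem (c ∷ cs) {f} m = resp (≋-sym (≋-trans (distribʳ f (const c) (z ⊛ eval cs z)) (+-congˡ (*-assoc z (eval cs z) f))))
    (⊕-mem (const-mem c m) (z-mem (eval-mem cs m)))

open IsSubmodule

multiples : Series → (Series → Set) → Series → Set
multiples a M f = ∃ λ m → M m × f ≋ a ⊛ m

multiples-isSubmodule : ∀ a {z M} → IsSubmodule z M → IsSubmodule z (multiples a M)
multiples-isSubmodule a {z} S = record
  { resp = λ { p (m , M , e) → m , M , ≋-trans (≋-sym p) e }
  ; ⊕-mem = λ { (m , M , e) (m′ , M′ , e′) → m ⊕ m′ , ⊕-mem S M M′ , ≋-trans (+-cong e e′) (≋-sym (distribˡ a m m′)) }
  ; const-mem = λ { c (m , M , e) → const c ⊛ m , const-mem S c M ,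
      ≋-trans (*-congˡ e) (solve 3 (λ c a m → c :* (a :* m) := a :* (c :* m)) ≋-refl (const c) a m) }
  ; z-mem = λ { (m , M , e) → z ⊛ m , z-mem S M , ≋-trans (*-congˡ e) (solve 3 (λ c a m → c :* (a :* m) := a :* (c :* m)) ≋-refl z a m) }
  }

-- Filtered k: the coefficient of xⁱ is divisible by 3^(i-k) for i > k.

weigh : ℕ → List ℤ → List ℤ
weigh zero    cs       = homothety (+ 3) cs
weigh (suc k) []       = []
weigh (suc k) (c ∷ cs) = c ∷ weigh k cs

Filtered : ℕ → Series → Set
Filtered k f = ∃ λ cs → f ≋ eval (weigh k cs) ξ

Filtered-const : ∀ k c → Filtered k (const c)
Filtered-const zero    c = c ∷ [] , ≋-sym (eval-[] c ξ)
Filtered-const (suc k) c = c ∷ proj₁ (Filtered-const k 0ℤ) ,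
  ≋-sym (≋-trans (+-congˡ (*-congˡ (≋-sym (proj₂ (Filtered-const k 0ℤ))))) (≋-trans (+-congˡ (zeroʳ ξ)) (+-identityʳ (const c))))

Filtered-cons : ∀ k c {f} → Filtered k f → Filtered (suc k) (const c ⊕ ξ ⊛ f)
Filtered-cons k c (cs , p) = c ∷ cs , +-congˡ (*-congˡ p)

Filtered-resp : ∀ k {f g} → f ≋ g → Filtered k f → Filtered k g
Filtered-resp k p (cs , e) = cs , ≋-trans (≋-sym p) e

Filtered-⊕ : ∀ k as bs → Filtered k (eval (weigh k as) ξ ⊕ eval (weigh k bs) ξ)
Filtered-⊕ zero as bs = as ⊞ bs , ≋-sym (≋-trans (eval-homothety (+ 3) (as ⊞ bs) ξ)
  (≋-trans (eval-⊞ as bs 3x) (≋-sym (+-cong (eval-homothety (+ 3) as ξ) (eval-homothety (+ 3) bs ξ)))))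
Filtered-⊕ (suc k) []       bs       = bs , +-identityˡ _
Filtered-⊕ (suc k) (a ∷ as) []       = a ∷ as , +-identityʳ _
Filtered-⊕ (suc k) (a ∷ as) (b ∷ bs) = Filtered-resp (suc k)
  (≋-trans (+-congʳ (ι-+ a b)) (solve 5 (λ a b ξ s t → a :+ b :+ ξ :* (s :+ t) := a :+ ξ :* s :+ (b :+ ξ :* t)) ≋-refl
    (const a) (const b) ξ (eval (weigh k as) ξ) (eval (weigh k bs) ξ)))
  (Filtered-cons k (a ℤ.+ b) (Filtered-⊕ k as bs))

Filtered-const⊛ : ∀ k c as → Filtered k (const c ⊛ eval (weigh k as) ξ)
Filtered-const⊛ zero c as = c · as , ≋-sym (≋-trans (eval-homothety (+ 3) (c · as) ξ)
  (≋-trans (eval-· c as 3x) (*-congˡ (≋-sym (eval-homothety (+ 3) as ξ)))))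
Filtered-const⊛ (suc k) c []       = [] , zeroʳ _
Filtered-const⊛ (suc k) c (a ∷ as) = Filtered-resp (suc k)
  (≋-trans (+-congʳ (ι-* c a)) (solve 4 (λ c a ξ s → c :* a :+ ξ :* (c :* s) := c :* (a :+ ξ :* s)) ≋-refl (const c) (const a) ξ (eval (weigh k as) ξ)))
  (Filtered-cons k (c ℤ.* a) (Filtered-const⊛ k c as))

-- Each coefficient moves up by one degree and gains the factor 3 that the weight asks for. The
-- recursion is 3x(a + ξs) = ξ(3a + 3xs).
Filtered-3x⊛ : ∀ k as → Filtered k (3x ⊛ eval (weigh k as) ξ)
Filtered-3x⊛ zero as = 0ℤ ∷ as , ≋-sym (≋-trans (eval-homothety (+ 3) (0ℤ ∷ as) ξ)
  (≋-trans (eval-shift as 3x) (*-congˡ (≋-sym (eval-homothety (+ 3) as ξ)))))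
Filtered-3x⊛ (suc k) []       = [] , zeroʳ _
Filtered-3x⊛ (suc k) (a ∷ as) with Filtered-const k (+ 3 ℤ.* a) | Filtered-3x⊛ k as
... | bs , p | cs , r = Filtered-resp (suc k)
  (≋-trans (+-congˡ (*-congˡ (+-cong (≋-trans (≋-sym p) (ι-* (+ 3) a)) (≋-sym r))))
    (solve 3 (λ a ξ s → con 0ℤ :+ ξ :* (con (+ 3) :* a :+ con (+ 3) :* ξ :* s) := con (+ 3) :* ξ :* (a :+ ξ :* s)) ≋-refl (const a) ξ (eval (weigh k as) ξ)))
  (Filtered-cons k 0ℤ (Filtered-⊕ k bs cs))

Filtered-isSubmodule : ∀ k → IsSubmodule 3x (Filtered k)
Filtered-isSubmodule k = record
  { resp = Filtered-resp k
  ; ⊕-mem = λ { (as , p) (bs , r) → Filtered-resp k (≋-sym (+-cong p r)) (Filtered-⊕ k as bs) }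
  ; const-mem = λ { c (as , p) → Filtered-resp k (≋-sym (*-congˡ p)) (Filtered-const⊛ k c as) }
  ; z-mem = λ { (as , p) → Filtered-resp k (≋-sym (*-congˡ p)) (Filtered-3x⊛ k as) }
  }

9x : Series
9x = const (+ 9) ⊛ ξ

triple-mem : ∀ {M} → IsSubmodule 3x M → IsSubmodule 9x M
triple-mem S = record
  { resp = resp S
  ; ⊕-mem = ⊕-mem S
  ; const-mem = const-mem S
  ; z-mem = λ {f} m → resp S (solve 2 (λ ξ f → con (+ 3) :* (con (+ 3) :* ξ :* f) := con (+ 9) :* ξ :* f) ≋-refl ξ f) (const-mem S (+ 3) (z-mem S m))
  }

-- Operators f ↦ U₃ (b f)

module Operator (b : Series) where

  V : Series → Series
  V f = U₃ (b ⊛ f)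

  V-cong : ∀ {f g} → f ≋ g → V f ≋ V g
  V-cong p = U₃-cong (*-congˡ p)

  V-⊕ : ∀ f g → V (f ⊕ g) ≋ V f ⊕ V g
  V-⊕ f g = ≋-trans (U₃-cong (distribˡ b f g)) (U₃-⊕ _ _)

  V-dilate : ∀ a f → V (dilate a ⊛ f) ≋ a ⊛ V f
  V-dilate a f = ≋-trans (U₃-cong (solve 3 (λ b a f → b :* (a :* f) := a :* (b :* f)) ≋-refl b (dilate a) f)) (U₃-dilate a (b ⊛ f))

  V-const : ∀ c f → V (const c ⊛ f) ≋ const c ⊛ V f
  V-const c f = ≋-trans (V-cong (*-congʳ (≋-sym (dilate-const c)))) (V-dilate (const c) f)

  V-eval : ∀ p c f → V (eval p (const c ⊛ y) ⊛ f) ≋ eval p (const c ⊛ ξ) ⊛ V f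
  V-eval p c f = ≋-trans (V-cong (*-congʳ (≋-sym (≋-trans (dilate-eval p (const c ⊛ ξ)) (eval-cong p (dilate-const⊛ c ξ)))))) (V-dilate _ f)

  -- ℤ[3x] is generated by 1, 3x, (3x)² over ℤ[3y].

  V-polynomial : ∀ {M} → IsSubmodule 3x M → ∀ p {f} → M (V f) → M (V (3x ⊛ f)) → M (V (3x ⊛ (3x ⊛ f))) → M (V (eval p 3x ⊛ f))
  V-polynomial S []       {f} m₀ m₁ m₂ = resp S (≋-sym (V-const 0ℤ f)) (const-mem S 0ℤ m₀)
  V-polynomial S (c ∷ cs) {f} m₀ m₁ m₂ = resp S
    (≋-sym (≋-trans (V-cong (≋-trans (distribʳ f (const c) _) (+-congˡ (solve 3 (λ z e f → z :* e :* f := e :* (z :* f)) ≋-refl 3x (eval cs 3x) f))))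
      (≋-trans (V-⊕ _ _) (+-congʳ (V-const c f)))))
    (⊕-mem S (const-mem S c m₀) (V-polynomial S cs m₁ m₂ m₃))
    where
    m₃ = resp S
      (≋-sym (≋-trans (V-cong (≋-trans (solve 2 (λ z f → z :* (z :* (z :* f)) := z :* (z :* z) :* f) ≋-refl 3x f) (≋-trans (*-congʳ 3x-cubic)
          (solve 5 (λ a b c z f → (a :* (z :* z) :+ b :* z :+ c) :* f := a :* (z :* (z :* f)) :+ b :* (z :* f) :+ c :* f) ≋-refl
            (eval z₁ 3y) (eval z₂ 3y) (eval z₃ 3y) 3x f))))
        (≋-trans (V-⊕ _ _) (+-cong (≋-trans (V-⊕ _ _) (+-cong (V-eval z₁ (+ 3) _) (V-eval z₂ (+ 3) _))) (V-eval z₃ (+ 3) f)))))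
      (⊕-mem S (⊕-mem S (eval-mem S z₁ m₂) (eval-mem S z₂ m₁)) (eval-mem S z₃ m₀))

  -- `Filtered k` is spanned by 1, x, ..., x^(k-1) and x^k ℤ[3x]. The recursion moves one power of x
  -- at a time into `f`.
  V-filtered : ∀ {z M} → IsSubmodule z M → ∀ k f → (∀ {i} → i < k → M (V (ξ ↑ i ⊛ f))) → (∀ p → M (V (eval p 3x ⊛ (ξ ↑ k ⊛ f)))) →
               ∀ {h} → Filtered k h → M (V (h ⊛ f))
  V-filtered S zero f low high (cs , p) = resp S
    (V-cong (≋-trans (*-congˡ (*-identityˡ f)) (*-congʳ (≋-sym (≋-trans p (eval-homothety (+ 3) cs ξ)))))) (high cs)
  V-filtered S (suc k) f low high ([] , p) = resp S (≋-sym (≋-trans (V-cong (*-congʳ p)) (V-const 0ℤ f)))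
    (const-mem S 0ℤ (resp S (V-cong (*-identityˡ f)) (low (s≤s z≤n))))
  V-filtered S (suc k) f low high (c ∷ cs , p) = resp S
    (≋-sym (≋-trans (V-cong (≋-trans (*-congʳ p) (solve 4 (λ c ξ e f → (c :+ ξ :* e) :* f := c :* f :+ e :* (ξ :* f)) ≋-refl (const c) ξ (eval (weigh k cs) ξ) f)))
      (≋-trans (V-⊕ _ _) (+-congʳ (V-const c f)))))
    (⊕-mem S (const-mem S c (resp S (V-cong (*-identityˡ f)) (low (s≤s z≤n))))
      (V-filtered S k (ξ ⊛ f) (λ {i} i<k → resp S (V-cong (shift i)) (low (s≤s i<k))) (λ p → resp S (V-cong (*-congˡ (shift k))) (high p)) (cs , ≋-refl)))
    where
    shift : ∀ i → ξ ↑ suc i ⊛ f ≋ ξ ↑ i ⊛ (ξ ⊛ f)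
    shift i = solve 3 (λ ξ p f → ξ :* p :* f := p :* (ξ :* f)) ≋-refl ξ (ξ ↑ i) f

  -- X′ is a polynomial in X of degree 2 over ℤ[9y].

  V-conjugate : ∀ {Src Tgt} → IsSubmodule 9x Src → IsSubmodule 9x Tgt → (∀ {f} → Src f → Tgt (V f)) →
                ∀ k {f} → Src f → Tgt (V (X′ ↑ k ⊛ f))
  V-conjugate S T base zero    {f} m = resp T (V-cong (≋-sym (*-identityˡ f))) (base m)
  V-conjugate {Src} S T base (suc k) {f} m = resp T
    (≋-sym (≋-trans (V-cong (solve 5 (λ X a b p f → (X :* X :+ a :* X :+ b) :* p :* f := p :* (X :* (X :* f)) :+ a :* (p :* (X :* f)) :+ b :* (p :* f)) ≋-refl
        X (eval t₁ 9y) (eval t₂ 9y) (X′ ↑ k) f))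
      (≋-trans (V-⊕ _ _) (+-cong (≋-trans (V-⊕ _ _) (+-congˡ (V-eval t₁ (+ 9) _))) (V-eval t₂ (+ 9) _)))))
    (⊕-mem T (⊕-mem T (V-conjugate S T base k (X-mem (X-mem m))) (eval-mem T t₁ (V-conjugate S T base k (X-mem m)))) (eval-mem T t₂ (V-conjugate S T base k m)))
    where
    X-mem : ∀ {f} → Src f → Src (X ⊛ f)
    X-mem {f} m = resp S (solve 2 (λ ξ f → f :+ con (+ 9) :* ξ :* f := (con 1ℤ :+ ξ :* (con (+ 9) :+ ξ :* con 0ℤ)) :* f) ≋-refl ξ f) (⊕-mem S m (z-mem S m))

open IsSubmodule

-- The two lattices

-- U₃ ξ ≡ ξ modulo 3, so U₃ cannot gain a factor 9 on all polynomials in ξ: modulo 9, Odd consists of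
-- the multiples of a single γ. Up to a unit, γ is the reduction modulo 9 of L 1 / 3.

γ-poly b-poly : List ℤ
γ-poly = 0ℤ ∷ 1ℤ ∷ + 7 ∷ 1ℤ ∷ []
b-poly = 0ℤ ∷ 1ℤ ∷ + 8 ∷ + 24 ∷ + 32 ∷ + 16 ∷ []

γ : Series
γ = eval γ-poly ξ

Even Ninth : Series → Set
Even  = multiples ξ (Filtered 2)
Ninth = multiples (const (+ 9)) (multiples ξ (Filtered 4))

Odd : Series → Set
Odd f = ∃₂ λ c m → Ninth m × f ≋ const c ⊛ γ ⊕ m

Even-isSubmodule : IsSubmodule 3x Even
Even-isSubmodule = multiples-isSubmodule ξ (Filtered-isSubmodule 2)

Ninth-isSubmodule : IsSubmodule 3x Ninth
Ninth-isSubmodule = multiples-isSubmodule (const (+ 9)) (multiples-isSubmodule ξ (Filtered-isSubmodule 4))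

-- `γ` has degree 3 and so lies in `Filtered 4`. The factor 9 of `Ninth` comes from 9x; 3xγ would
-- not lie in `Odd`, which is why `t₁` and `t₂` are taken at 9y.
9xγ : Ninth (9x ⊛ γ)
9xγ = ξ ⊛ γ , (γ , (γ-poly , ≋-refl) , ≋-refl) , *-assoc (const (+ 9)) ξ γ

Odd-isSubmodule : IsSubmodule 9x Odd
Odd-isSubmodule = record
  { resp = λ { p (c , m , M , e) → c , m , M , ≋-trans (≋-sym p) e }
  ; ⊕-mem = λ { (c , m , M , e) (c′ , m′ , M′ , e′) → c ℤ.+ c′ , m ⊕ m′ , ⊕-mem Ninth-isSubmodule M M′ ,
      ≋-trans (+-cong e e′) (≋-sym (≋-trans (+-congʳ (*-congʳ (ι-+ c c′)))
        (solve 5 (λ c c′ g m m′ → (c :+ c′) :* g :+ (m :+ m′) := c :* g :+ m :+ (c′ :* g :+ m′)) ≋-refl (const c) (const c′) γ m m′))) }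
  ; const-mem = λ { a (c , m , M , e) → a ℤ.* c , const a ⊛ m , const-mem Ninth-isSubmodule a M ,
      ≋-trans (*-congˡ e) (≋-sym (≋-trans (+-congʳ (*-congʳ (ι-* a c)))
        (solve 4 (λ a c g m → a :* c :* g :+ a :* m := a :* (c :* g :+ m)) ≋-refl (const a) (const c) γ m))) }
  ; z-mem = λ { (c , m , M , e) → 0ℤ , const c ⊛ (9x ⊛ γ) ⊕ 9x ⊛ m ,
      ⊕-mem Ninth-isSubmodule (const-mem Ninth-isSubmodule c 9xγ) (z-mem (triple-mem Ninth-isSubmodule) M) ,
      ≋-trans (*-congˡ e) (solve 4 (λ z c g m → z :* (c :* g :+ m) := con 0ℤ :* g :+ (c :* (z :* g) :+ z :* m)) ≋-refl 9x (const c) γ m) }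
  }

Ninth⇒Odd : ∀ {m} → Ninth m → Odd m
Ninth⇒Odd {m} M = 0ℤ , m , M , solve 2 (λ g m → m := con 0ℤ :* g :+ m) ≋-refl γ m

-- Membership of explicit polynomials

-- quotients d divides by d + 1, exactly wherever it is used.

quotients : ℕ → List ℤ → List ℤ
quotients d []       = []
quotients d (a ∷ as) = (a ℤ./ℕ suc d) ∷ quotients d as

-- The recursion runs on the divided tail, which is not structurally smaller; the length of the list
-- is enough fuel.
unhomothety : ℕ → List ℤ → List ℤ
unhomothety zero      as       = []
unhomothety (suc fuel) []       = []
unhomothety (suc fuel) (a ∷ as) = a ∷ unhomothety fuel (quotients 2 as)

unweigh : ℕ → List ℤ → List ℤ
unweigh zero    cs       = unhomothety (length cs) cs
unweigh (suc k) []       = []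
unweigh (suc k) (c ∷ cs) = c ∷ unweigh k cs

-- The constant term is dropped, the weights are divided out and multiplied back. Equality with the
-- input certifies that the constant term was 0 and the divisions were exact.
evenPart oddPart : List ℤ → List ℤ
evenPart as = 0ℤ ∷ weigh 2 (unweigh 2 (drop 1 as))
oddPart  as = 0ℤ ∷ weigh 4 (unweigh 4 (drop 1 as))

Even-check : ∀ as → as ≐ evenPart as → Even (eval as ξ)
Even-check as p = _ , (unweigh 2 (drop 1 as) , ≋-refl) , ≋-trans (≐⇒≋ as (evenPart as) ξ p) (eval-shift (weigh 2 (unweigh 2 (drop 1 as))) ξ)

ninthPart : List ℤ → List ℤ
ninthPart as = + 9 · oddPart (quotients 8 as)

Ninth-check : ∀ as → as ≐ ninthPart as → Ninth (eval as ξ)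
Ninth-check as p = _ , (_ , (unweigh 4 (drop 1 (quotients 8 as)) , ≋-refl) , ≋-refl) ,
  ≋-trans (≐⇒≋ as (ninthPart as) ξ p) (≋-trans (eval-· (+ 9) (oddPart (quotients 8 as)) ξ) (*-congˡ (eval-shift (weigh 4 (unweigh 4 (drop 1 (quotients 8 as)))) ξ)))

-- `γ` begins with ξ, so `c` is always taken to be the linear coefficient of `as`.
Odd-check : ∀ c as → as ⊞ (ℤ.- c) · γ-poly ≐ ninthPart (as ⊞ (ℤ.- c) · γ-poly) → Odd (eval as ξ)
Odd-check c as p = c , _ , Ninth-check (as ⊞ (ℤ.- c) · γ-poly) p , ≋-sym (≋-trans
  (+-congˡ (≋-trans (eval-⊞ as ((ℤ.- c) · γ-poly) ξ) (+-congˡ (≋-trans (eval-· (ℤ.- c) γ-poly ξ) (*-congʳ (ι-neg c))))))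
  (solve 3 (λ c g a → c :* g :+ (a :+ :- c :* g) := a) ≋-refl (const c) γ (eval as ξ)))

-- From odd to even index

U₃-image : ℕ → List ℤ
U₃-image m = Uₜ (xPower m)

module OddStep = Operator one

U₃-xPower : ∀ m → OddStep.V (ξ ↑ m) ≋ eval (U₃-image m) ξ
U₃-xPower m = ≋-trans (U₃-cong (≋-trans (*-identityˡ _) (≋-sym (⟦xPower⟧ m)))) (U₃-⟦⟧ (xPower m))

scaledPower : ∀ {V : Series → Series} {M} → IsSubmodule 3x M → (∀ {f g} → f ≋ g → V f ≋ V g) → (∀ c f → V (const c ⊛ f) ≋ const c ⊛ V f) →
  ∀ c m as → V (ξ ↑ m) ≋ eval as ξ → M (eval (c · as) ξ) → ∀ {f} → f ≋ const c ⊛ ξ ↑ m → M (V f)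
scaledPower S cong′ const′ c m as p M r = resp S (≋-sym (≋-trans (cong′ r) (≋-trans (const′ c (ξ ↑ m)) (≋-trans (*-congˡ p) (≋-sym (eval-· c as ξ)))))) M

U₃-member : ∀ c m → Even (eval (c · U₃-image m) ξ) → ∀ {f} → f ≋ const c ⊛ ξ ↑ m → Even (OddStep.V f)
U₃-member c m = scaledPower Even-isSubmodule OddStep.V-cong OddStep.V-const c m (U₃-image m) (U₃-xPower m)

-- Seven explicit images suffice: those of ξ, ..., ξ⁴ for the low part, and of ξ⁵, 3ξ⁶, 9ξ⁷, which
-- generate ξ⁵ℤ[3x] over ℤ[3y].
U₃-Filtered : ∀ {h} → Filtered 4 h → Even (OddStep.V (h ⊛ ξ))
U₃-Filtered = OddStep.V-filtered Even-isSubmodule 4 ξ low (λ p → OddStep.V-polynomial Even-isSubmodule p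
    (U₃-member 1ℤ 5 (Even-check (1ℤ · U₃-image 5) tt) (solve 1 (λ x → pow 4 x :* x := con 1ℤ :* pow 5 x) ≋-refl ξ))
    (U₃-member (+ 3) 6 (Even-check (+ 3 · U₃-image 6) tt) (solve 1 (λ x → con (+ 3) :* x :* (pow 4 x :* x) := con (+ 3) :* pow 6 x) ≋-refl ξ))
    (U₃-member (+ 9) 7 (Even-check (+ 9 · U₃-image 7) tt) (solve 1 (λ x → con (+ 3) :* x :* (con (+ 3) :* x :* (pow 4 x :* x)) := con (+ 9) :* pow 7 x) ≋-refl ξ)))
  where
  low : ∀ {i} → i < 4 → Even (OddStep.V (ξ ↑ i ⊛ ξ))
  low {0} _ = U₃-member 1ℤ 1 (Even-check (1ℤ · U₃-image 1) tt) (solve 1 (λ x → pow 0 x :* x := con 1ℤ :* pow 1 x) ≋-refl ξ)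
  low {1} _ = U₃-member 1ℤ 2 (Even-check (1ℤ · U₃-image 2) tt) (solve 1 (λ x → pow 1 x :* x := con 1ℤ :* pow 2 x) ≋-refl ξ)
  low {2} _ = U₃-member 1ℤ 3 (Even-check (1ℤ · U₃-image 3) tt) (solve 1 (λ x → pow 2 x :* x := con 1ℤ :* pow 3 x) ≋-refl ξ)
  low {3} _ = U₃-member 1ℤ 4 (Even-check (1ℤ · U₃-image 4) tt) (solve 1 (λ x → pow 3 x :* x := con 1ℤ :* pow 4 x) ≋-refl ξ)
  low {suc (suc (suc (suc _)))} (s≤s (s≤s (s≤s (s≤s ()))))

9Even : Series → Set
9Even = multiples (const (+ 9)) Even

γ-image : List ℤ
γ-image = U₃-image 1 ⊞ + 7 · U₃-image 2 ⊞ U₃-image 3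

-- Divisibility by 9 holds only for the combination: the linear coefficients of the images of ξ, ξ²,
-- ξ³ are 19, 10, 1, and 19 + 7·10 + 1 = 90.
U₃-γ : 9Even (OddStep.V γ)
U₃-γ = eval (quotients 8 γ-image) ξ , Even-check (quotients 8 γ-image) tt , (begin
  OddStep.V γ
    ≈⟨ OddStep.V-cong (solve 1 (λ x → con 0ℤ :+ x :* (con 1ℤ :+ x :* (con (+ 7) :+ x :* (con 1ℤ :+ x :* con 0ℤ))) := pow 1 x :+ con (+ 7) :* pow 2 x :+ pow 3 x) ≋-refl ξ) ⟩
  OddStep.V (ξ ↑ 1 ⊕ const (+ 7) ⊛ ξ ↑ 2 ⊕ ξ ↑ 3)
    ≈⟨ ≋-trans (OddStep.V-⊕ _ _) (+-congʳ (≋-trans (OddStep.V-⊕ _ _) (+-congˡ (OddStep.V-const (+ 7) (ξ ↑ 2))))) ⟩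
  OddStep.V (ξ ↑ 1) ⊕ const (+ 7) ⊛ OddStep.V (ξ ↑ 2) ⊕ OddStep.V (ξ ↑ 3)
    ≈⟨ +-cong (+-cong (U₃-xPower 1) (≋-trans (*-congˡ (U₃-xPower 2)) (≋-sym (eval-· (+ 7) (U₃-image 2) ξ)))) (U₃-xPower 3) ⟩
  eval (U₃-image 1) ξ ⊕ eval (+ 7 · U₃-image 2) ξ ⊕ eval (U₃-image 3) ξ
    ≈⟨ ≋-sym (≋-trans (eval-⊞ (U₃-image 1 ⊞ + 7 · U₃-image 2) (U₃-image 3) ξ) (+-congʳ (eval-⊞ (U₃-image 1) (+ 7 · U₃-image 2) ξ))) ⟩
  eval γ-image ξ
    ≈⟨ ≐⇒≋ γ-image (+ 9 · quotients 8 γ-image) ξ tt ⟩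
  eval (+ 9 · quotients 8 γ-image) ξ
    ≈⟨ eval-· (+ 9) (quotients 8 γ-image) ξ ⟩
  const (+ 9) ⊛ eval (quotients 8 γ-image) ξ ∎)
  where open ≋-Reasoning

9Even-isSubmodule : IsSubmodule 3x 9Even
9Even-isSubmodule = multiples-isSubmodule (const (+ 9)) Even-isSubmodule

-- The factor 9 has two sources: `U₃-γ` for the multiple of γ, and the 9 already present in `Ninth`,
-- which U₃ keeps. After L 1 the power of 3 grows only here.
U₃-Odd : ∀ {f} → Odd f → 9Even (OddStep.V f)
U₃-Odd (c , m , (n , (h , F , e₃) , e₂) , e₁) = resp 9Even-isSubmodule
  (≋-sym (≋-trans (OddStep.V-cong (≋-trans e₁ (+-congˡ (≋-trans e₂ (*-congˡ (≋-trans e₃ (*-comm ξ h)))))))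
    (≋-trans (OddStep.V-⊕ _ _) (+-cong (OddStep.V-const c γ) (OddStep.V-const (+ 9) (h ⊛ ξ))))))
  (⊕-mem 9Even-isSubmodule (const-mem 9Even-isSubmodule c U₃-γ) (_ , U₃-Filtered F , ≋-refl))

-- From even to odd index

b : Series
b = eval b-poly w ⊛ s′

module EvenStep = Operator b

V-image : ℕ → List ℤ
V-image m = Uₜ (b-poly ⊙ mulS′ (xPower m))

V-xPower : ∀ m → EvenStep.V (ξ ↑ m) ≋ eval (V-image m) ξ
V-xPower m = ≋-trans (U₃-cong (≋-trans (*-assoc _ _ _) (≋-sym (≋-trans (⟦⊙⟧ b-poly (mulS′ (xPower m)))
  (*-congˡ (≋-trans (⟦mulS′⟧ (xPower m)) (*-congˡ (⟦xPower⟧ m)))))))) (U₃-⟦⟧ (b-poly ⊙ mulS′ (xPower m)))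

V-member : ∀ c m → Ninth (eval (c · V-image m) ξ) → ∀ {f} → f ≋ const c ⊛ ξ ↑ m → Ninth (EvenStep.V f)
V-member c m = scaledPower Ninth-isSubmodule EvenStep.V-cong EvenStep.V-const c m (V-image m) (V-xPower m)

-- Only ξ and ξ² have images that involve γ. The part generated by ξ³, 3ξ⁴, 9ξ⁵ lands in `Ninth`,
-- which unlike `Odd` is stable under 3x, as `V-polynomial` requires.
V-Filtered : ∀ {h} → Filtered 2 h → Odd (EvenStep.V (h ⊛ ξ))
V-Filtered = EvenStep.V-filtered Odd-isSubmodule 2 ξ low (λ p → Ninth⇒Odd (EvenStep.V-polynomial Ninth-isSubmodule p
    (V-member 1ℤ 3 (Ninth-check (1ℤ · V-image 3) tt) (solve 1 (λ x → pow 2 x :* x := con 1ℤ :* pow 3 x) ≋-refl ξ))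
    (V-member (+ 3) 4 (Ninth-check (+ 3 · V-image 4) tt) (solve 1 (λ x → con (+ 3) :* x :* (pow 2 x :* x) := con (+ 3) :* pow 4 x) ≋-refl ξ))
    (V-member (+ 9) 5 (Ninth-check (+ 9 · V-image 5) tt) (solve 1 (λ x → con (+ 3) :* x :* (con (+ 3) :* x :* (pow 2 x :* x)) := con (+ 9) :* pow 5 x) ≋-refl ξ))))
  where
  low : ∀ {i} → i < 2 → Odd (EvenStep.V (ξ ↑ i ⊛ ξ))
  low {0} _ = resp Odd-isSubmodule (≋-sym (≋-trans (EvenStep.V-cong (solve 1 (λ x → pow 0 x :* x := pow 1 x) ≋-refl ξ)) (V-xPower 1))) (Odd-check (+ 12) (V-image 1) tt)
  low {1} _ = resp Odd-isSubmodule (≋-sym (≋-trans (EvenStep.V-cong (solve 1 (λ x → pow 1 x :* x := pow 2 x) ≋-refl ξ)) (V-xPower 2))) (Odd-check 1ℤ (V-image 2) tt)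
  low {suc (suc _)} (s≤s (s≤s ()))

V-Even : ∀ {f} → Even f → Odd (EvenStep.V f)
V-Even (h , F , e) = resp Odd-isSubmodule (≋-sym (EvenStep.V-cong (≋-trans e (*-comm ξ h)))) (V-Filtered F)

3Odd : Series → Set
3Odd = multiples (const (+ 3)) Odd

-- This series is (1 + 9x) L 1, as `form-one` shows; its linear coefficient is d₂(2) = 33, whence
-- the 11.
V-one : 3Odd (EvenStep.V one)
V-one = eval (quotients 2 (V-image 0)) ξ , Odd-check (+ 11) (quotients 2 (V-image 0)) tt ,
  ≋-trans (V-xPower 0) (≋-trans (≐⇒≋ (V-image 0) (+ 3 · quotients 2 (V-image 0)) ξ tt) (eval-· (+ 3) (quotients 2 (V-image 0)) ξ))

open IsSubmodule

-- The induction on α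

HasForm : (Series → Set) → ℕ → ℕ → ℕ → Set
HasForm M α k e = ∃ λ P → M P × X ↑ k ⊛ L α ≋ const (+ (3 ℕ.^ e)) ⊛ P

dilate-X : dilate X ≋ N
dilate-X = dilate-eval (1ℤ ∷ + 9 ∷ []) ξ

-- As N³ = X X′, the 3k factors 1 + 9y supply the k factors 1 + 9x in the denominator of L α; X′ᵏ is
-- left for `V-conjugate`.
dilate-X↑ : ∀ k → dilate (X ↑ (k ℕ.* 3)) ≋ X ↑ k ⊛ X′ ↑ k
dilate-X↑ k = ≋-trans (dilate-↑ X (k ℕ.* 3)) (≋-trans (↑-cong (k ℕ.* 3) dilate-X) (≋-trans (↑-* N k 3)
  (≋-trans (↑-cong k (≋-sym X-X′)) (*-↑ X X′ k))))

s-multiplier : s ⊛ multiplier ≋ eval b-poly w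
s-multiplier = ≋-trans (*-congʳ (solve 1 (λ w → con 1ℤ :+ w :* (con (+ 3) :+ w :* con 0ℤ) := con 1ℤ :+ con (+ 3) :* w) ≋-refl w))
  (≋-trans multiplier-w (solve 1 (λ w → let u = con 1ℤ :+ con (+ 2) :* w in w :* (u :* (u :* (u :* (u :* con 1ℤ)))) :=
    con 0ℤ :+ w :* (con 1ℤ :+ w :* (con (+ 8) :+ w :* (con (+ 24) :+ w :* (con (+ 32) :+ w :* (con (+ 16) :+ w :* con 0ℤ)))))) ≋-refl w))

-- The denominator s of the multiplier is completed to its norm N, which U₃ turns into the one
-- additional factor 1 + 9x of an even-to-odd step.
N-multiplier : N ⊛ multiplier ≋ b
N-multiplier = ≋-trans (*-congʳ (≋-sym s-s′)) (≋-trans (solve 3 (λ s t m → s :* t :* m := s :* m :* t) ≋-refl s s′ multiplier) (*-congʳ s-multiplier))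

const-3^ : ∀ d e → const (+ (3 ℕ.^ e)) ⊛ const (+ (3 ℕ.^ d)) ≋ const (+ (3 ℕ.^ (d ℕ.+ e)))
const-3^ d e = ≋-trans (≋-sym (ι-* (+ (3 ℕ.^ e)) (+ (3 ℕ.^ d)))) (≡⇒≋ (cong const (trans (sym (ℤ.pos-* (3 ℕ.^ e) (3 ℕ.^ d)))
  (cong +_ (trans (ℕ.*-comm (3 ℕ.^ e) (3 ℕ.^ d)) (sym (ℕ.^-distribˡ-+-* 3 d e)))))))

form-one : HasForm Odd 1 1 1
form-one = proj₁ V-one , proj₁ (proj₂ V-one) , (begin
  X ↑ 1 ⊛ L 1
    ≈⟨ *-cong (*-identityʳ X) L-one ⟩
  X ⊛ U₃ multiplier
    ≈⟨ ≋-sym (U₃-dilate X multiplier) ⟩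
  U₃ (dilate X ⊛ multiplier)
    ≈⟨ U₃-cong (≋-trans (*-congʳ dilate-X) (≋-trans N-multiplier (≋-sym (*-identityʳ b)))) ⟩
  EvenStep.V one
    ≈⟨ proj₂ (proj₂ V-one) ⟩
  const (+ 3) ⊛ proj₁ V-one ∎)
  where open ≋-Reasoning

form-even : ∀ {α k e} → parity α ≡ 1ℙ → parity (suc α) ≡ 0ℙ → HasForm Odd α k e → HasForm Even (suc α) (k ℕ.* 3) (2 ℕ.+ e)
form-even {α} {k} {e} p p′ (P , O , eq) = R , proj₁ (proj₂ image) , (begin
  X ↑ (k ℕ.* 3) ⊛ L (suc α)
    ≈⟨ *-congˡ (L-suc-odd {α} p p′) ⟩
  X ↑ (k ℕ.* 3) ⊛ U₃ (L α)
    ≈⟨ ≋-sym (U₃-dilate (X ↑ (k ℕ.* 3)) (L α)) ⟩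
  U₃ (dilate (X ↑ (k ℕ.* 3)) ⊛ L α)
    ≈⟨ U₃-cong (≋-trans (*-congʳ (dilate-X↑ k)) (≋-trans (solve 3 (λ a b l → a :* b :* l := con 1ℤ :* (b :* (a :* l))) ≋-refl (X ↑ k) (X′ ↑ k) (L α))
         (*-congˡ (≋-trans (*-congˡ eq) (solve 3 (λ a c p → a :* (c :* p) := c :* (a :* p)) ≋-refl (X′ ↑ k) (const (+ (3 ℕ.^ e))) P))))) ⟩
  OddStep.V (const (+ (3 ℕ.^ e)) ⊛ (X′ ↑ k ⊛ P))
    ≈⟨ ≋-trans (OddStep.V-const (+ (3 ℕ.^ e)) _) (*-congˡ (proj₂ (proj₂ image))) ⟩
  const (+ (3 ℕ.^ e)) ⊛ (const (+ 9) ⊛ R)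
    ≈⟨ ≋-trans (≋-sym (*-assoc _ _ R)) (*-congʳ (const-3^ 2 e)) ⟩
  const (+ (3 ℕ.^ (2 ℕ.+ e))) ⊛ R ∎)
  where
  open ≋-Reasoning
  image : 9Even (OddStep.V (X′ ↑ k ⊛ P))
  image = OddStep.V-conjugate Odd-isSubmodule (triple-mem 9Even-isSubmodule) U₃-Odd k O

  R : Series
  R = proj₁ image

form-odd : ∀ {α k e} → parity α ≡ 0ℙ → parity (suc α) ≡ 1ℙ → HasForm Even α k e → HasForm Odd (suc α) (suc (k ℕ.* 3)) e
form-odd {α} {k} {e} p p′ (P , O , eq) = _ , EvenStep.V-conjugate (triple-mem Even-isSubmodule) Odd-isSubmodule V-Even k O , (begin
  X ↑ suc (k ℕ.* 3) ⊛ L (suc α)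
    ≈⟨ *-congˡ (L-suc-even {α} p p′) ⟩
  X ↑ suc (k ℕ.* 3) ⊛ U₃ (multiplier ⊛ L α)
    ≈⟨ ≋-sym (U₃-dilate (X ↑ suc (k ℕ.* 3)) (multiplier ⊛ L α)) ⟩
  U₃ (dilate (X ↑ suc (k ℕ.* 3)) ⊛ (multiplier ⊛ L α))
    ≈⟨ U₃-cong (≋-trans (*-congʳ (≋-trans (dilate-⊛ X (X ↑ (k ℕ.* 3))) (*-cong dilate-X (dilate-X↑ k))))
         (≋-trans (solve 5 (λ n a b m l → n :* (a :* b) :* (m :* l) := n :* m :* (b :* (a :* l))) ≋-refl N (X ↑ k) (X′ ↑ k) multiplier (L α))
         (*-cong N-multiplier (≋-trans (*-congˡ eq) (solve 3 (λ a c p → a :* (c :* p) := c :* (a :* p)) ≋-refl (X′ ↑ k) (const (+ (3 ℕ.^ e))) P))))) ⟩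
  EvenStep.V (const (+ (3 ℕ.^ e)) ⊛ (X′ ↑ k ⊛ P))
    ≈⟨ EvenStep.V-const (+ (3 ℕ.^ e)) _ ⟩
  const (+ (3 ℕ.^ e)) ⊛ EvenStep.V (X′ ↑ k ⊛ P) ∎)
  where open ≋-Reasoning

-- oddExponent m = ⌊3^(2m+2) / 8⌋

oddExponent : ℕ → ℕ
oddExponent zero    = 1
oddExponent (suc m) = suc (oddExponent m ℕ.* 3 ℕ.* 3)

parity-odd : ∀ m → parity (1 ℕ.+ m ℕ.* 2) ≡ 1ℙ
parity-odd zero    = refl
parity-odd (suc m) = parity-odd m

parity-even : ∀ m → parity (m ℕ.* 2) ≡ 0ℙ
parity-even zero    = refl
parity-even (suc m) = parity-even m

forms-odd : ∀ m → HasForm Odd (1 ℕ.+ m ℕ.* 2) (oddExponent m) (1 ℕ.+ m ℕ.* 2)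
forms-even : ∀ m → HasForm Even (2 ℕ.+ m ℕ.* 2) (oddExponent m ℕ.* 3) (3 ℕ.+ m ℕ.* 2)
forms-odd zero    = form-one
forms-odd (suc m) = form-odd {2 ℕ.+ m ℕ.* 2} {oddExponent m ℕ.* 3} {3 ℕ.+ m ℕ.* 2} (parity-even m) (parity-odd m) (forms-even m)
forms-even m      = form-even {1 ℕ.+ m ℕ.* 2} {oddExponent m} {1 ℕ.+ m ℕ.* 2} (parity-odd m) (parity-even m) (forms-odd m)

-- Modulo 8 the powers of 3 are 1 and 3 in turn, so the floor in ψ only removes this remainder.
3^-odd : ∀ m → 3 ℕ.^ (1 ℕ.+ m ℕ.* 2 ℕ.+ 1) ≡ 1 ℕ.+ oddExponent m ℕ.* 8
3^-odd zero    = refl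
3^-odd (suc m) = trans (cong (λ t → 3 ℕ.* (3 ℕ.* t)) (3^-odd m)) (lemma (oddExponent m))
  where
  lemma : ∀ j → 3 ℕ.* (3 ℕ.* (1 ℕ.+ j ℕ.* 8)) ≡ 1 ℕ.+ suc (j ℕ.* 3 ℕ.* 3) ℕ.* 8
  lemma = solve-∀

3^-even : ∀ m → 3 ℕ.^ (2 ℕ.+ m ℕ.* 2 ℕ.+ 1) ≡ 3 ℕ.+ oddExponent m ℕ.* 3 ℕ.* 8
3^-even m = trans (cong (3 ℕ.*_) (3^-odd m)) (lemma (oddExponent m))
  where
  lemma : ∀ j → 3 ℕ.* (1 ℕ.+ j ℕ.* 8) ≡ 3 ℕ.+ j ℕ.* 3 ℕ.* 8
  lemma = solve-∀

-- From lattice elements to integer polynomials in x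

Even⇒polynomial : ∀ {P} → Even P → ∃ λ cs → P ≋ evaluate cs x
Even⇒polynomial (h , (cs , p) , r) = 0ℤ ∷ weigh 2 cs , ≋-trans r (≋-trans (*-congˡ p) (≋-trans (≋-sym (eval-shift (weigh 2 cs) ξ))
  (≋-trans (eval-cong (0ℤ ∷ weigh 2 cs) ξ≋x) (≋-sym (evaluate≋eval (0ℤ ∷ weigh 2 cs) x)))))

Odd⇒polynomial : ∀ {P} → Odd P → ∃ λ cs → P ≋ evaluate cs x
Odd⇒polynomial {P} (c , m , (n , (h , (cs , p) , r) , e₂) , e₁) = ds , ≋-trans (≋-sym expansion) (≋-trans (eval-cong ds ξ≋x) (≋-sym (evaluate≋eval ds x)))
  where
  hs ds : List ℤ
  hs = 0ℤ ∷ weigh 4 cs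
  ds = c · γ-poly ⊞ + 9 · hs

  expansion : eval ds ξ ≋ P
  expansion = ≋-trans (eval-⊞ (c · γ-poly) (+ 9 · hs) ξ) (≋-trans (+-cong (eval-· c γ-poly ξ) (≋-trans (eval-· (+ 9) hs ξ)
    (*-congˡ (≋-trans (eval-shift (weigh 4 cs) ξ) (≋-trans (*-congˡ (≋-sym p)) (≋-sym r)))))) (≋-sym (≋-trans e₁ (+-congˡ e₂))))

*-cancel-/ : ∀ d .{{_ : ℕ.NonZero d}} z → (+ d ℤ.* z) ℚ./ d ≡ z ℚ./ 1
*-cancel-/ (suc d) z = ℚ.fromℚᵘ-cong {mkℚᵘ (+ suc d ℤ.* z) d} {mkℚᵘ z 0}
  (*≡* (trans (ℤ.*-identityʳ _) (ℤ.*-comm (+ suc d) z)))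

form⇒polynomial : ∀ {M} → (∀ {P} → M P → ∃ λ cs → P ≋ evaluate cs x) → ∀ α {k e k′ e′} → k ≡ k′ → e ≡ e′ → HasForm M α k e →
  (((1# Defs.+ const (+ 9) Defs.* x) ^ k′) Defs.* L α) ÷3^ e′ ∈ℤ[ x ]
form⇒polynomial {M} polynomial α {k} {e} refl refl (P , M-P , eq) = cs , λ n →
  trans (cong (λ a → (a ℚ./ (3 ℕ.^ e)) {{ℕ.m^n≢0 3 e}}) (coefficient n)) (*-cancel-/ (3 ℕ.^ e) {{ℕ.m^n≢0 3 e}} (evaluate cs x n))
  where
  cs : List ℤ
  cs = proj₁ (polynomial M-P)

  base : 1# Defs.+ const (+ 9) Defs.* x ≋ X
  base = ≋-trans (+≋⊕ _ _) (+-congˡ (≋-trans (*≋⊛ _ _) (≋-trans (*-congˡ (≋-sym ξ≋x))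
    (solve 1 (λ x → con (+ 9) :* x := x :* (con (+ 9) :+ x :* con 0ℤ)) ≋-refl ξ))))

  coefficient : ∀ n → (((1# Defs.+ const (+ 9) Defs.* x) ^ k) Defs.* L α) n ≡ + (3 ℕ.^ e) ℤ.* evaluate cs x n
  coefficient n = trans (≋-trans (*≋⊛ _ (L α)) (≋-trans (*-congʳ (≋-trans (^≋↑ _ k) (↑-cong k base))) (≋-trans eq (*-congˡ (proj₂ (polynomial M-P))))) at n)
    (const-⊛ (+ (3 ℕ.^ e)) (evaluate cs x) n)

data Half : ℕ → Set where
  odd  : ∀ m → Half (1 ℕ.+ m ℕ.* 2)
  even : ∀ m → Half (2 ℕ.+ m ℕ.* 2)

half : ∀ α → 1 ≤ α → Half α
half 1             _ = odd 0
half 2             _ = even 0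
half (suc (suc (suc α))) _ with half (suc α) (s≤s z≤n)
... | odd m  = odd (suc m)
... | even m = even (suc m)

Integral : ℕ → Set
Integral α =
    let ψ = (3 ℕ.^ (α ℕ.+ 1)) / 8
        β = 2 ℕ.* (α / 2) ℕ.+ 1
    in (((1# Defs.+ const (+ 9) Defs.* x) ^ ψ) Defs.* L α) ÷3^ β ∈ℤ[ x ]

integral-half : ∀ {α} → Half α → Integral α
integral-half (odd m)  = form⇒polynomial Odd⇒polynomial (1 ℕ.+ m ℕ.* 2)
  (sym (trans (cong (_/ 8) (3^-odd m)) ([m+n*8]/8 1 (oddExponent m))))
  (trans (ℕ.+-comm 1 (m ℕ.* 2)) (cong (ℕ._+ 1) (trans (ℕ.*-comm m 2) (cong (2 ℕ.*_) (sym (trans (+-distrib-/-∣ʳ 1 (n∣m*n m {2})) (m*n/n≡m m 2)))))))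
  (forms-odd m)
integral-half (even m) = form⇒polynomial Even⇒polynomial (2 ℕ.+ m ℕ.* 2)
  (sym (trans (cong (_/ 8) (3^-even m)) ([m+n*8]/8 3 (oddExponent m ℕ.* 3))))
  (trans (ℕ.+-comm 1 (suc m ℕ.* 2)) (cong (ℕ._+ 1) (trans (ℕ.*-comm (suc m) 2) (cong (2 ℕ.*_) (sym (m*n/n≡m (suc m) 2))))))
  (forms-even m)

open import Defs

theorem1p3 : (α : ℕ) → 1 ≤ α →
    let ψ = (3 ℕ.^ (α ℕ.+ 1)) / 8
        β = 2 ℕ.* (α / 2) ℕ.+ 1
    in (((1# + const (+ 9) * x) ^ ψ) * L α) ÷3^ β ∈ℤ[ x ]
theorem1p3 α 1≤α = integral-half (half α 1≤α)
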